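{- Let $\varepsilon > 0$ be a constant. Consider the random graph process $\{G_i\}_{i=0}^{\binom{n}{2}}$ on $n$ vertices and let $\tau_1 = \min\{m : \delta(G_m)\ge 1\}$ denote the step in which the last isolated vertex disappears. Then with high probability (as $n\to\infty$) $G_{\tau_1}$ is $(1/2-\varepsilon)$-resilient with respect to connectivity.
   Context: Random graph process: $G_0$ is the empty graph on $n$ vertices; for each $i\in\{1,\dots,\binom n2\}$, $G_i$ is obtained from $G_{i-1}$ by adding an edge $e\notin E(G_{i-1})$ chosen uniformly at random among the missing edges. With high probability: with probability tending to $1$ as $n\to\infty$. $\delta(G)$ denotes the minimum degree of $G$. $\alpha$-resilience: Let $G=(V,E)$ be a graph, $\mathcal P$ a monotone increasing graph property, and $\alpha$ a real constant. $G$ is $\alpha$-resilient with respect to $\mathcal P$ if for every spanning subgraph $H\subseteq G$ satisfying $\deg_H(v)\le \alpha\deg_G(v)$ for all $v\in V$, we have $G-H\in\mathcal P$, where $G-H$ is the graph on $V$ with edge set $E(G)\setminus E(H)$. -}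

module Defs where

open import Algebra.Properties.Group using (⁻¹-involutive)
open import Data.Bool.Base using (Bool; true; false; T; not; _∧_; _∨_; if_then_else_)
open import Data.Bool.Properties using (∧-comm; ∨-comm; T?)
open import Data.Fin.Base using (Fin; _<_)
open import Data.Fin.Properties using (_≟_; _<?_; <⇒≢)
open import Data.Fin.Subset using (Subset; ∣_∣)
open import Data.Integer.Base using (+_; 1ℤ)
open import Data.List.Base using
  (List; []; _∷_; [_]; map; concatMap; filter; mapMaybe; foldr; length; allFin; cartesianProduct)
open import Data.List.Extrema.Nat using (min)
open import Data.Maybe.Base as Maybe using (Maybe)
open import Data.Nat.Base as ℕ using (ℕ; zero; suc)
open import Data.Nat.Combinatorics using (_C_)
open import Data.Product.Base using (Σ-syntax; ∃; ∃-syntax; _×_; _,_)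
open import Data.Rational.Base as ℚ using (ℚ; 0ℚ; 1ℚ)
import Data.Rational.Properties as ℚ
open import Data.Sum.Base using (_⊎_; swap)
open import Data.Vec.Base as Vec using (Vec; tabulate)
open import Function.Bundles using (_⇔_; mk⇔; Equivalence)
open import Relation.Binary.Construct.Closure.ReflexiveTransitive as Star using (Star)
open import Relation.Binary.PropositionalEquality using (_≡_; refl; sym; cong; cong₂; subst; module ≡-Reasoning)
open import Relation.Nullary using (¬_; yes; no)
open import Relation.Nullary.Decidable using (does; dec⇒maybe; ¬?)

------------------------------------------------------------------------
-- Dedekind reals

record ℝ : Set₁ where
  field
    L U       : ℚ → Set
    L-inhab   : ∃ L
    U-inhab   : ∃ U
    L-rounded : ∀ q → L q ⇔ (∃[ r ] q ℚ.< r × L r)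
    U-rounded : ∀ q → U q ⇔ (∃[ r ] r ℚ.< q × U r)
    disjoint  : ∀ q → ¬ (L q × U q)
    located   : ∀ {q r} → q ℚ.< r → L q ⊎ U r

Positive : ℝ → Set
Positive x = ℝ.L x 0ℚ

private
  flip-< : ∀ p {q r} → q ℚ.< r → p ℚ.- r ℚ.< p ℚ.- q
  flip-< p q<r = ℚ.+-monoʳ-< p (ℚ.neg-antimono-< q<r)

  flip-flip : ∀ p q → p ℚ.- (p ℚ.- q) ≡ q
  flip-flip p q = begin
    p ℚ.- (p ℚ.- q)             ≡⟨ cong (p ℚ.+_) (ℚ.neg-distrib-+ p (ℚ.- q)) ⟩
    p ℚ.+ (ℚ.- p ℚ.- (ℚ.- q))   ≡⟨ ℚ.+-assoc p (ℚ.- p) (ℚ.- (ℚ.- q)) ⟨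
    p ℚ.- p ℚ.+ (ℚ.- (ℚ.- q))   ≡⟨ cong₂ ℚ._+_ (ℚ.+-inverseʳ p) (⁻¹-involutive ℚ.+-0-group q) ⟩
    0ℚ ℚ.+ q                    ≡⟨ ℚ.+-identityˡ q ⟩
    q                           ∎
    where open ≡-Reasoning

infix 6 _⊖_

_⊖_ : ℚ → ℝ → ℝ
p ⊖ x = record
  { L         = λ q → U (p ℚ.- q)
  ; U         = λ q → L (p ℚ.- q)
  ; L-inhab   = let (u , Uu) = U-inhab in p ℚ.- u , subst U (sym (flip-flip p u)) Uu
  ; U-inhab   = let (l , Ll) = L-inhab in p ℚ.- l , subst L (sym (flip-flip p l)) Ll
  ; L-rounded = λ q → mk⇔
      (λ Uq → let (r , r< , Ur) = to (U-rounded _) Uq in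
        p ℚ.- r ,
        subst (ℚ._< p ℚ.- r) (flip-flip p q) (flip-< p r<) ,
        subst U (sym (flip-flip p r)) Ur)
      (λ (r , q<r , Ur) → from (U-rounded _) (p ℚ.- r , flip-< p q<r , Ur))
  ; U-rounded = λ q → mk⇔
      (λ Lq → let (r , <r , Lr) = to (L-rounded _) Lq in
        p ℚ.- r ,
        subst (p ℚ.- r ℚ.<_) (flip-flip p q) (flip-< p <r) ,
        subst L (sym (flip-flip p r)) Lr)
      (λ (r , r<q , Lr) → from (L-rounded _) (p ℚ.- r , flip-< p r<q , Lr))
  ; disjoint  = λ q (Uq , Lq) → disjoint _ (Lq , Uq)
  ; located   = λ q<r → swap (located (flip-< p q<r))
  }
  where
  open ℝ x
  open Equivalence using (to; from)

ℕtoℚ : ℕ → ℚ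
ℕtoℚ k = + k ℚ./ 1

-- a ≤ x · b for a real x and naturals a, b: since b ≥ 0, this holds iff
-- a ≤ q b for every rational q > x.
infix 4 _≤_·_

_≤_·_ : ℕ → ℝ → ℕ → Set
a ≤ x · b = ∀ q → ℝ.U x q → ℕtoℚ a ℚ.≤ q ℚ.* ℕtoℚ b

------------------------------------------------------------------------
-- Simple graphs on the vertex set Fin n

record Graph (n : ℕ) : Set where
  field
    adj        : Fin n → Fin n → Bool
    adj-sym    : ∀ u v → adj u v ≡ adj v u
    adj-irrefl : ∀ v → adj v v ≡ false

  Adj : Fin n → Fin n → Set
  Adj u v = T (adj u v)

  neighbours : Fin n → Subset n
  neighbours v = tabulate (adj v)

  deg : Fin n → ℕ
  deg v = ∣ neighbours v ∣

open Graph public using (Adj; deg)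
open Graph using (adj; adj-sym; adj-irrefl)

-- Degrees are below n, so for n ≥ 1 the default value n does not affect
-- the minimum.
δ : ∀ {n} → Graph n → ℕ
δ {n} G = min n (map (deg G) (allFin n))

infix 4 _⊆_

_⊆_ : ∀ {n} → Graph n → Graph n → Set
H ⊆ G = ∀ u v → Adj H u v → Adj G u v

infixl 6 _∖_

_∖_ : ∀ {n} → Graph n → Graph n → Graph n
G ∖ H = record
  { adj        = λ u v → adj G u v ∧ not (adj H u v)
  ; adj-sym    = λ u v → cong₂ (λ a b → a ∧ not b) (adj-sym G u v) (adj-sym H u v)
  ; adj-irrefl = λ v → cong (_∧ not (adj H v v)) (adj-irrefl G v)
  }

emptyGraph : ∀ n → Graph n
emptyGraph n = record
  { adj        = λ _ _ → false
  ; adj-sym    = λ _ _ → refl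
  ; adj-irrefl = λ _ → refl
  }

-- Unordered pairs of distinct vertices, listed in increasing order.
Pair : ℕ → Set
Pair n = Σ[ (u , v) ∈ Fin n × Fin n ] u < v

pairs : ∀ n → List (Pair n)
pairs n = mapMaybe (λ (u , v) → Maybe.map ((u , v) ,_) (dec⇒maybe (u <? v)))
                   (cartesianProduct (allFin n) (allFin n))

missing : ∀ {n} → Graph n → List (Pair n)
missing {n} G = filter (λ ((u , v) , _) → ¬? (T? (adj G u v))) (pairs n)

addEdge : ∀ {n} → Graph n → Pair n → Graph n
addEdge {n} G ((u , v) , u<v) = record
  { adj        = λ x y → adj G x y ∨ joins x y
  ; adj-sym    = λ x y → cong₂ _∨_ (adj-sym G x y) (joins-sym x y)
  ; adj-irrefl = λ x → cong₂ _∨_ (adj-irrefl G x) (joins-irrefl x)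
  }
  where
  is : Fin n → Fin n → Bool
  is w x = does (x ≟ w)

  joins : Fin n → Fin n → Bool
  joins x y = (is u x ∧ is v y) ∨ (is v x ∧ is u y)

  joins-sym : ∀ x y → joins x y ≡ joins y x
  joins-sym x y
    rewrite ∧-comm (is u x) (is v y) | ∧-comm (is v x) (is u y)
    = ∨-comm (is v y ∧ is u x) (is u y ∧ is v x)

  joins-irrefl : ∀ x → joins x x ≡ false
  joins-irrefl x with x ≟ u | x ≟ v
  ... | no  _    | no  _ = refl
  ... | no  _    | yes _ = refl
  ... | yes _    | no  _ = refl
  ... | yes refl | yes x≡v with () ← <⇒≢ u<v x≡v

------------------------------------------------------------------------
-- Resilience

record MonotoneProperty : Set₁ where
  field
    holds : ∀ {n} → Graph n → Set
    mono  : ∀ {n} {G G′ : Graph n} → G ⊆ G′ → holds G → holds G′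

open MonotoneProperty public using (holds)

connectivity : MonotoneProperty
connectivity = record
  { holds = λ G → ∀ u v → Star (Adj G) u v
  ; mono  = λ G⊆G′ conn u v → Star.map (G⊆G′ _ _) (conn u v)
  }

Resilient : MonotoneProperty → ℝ → ∀ {n} → Graph n → Set
Resilient 𝒫 α G =
  ∀ H → H ⊆ G → (∀ v → deg H v ≤ α · deg G v) → holds 𝒫 (G ∖ H)

------------------------------------------------------------------------
-- Finite probability

-- Outcomes with their probabilities.
Dist : Set → Set
Dist A = List (ℚ × A)

return : ∀ {A : Set} → A → Dist A
return a = [ 1ℚ , a ]

infixl 1 _>>=_

_>>=_ : ∀ {A B : Set} → Dist A → (A → Dist B) → Dist B
μ >>= f = concatMap (λ (p , a) → map (λ (q , b) → p ℚ.* q , b) (f a)) μ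

-- The empty list has no uniform distribution; the clause for it is never
-- reached in the random graph process.
uniform : ∀ {A : Set} → List A → Dist A
uniform []          = []
uniform xs@(_ ∷ ys) = map (λ x → 1ℤ ℚ./ suc (length ys) , x) xs

Pr : ∀ {A : Set} → Dist A → (A → Bool) → ℚ
Pr μ B = foldr (λ (p , a) s → (if B a then p else 0ℚ) ℚ.+ s) 0ℚ μ

-- Pr A → 1.  An event involving real parameters need not be decidable, and
-- Pr only measures decidable ones; Pr A ≥ p is therefore expressed by a
-- decidable event B ⊆ A with Pr B ≥ p (classically one may take B = A).
WithHighProbability :
  {Ω : ℕ → Set} → (∀ n → Dist (Ω n)) → (∀ n → Ω n → Set) → Set
WithHighProbability {Ω} μ A =
  ∀ η → 0ℚ ℚ.< η →
  ∃[ N ] ∀ n → N ℕ.≤ n →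
  Σ[ B ∈ (Ω n → Bool) ] (∀ ω → T (B ω) → A n ω) × 1ℚ ℚ.- η ℚ.≤ Pr (μ n) B

------------------------------------------------------------------------
-- The random graph process

-- The sequence G = G₀, G₁, …, Gₖ obtained by k steps of the process from G.
run : ∀ {n} k → Graph n → Dist (Vec (Graph n) (suc k))
run zero    G = return (G Vec.∷ Vec.[])
run (suc k) G = uniform (missing G) >>= λ e →
                run k (addEdge G e) >>= λ Gs →
                return (G Vec.∷ Gs)

-- Entry i of an outcome is Gᵢ, for 0 ≤ i ≤ n C 2.
Trajectory : ℕ → Set
Trajectory n = Vec (Graph n) (suc (n C 2))

process : ∀ n → Dist (Trajectory n)
process n = run (n C 2) (emptyGraph n)

IsMin : ∀ {k} → (Fin k → Set) → Fin k → Set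
IsMin P m = P m × (∀ j → j < m → ¬ P j)

-- A potential is a nonnegative function f t G whose average over the next edge of the process is at
-- most f t G.  By Ville's maximal inequality it stays below 1 along the whole trajectory with
-- probability at least 1 - f 0 ∅, so every bad event only has to be dominated by a potential with
-- small initial value; being pointwise, such a bound also applies at the random time τ₁.
--
-- Let ℓ be of order log n, m₀ a suitable multiple of n ℓ, and m₁ = 2 m₀.  The sum of five potentials
-- gives: (A) up to time m₀ some vertex is isolated; (B) at time m₁ none is, so m₀ < τ₁ ≤ m₁; from
-- time m₀ to m₁, (C) no closed neighbourhood contains two vertices of degree at most ℓ, (D) a set of
-- at most n/D vertices spans fewer than ℓ/8 edges per vertex, and (E) for larger sets S of at most
-- n/2 vertices, (1 + 2/K) e(S, Sᶜ) > 2 e(S), where 1/K < ε.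
--
-- If G - H is disconnected, take a cut S with |S| ≤ n/2.  All edges leaving S lie in H, so every
-- vertex of S has at least (1/2 + 1/K) of its G-degree inside S, and summing over S contradicts (E)
-- if S is large.  If S is small, then every vertex of degree at most ℓ in S has a neighbour of larger
-- degree in S, and by (C) these neighbours are distinct; so at least half of the vertices of S have
-- degree more than ℓ, half of it inside S, which contradicts (D).

module Submission where

open import Data.Bool.Base as Bool using (Bool; true; false; not; if_then_else_; _∧_; _∨_)
open import Data.Fin.Base as Fin using (Fin; toℕ)
open import Data.Fin.Subset using (Subset)
import Data.Integer.Base as ℤ
import Data.Integer.Properties as ℤ
open import Data.List.Base as List using (List; length; allFin; map; _++_; []; _∷_)
open import Data.List.Membership.Propositional using (_∈_)
open import Data.List.Relation.Unary.Any using (here; there)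
open import Data.Nat.Base as ℕ using (ℕ; zero; suc; z≤n; s≤s)
import Data.Nat.Properties as ℕ
open import Data.Nat.Solver using () renaming (module +-*-Solver to ℕ-Solver)
open import Data.Product.Base using (_×_; _,_; proj₁; proj₂; ∃-syntax)
import Data.Rational.Unnormalised.Base as ℚᵘ
import Data.Rational.Unnormalised.Properties as ℚᵘ
open import Data.Sum.Base using (_⊎_; inj₁; inj₂)
open import Function.Base using (_∘_; const)
open import Function.Bundles using (Equivalence)
open import Relation.Binary.PropositionalEquality hiding (J)
open import Relation.Nullary using (¬_; Dec; yes; no; does; contradiction)
open import Relation.Nullary.Decidable using (dec-true; dec-false)
open ℕ-Solver using () renaming (solve to solve-ℕ; _:=_ to _:=ℕ_; _:+_ to _:+ℕ_; _:*_ to _:*ℕ_; con to conℕ)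

-- Except for (A), the potentials are sums of exponential weights `W G` times `r ^ (m ∸ t)`, where
-- `r` bounds the average factor by which one new edge multiplies `W`. The discount has run out at
-- time `m`, and `W` is at least 1 on the bad event. The choice of m₀ is squeezed by (A) and (C). At
-- m₀ about n exp(-2m₀/n) isolated vertices are left, and this must be large. For (C) there are n³
-- triples (two vertices and a common neighbour), the two edges to the neighbour give n⁻², and
-- avoiding both vertices gives exp(-4m₀/n), up to a factor 16^(2ℓ), a small power of n. So m₀ lies
-- between n log n / 4 and n log n / 2, and doubling it removes all isolated vertices. The rates
-- used, 11/5 and 7/2 for 2 and 4, leave room for the errors. No logarithm or exponential is used: ℓ
-- is the integer part of the logarithm of n to a fixed base `B`, time is cut into blocks of `k` =
-- n/22 steps, and Bernoulli's inequality compares the decay over a block with a fixed fraction.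
-- What remains are numerical inequalities between powers.

-- Rational arithmetic: embedded naturals, powers, Bernoulli's inequality, finite sums

module Rationals where

  open import Data.Integer.Base using (+_)
  open import Data.Rational.Base
  open import Data.Rational.Properties
  open import Data.Rational.Solver using (module +-*-Solver)
  open import Defs using (ℕtoℚ)
  open +-*-Solver using (solve; _:=_; _:+_; _:*_; _:-_; con)

  opaque
    -- Opaque, so that it acts as an abstract ordered semiring homomorphism and its values are never
    -- normalised as fractions.
    ι : ℕ → ℚ
    ι = ℕtoℚ

    ι≡ℕtoℚ : ∀ k → ι k ≡ ℕtoℚ k
    ι≡ℕtoℚ k = refl

    ι0 : ι 0 ≡ 0ℚ
    ι0 = refl

    ι1 : ι 1 ≡ 1ℚ
    ι1 = refl

    ι-+ : ∀ a b → ι (a ℕ.+ b) ≡ ι a + ι b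
    ι-+ a b = toℚᵘ-injective (begin
      toℚᵘ (ι (a ℕ.+ b))                       ≈⟨ toℚᵘ-fromℚᵘ (ℚᵘ.mkℚᵘ (+ (a ℕ.+ b)) 0) ⟩
      ℚᵘ.mkℚᵘ (+ (a ℕ.+ b)) 0                  ≈⟨ ℚᵘ.*≡* (cong (ℤ._* + 1) (cong₂ ℤ._+_ (ℤ.*-identityʳ (+ a)) (ℤ.*-identityʳ (+ b)))) ⟨
      ℚᵘ.mkℚᵘ (+ a) 0 ℚᵘ.+ ℚᵘ.mkℚᵘ (+ b) 0     ≈⟨ ℚᵘ.+-cong (toℚᵘ-fromℚᵘ (ℚᵘ.mkℚᵘ (+ a) 0)) (toℚᵘ-fromℚᵘ (ℚᵘ.mkℚᵘ (+ b) 0)) ⟨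
      toℚᵘ (ι a) ℚᵘ.+ toℚᵘ (ι b)               ≈⟨ toℚᵘ-homo-+ (ι a) (ι b) ⟨
      toℚᵘ (ι a + ι b)  ∎)
      where open ℚᵘ.≃-Reasoning

    ι-* : ∀ a b → ι (a ℕ.* b) ≡ ι a * ι b
    ι-* a b = toℚᵘ-injective (begin
      toℚᵘ (ι (a ℕ.* b))                       ≈⟨ toℚᵘ-fromℚᵘ (ℚᵘ.mkℚᵘ (+ (a ℕ.* b)) 0) ⟩
      ℚᵘ.mkℚᵘ (+ (a ℕ.* b)) 0                  ≈⟨ ℚᵘ.*≡* (cong (ℤ._* + 1) (ℤ.pos-* a b)) ⟩
      ℚᵘ.mkℚᵘ (+ a) 0 ℚᵘ.* ℚᵘ.mkℚᵘ (+ b) 0     ≈⟨ ℚᵘ.*-cong (toℚᵘ-fromℚᵘ (ℚᵘ.mkℚᵘ (+ a) 0)) (toℚᵘ-fromℚᵘ (ℚᵘ.mkℚᵘ (+ b) 0)) ⟨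
      toℚᵘ (ι a) ℚᵘ.* toℚᵘ (ι b)               ≈⟨ toℚᵘ-homo-* (ι a) (ι b) ⟨
      toℚᵘ (ι a * ι b)  ∎)
      where open ℚᵘ.≃-Reasoning

    ι-mono-≤ : ∀ {a b} → a ℕ.≤ b → ι a ≤ ι b
    ι-mono-≤ {a} {b} a≤b = toℚᵘ-cancel-≤ (begin
      toℚᵘ (ι a)       ≃⟨ toℚᵘ-fromℚᵘ (ℚᵘ.mkℚᵘ (+ a) 0) ⟩
      ℚᵘ.mkℚᵘ (+ a) 0  ≤⟨ ℚᵘ.*≤* (ℤ.*-monoʳ-≤-nonNeg (+ 1) (ℤ.+≤+ a≤b)) ⟩
      ℚᵘ.mkℚᵘ (+ b) 0  ≃⟨ toℚᵘ-fromℚᵘ (ℚᵘ.mkℚᵘ (+ b) 0) ⟨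
      toℚᵘ (ι b)  ∎)
      where open ℚᵘ.≤-Reasoning

    ι-cancel-≤ : ∀ {a b} → ι a ≤ ι b → a ℕ.≤ b
    ι-cancel-≤ {a} {b} ιa≤ιb = ℤ.drop‿+≤+ (ℤ.*-cancelʳ-≤-pos (+ a) (+ b) (+ 1) (ℚᵘ.drop-*≤* (begin
      ℚᵘ.mkℚᵘ (+ a) 0  ≃⟨ toℚᵘ-fromℚᵘ (ℚᵘ.mkℚᵘ (+ a) 0) ⟨
      toℚᵘ (ι a)  ≤⟨ toℚᵘ-mono-≤ ιa≤ιb ⟩
      toℚᵘ (ι b)       ≃⟨ toℚᵘ-fromℚᵘ (ℚᵘ.mkℚᵘ (+ b) 0) ⟩
      ℚᵘ.mkℚᵘ (+ b) 0  ∎)))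
      where open ℚᵘ.≤-Reasoning

  0≤ι : ∀ a → 0ℚ ≤ ι a
  0≤ι a = subst (_≤ ι a) ι0 (ι-mono-≤ ℕ.z≤n)

  infixr 8 _^_

  _^_ : ℚ → ℕ → ℚ
  p ^ zero  = 1ℚ
  p ^ suc k = p * p ^ k

  ^-homo-* : ∀ p j k → p ^ (j ℕ.+ k) ≡ p ^ j * p ^ k
  ^-homo-* p zero    k = sym (*-identityˡ (p ^ k))
  ^-homo-* p (suc j) k = trans (cong (p *_) (^-homo-* p j k)) (sym (*-assoc p (p ^ j) (p ^ k)))

  ^-distrib-* : ∀ p q k → (p * q) ^ k ≡ p ^ k * q ^ k
  ^-distrib-* p q zero    = refl
  ^-distrib-* p q (suc k) = trans (cong (p * q *_) (^-distrib-* p q k))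
    (solve 4 (λ p q x y → p :* q :* (x :* y) := p :* x :* (q :* y)) refl p q (p ^ k) (q ^ k))

  1^ : ∀ k → 1ℚ ^ k ≡ 1ℚ
  1^ zero    = refl
  1^ (suc k) = trans (*-identityˡ _) (1^ k)

  ^-assocʳ : ∀ p j k → (p ^ j) ^ k ≡ p ^ (j ℕ.* k)
  ^-assocʳ p zero    k = 1^ k
  ^-assocʳ p (suc j) k = begin
    (p * p ^ j) ^ k  ≡⟨ ^-distrib-* p (p ^ j) k ⟩
    p ^ k * (p ^ j) ^ k  ≡⟨ cong (p ^ k *_) (^-assocʳ p j k) ⟩
    p ^ k * p ^ (j ℕ.* k)  ≡⟨ ^-homo-* p k (j ℕ.* k) ⟨
    p ^ (k ℕ.+ j ℕ.* k)  ∎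
    where open ≡-Reasoning

  ι-^ : ∀ a k → ι (a ℕ.^ k) ≡ ι a ^ k
  ι-^ a zero    = ι1
  ι-^ a (suc k) = trans (ι-* a (a ℕ.^ k)) (cong (ι a *_) (ι-^ a k))

  ι-suc : ∀ k → ι (suc k) ≡ 1ℚ + ι k
  ι-suc k = trans (ι-+ 1 k) (cong (_+ ι k) ι1)

  0≤1 : 0ℚ ≤ 1ℚ
  0≤1 = subst (0ℚ ≤_) ι1 (0≤ι 1)

  0≤+ : ∀ {p q} → 0ℚ ≤ p → 0ℚ ≤ q → 0ℚ ≤ p + q
  0≤+ = +-mono-≤ {0ℚ} {_} {0ℚ}

  *-monoˡ : ∀ {p q} r → 0ℚ ≤ r → p ≤ q → r * p ≤ r * q
  *-monoˡ r 0≤r = *-monoˡ-≤-nonNeg r {{nonNegative 0≤r}}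

  *-monoʳ : ∀ {p q} r → 0ℚ ≤ r → p ≤ q → p * r ≤ q * r
  *-monoʳ r 0≤r = *-monoʳ-≤-nonNeg r {{nonNegative 0≤r}}

  0≤* : ∀ {p q} → 0ℚ ≤ p → 0ℚ ≤ q → 0ℚ ≤ p * q
  0≤* {p} 0≤p 0≤q = subst (_≤ p * _) (*-zeroʳ p) (*-monoˡ p 0≤p 0≤q)

  *-mono : ∀ {p q r s} → 0ℚ ≤ r → 0ℚ ≤ q → p ≤ q → r ≤ s → p * r ≤ q * s
  *-mono {p} {q} {r} 0≤r 0≤q p≤q r≤s = ≤-trans (*-monoʳ r 0≤r p≤q) (*-monoˡ q 0≤q r≤s)

  ≤-+ʳ : ∀ {p q r} → q ≡ p + r → 0ℚ ≤ r → p ≤ q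
  ≤-+ʳ {p} {q} {r} q≡p+r 0≤r = begin
    p  ≡⟨ +-identityʳ p ⟨
    p + 0ℚ  ≤⟨ +-monoʳ-≤ p 0≤r ⟩
    p + r  ≡⟨ q≡p+r ⟨
    q  ∎
    where open ≤-Reasoning

  p≤q⇒0≤q-p : ∀ {p q} → p ≤ q → 0ℚ ≤ q - p
  p≤q⇒0≤q-p {p} {q} p≤q = subst (_≤ q - p) (+-inverseʳ p) (+-monoˡ-≤ (- p) p≤q)

  0≤q-p⇒p≤q : ∀ {p q} → 0ℚ ≤ q - p → p ≤ q
  0≤q-p⇒p≤q {p} {q} = ≤-+ʳ (solve 2 (λ p q → q := p :+ (q :- p)) refl p q)


  0≤^ : ∀ {p} → 0ℚ ≤ p → ∀ k → 0ℚ ≤ p ^ k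
  0≤^ 0≤p zero    = 0≤1
  0≤^ 0≤p (suc k) = 0≤* 0≤p (0≤^ 0≤p k)

  ^-monoˡ : ∀ {p q} → 0ℚ ≤ p → p ≤ q → ∀ k → p ^ k ≤ q ^ k
  ^-monoˡ 0≤p p≤q zero    = ≤-refl
  ^-monoˡ 0≤p p≤q (suc k) = *-mono (0≤^ 0≤p k) (≤-trans 0≤p p≤q) p≤q (^-monoˡ 0≤p p≤q k)

  1≤^ : ∀ {p} → 1ℚ ≤ p → ∀ k → 1ℚ ≤ p ^ k
  1≤^ {p} 1≤p k = subst (_≤ p ^ k) (1^ k) (^-monoˡ 0≤1 1≤p k)

  ^≤1 : ∀ {p} → 0ℚ ≤ p → p ≤ 1ℚ → ∀ k → p ^ k ≤ 1ℚ
  ^≤1 {p} 0≤p p≤1 k = subst (p ^ k ≤_) (1^ k) (^-monoˡ 0≤p p≤1 k)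

  -- Replaces taking a k-th root: if p ≤ 1, then p^k ≤ p for k ≥ 1.
  1≤^⇒1≤ : ∀ {p} → 0ℚ ≤ p → ∀ k → 1 ℕ.≤ k → 1ℚ ≤ p ^ k → 1ℚ ≤ p
  1≤^⇒1≤ {p} 0≤p (suc k) _ 1≤p^k with ≤-total 1ℚ p
  ... | inj₁ 1≤p = 1≤p
  ... | inj₂ p≤1 = begin
    1ℚ  ≤⟨ 1≤p^k ⟩
    p * p ^ k  ≤⟨ *-monoˡ p 0≤p (^≤1 0≤p p≤1 k) ⟩
    p * 1ℚ  ≡⟨ *-identityʳ p ⟩
    p  ∎
    where open ≤-Reasoning

  ^-monoʳ : ∀ {p} → 1ℚ ≤ p → ∀ {j k} → j ℕ.≤ k → p ^ j ≤ p ^ k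
  ^-monoʳ {p} 1≤p {j} {k} j≤k = begin
    p ^ j  ≡⟨ *-identityʳ (p ^ j) ⟨
    p ^ j * 1ℚ  ≤⟨ *-monoˡ (p ^ j) (0≤^ (≤-trans 0≤1 1≤p) j) (1≤^ 1≤p (k ℕ.∸ j)) ⟩
    p ^ j * p ^ (k ℕ.∸ j)  ≡⟨ ^-homo-* p j (k ℕ.∸ j) ⟨
    p ^ (j ℕ.+ (k ℕ.∸ j))  ≡⟨ cong (p ^_) (ℕ.m+[n∸m]≡n j≤k) ⟩
    p ^ k  ∎
    where open ≤-Reasoning

  ^-antiʳ : ∀ {p} → 0ℚ ≤ p → p ≤ 1ℚ → ∀ {j k} → j ℕ.≤ k → p ^ k ≤ p ^ j
  ^-antiʳ {p} 0≤p p≤1 {j} {k} j≤k = begin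
    p ^ k  ≡⟨ cong (p ^_) (ℕ.m+[n∸m]≡n j≤k) ⟨
    p ^ (j ℕ.+ (k ℕ.∸ j))  ≡⟨ ^-homo-* p j (k ℕ.∸ j) ⟩
    p ^ j * p ^ (k ℕ.∸ j)  ≤⟨ *-monoˡ (p ^ j) (0≤^ 0≤p j) (^≤1 0≤p p≤1 (k ℕ.∸ j)) ⟩
    p ^ j * 1ℚ  ≡⟨ *-identityʳ (p ^ j) ⟩
    p ^ j  ∎
    where open ≤-Reasoning

  0≤p² : ∀ p → 0ℚ ≤ p * p
  0≤p² p with ≤-total 0ℚ p
  ... | inj₁ 0≤p = 0≤* 0≤p 0≤p
  ... | inj₂ p≤0 = subst (0ℚ ≤_) (solve 1 (λ p → (con 0ℚ :- p) :* (con 0ℚ :- p) := p :* p) refl p)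
                     (0≤* (p≤q⇒0≤q-p p≤0) (p≤q⇒0≤q-p p≤0))

  -- The induction step has the excess k x². Stands in for estimates by the exponential function;
  -- negative `x` bounds a decay from below.
  bernoulli : ∀ x → 0ℚ ≤ 1ℚ + x → ∀ k → 1ℚ + ι k * x ≤ (1ℚ + x) ^ k
  bernoulli x 0≤1+x zero    = ≤-reflexive (trans (cong (λ z → 1ℚ + z * x) ι0) (solve 1 (λ x → con 1ℚ :+ con 0ℚ :* x := con 1ℚ) refl x))
  bernoulli x 0≤1+x (suc k) = begin
    1ℚ + ι (suc k) * x  ≡⟨ cong (λ z → 1ℚ + z * x) (ι-suc k) ⟩
    1ℚ + (1ℚ + ι k) * x  ≤⟨ ≤-+ʳ (solve 2 (λ x k → (con 1ℚ :+ x) :* (con 1ℚ :+ k :* x) := con 1ℚ :+ (con 1ℚ :+ k) :* x :+ k :* (x :* x)) refl x (ι k)) (0≤* (0≤ι k) (0≤p² x)) ⟩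
    (1ℚ + x) * (1ℚ + ι k * x)  ≤⟨ *-monoˡ (1ℚ + x) 0≤1+x (bernoulli x 0≤1+x k) ⟩
    (1ℚ + x) * (1ℚ + x) ^ k  ∎
    where open ≤-Reasoning

  -- Bounds a decay from above: p ≤ 1/(1 + x) gives p^k ≤ 1/(1 + kx), with denominators cleared.
  inverse-bernoulli : ∀ {p x} → 0ℚ ≤ p → 0ℚ ≤ x → p * (1ℚ + x) ≤ 1ℚ →
                      ∀ k → p ^ k * (1ℚ + ι k * x) ≤ 1ℚ
  inverse-bernoulli {p} {x} 0≤p 0≤x px≤1 k = begin
    p ^ k * (1ℚ + ι k * x)  ≤⟨ *-monoˡ (p ^ k) (0≤^ 0≤p k) (bernoulli x (0≤+ 0≤1 0≤x) k) ⟩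
    p ^ k * (1ℚ + x) ^ k  ≡⟨ ^-distrib-* p (1ℚ + x) k ⟨
    (p * (1ℚ + x)) ^ k  ≤⟨ ^≤1 (0≤* 0≤p (0≤+ 0≤1 0≤x)) px≤1 k ⟩
    1ℚ  ∎
    where open ≤-Reasoning

  private variable
    A B : Set

  ∑ : List A → (A → ℚ) → ℚ
  ∑ []       f = 0ℚ
  ∑ (x ∷ xs) f = f x + ∑ xs f

  ∑-mono : ∀ (xs : List A) {f g} → (∀ {x} → x ∈ xs → f x ≤ g x) → ∑ xs f ≤ ∑ xs g
  ∑-mono []       f≤g = ≤-refl
  ∑-mono (x ∷ xs) f≤g = +-mono-≤ (f≤g (here refl)) (∑-mono xs (f≤g ∘ there))

  ∑-cong : ∀ (xs : List A) {f g} → (∀ x → f x ≡ g x) → ∑ xs f ≡ ∑ xs g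
  ∑-cong []       f≡g = refl
  ∑-cong (x ∷ xs) f≡g = cong₂ _+_ (f≡g x) (∑-cong xs f≡g)

  0≤∑ : ∀ (xs : List A) {f} → (∀ x → 0ℚ ≤ f x) → 0ℚ ≤ ∑ xs f
  0≤∑ []       0≤f = ≤-refl
  0≤∑ (x ∷ xs) 0≤f = 0≤+ (0≤f x) (0≤∑ xs 0≤f)

  ∑-+ : ∀ (xs : List A) f g → ∑ xs (λ x → f x + g x) ≡ ∑ xs f + ∑ xs g
  ∑-+ []       f g = refl
  ∑-+ (x ∷ xs) f g = trans (cong (_+_ (f x + g x)) (∑-+ xs f g))
    (solve 4 (λ a b c d → a :+ b :+ (c :+ d) := a :+ c :+ (b :+ d)) refl (f x) (g x) (∑ xs f) (∑ xs g))

  ∑-*ˡ : ∀ (xs : List A) c f → ∑ xs (λ x → c * f x) ≡ c * ∑ xs f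
  ∑-*ˡ []       c f = sym (*-zeroʳ c)
  ∑-*ˡ (x ∷ xs) c f = trans (cong (_+_ (c * f x)) (∑-*ˡ xs c f)) (sym (*-distribˡ-+ c (f x) (∑ xs f)))

  ∑-*ʳ : ∀ (xs : List A) c f → ∑ xs (λ x → f x * c) ≡ ∑ xs f * c
  ∑-*ʳ xs c f = trans (∑-cong xs (λ x → *-comm (f x) c)) (trans (∑-*ˡ xs c f) (*-comm c (∑ xs f)))

  ∑-const : ∀ (xs : List A) c → ∑ xs (λ _ → c) ≡ ι (length xs) * c
  ∑-const []       c = sym (trans (cong (_* c) ι0) (*-zeroˡ c))
  ∑-const (x ∷ xs) c = begin
    c + ∑ xs (λ _ → c)  ≡⟨ cong (_+_ c) (∑-const xs c) ⟩
    c + ι (length xs) * c  ≡⟨ solve 2 (λ c k → c :+ k :* c := (con 1ℚ :+ k) :* c) refl c (ι (length xs)) ⟩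
    (1ℚ + ι (length xs)) * c  ≡⟨ cong (_* c) (ι-suc (length xs)) ⟨
    ι (suc (length xs)) * c  ∎
    where open ≡-Reasoning

  ∑-zero : ∀ (xs : List A) → ∑ xs (λ _ → 0ℚ) ≡ 0ℚ
  ∑-zero xs = trans (∑-const xs 0ℚ) (*-zeroʳ (ι (length xs)))

  ∑-comm : ∀ (xs : List A) (ys : List B) (f : A → B → ℚ) →
           ∑ xs (λ x → ∑ ys (f x)) ≡ ∑ ys (λ y → ∑ xs (λ x → f x y))
  ∑-comm []       ys f = sym (∑-zero ys)
  ∑-comm (x ∷ xs) ys f = trans (cong (_+_ (∑ ys (f x))) (∑-comm xs ys f)) (sym (∑-+ ys (f x) (λ y → ∑ xs (λ x → f x y))))

  ∑-++ : ∀ (xs ys : List A) f → ∑ (xs ++ ys) f ≡ ∑ xs f + ∑ ys f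
  ∑-++ []       ys f = sym (+-identityˡ _)
  ∑-++ (x ∷ xs) ys f = trans (cong (_+_ (f x)) (∑-++ xs ys f)) (sym (+-assoc (f x) _ _))

  ∑-map : ∀ (h : A → B) xs f → ∑ (map h xs) f ≡ ∑ xs (f ∘ h)
  ∑-map h []       f = refl
  ∑-map h (x ∷ xs) f = cong (_+_ (f (h x))) (∑-map h xs f)

  ∈⇒≤∑ : ∀ {xs : List A} {f} → (∀ x → 0ℚ ≤ f x) → ∀ {x} → x ∈ xs → f x ≤ ∑ xs f
  ∈⇒≤∑ {xs = _ ∷ xs} {f} 0≤f {x} (here refl) = ≤-+ʳ refl (0≤∑ xs 0≤f)
  ∈⇒≤∑ {xs = y ∷ xs} {f} 0≤f {x} (there x∈) =
    ≤-trans (∈⇒≤∑ 0≤f x∈) (≤-+ʳ (+-comm (f y) (∑ xs f)) (0≤f y))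

-- Transfer between ℕ and ℚ, and certificates for inequalities

module Casts where

  open import Data.Bool.Base using (T)
  open import Data.Rational.Base
  open import Data.Rational.Properties
  open import Data.Rational.Solver using (module +-*-Solver)
  open import Data.Vec.Base using (Vec; lookup)
  open import Defs using (ℕtoℚ)
  open Rationals

  open +-*-Solver using (solve; _:=_; _:+_; _:*_; _:-_)

  infixl 6 _⊕_
  infixl 7 _⊗_

  -- Reified polynomials, for moving (in)equalities between ℕ and ℚ.
  data Expr (k : ℕ) : Set where
    var     : Fin k → Expr k
    #_      : ℕ → Expr k
    _⊕_ _⊗_ : Expr k → Expr k → Expr k

  ⟦_⟧ℕ : ∀ {k} → Expr k → Vec ℕ k → ℕ
  ⟦ var i ⟧ℕ ρ = lookup ρ i
  ⟦ # c ⟧ℕ   ρ = c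
  ⟦ a ⊕ b ⟧ℕ ρ = ⟦ a ⟧ℕ ρ ℕ.+ ⟦ b ⟧ℕ ρ
  ⟦ a ⊗ b ⟧ℕ ρ = ⟦ a ⟧ℕ ρ ℕ.* ⟦ b ⟧ℕ ρ

  ⟦_⟧ℚ : ∀ {k} → Expr k → Vec ℕ k → ℚ
  ⟦ var i ⟧ℚ ρ = ι (lookup ρ i)
  ⟦ # c ⟧ℚ   ρ = ℕtoℚ c
  ⟦ a ⊕ b ⟧ℚ ρ = ⟦ a ⟧ℚ ρ + ⟦ b ⟧ℚ ρ
  ⟦ a ⊗ b ⟧ℚ ρ = ⟦ a ⟧ℚ ρ * ⟦ b ⟧ℚ ρ

  ι-⟦⟧ : ∀ {k} (a : Expr k) ρ → ι (⟦ a ⟧ℕ ρ) ≡ ⟦ a ⟧ℚ ρ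
  ι-⟦⟧ (var i) ρ = refl
  ι-⟦⟧ (# c)   ρ = ι≡ℕtoℚ c
  ι-⟦⟧ (a ⊕ b) ρ = trans (ι-+ (⟦ a ⟧ℕ ρ) (⟦ b ⟧ℕ ρ)) (cong₂ _+_ (ι-⟦⟧ a ρ) (ι-⟦⟧ b ρ))
  ι-⟦⟧ (a ⊗ b) ρ = trans (ι-* (⟦ a ⟧ℕ ρ) (⟦ b ⟧ℕ ρ)) (cong₂ _*_ (ι-⟦⟧ a ρ) (ι-⟦⟧ b ρ))

  cast-≤ : ∀ {k} (ρ : Vec ℕ k) (a b : Expr k) → ⟦ a ⟧ℕ ρ ℕ.≤ ⟦ b ⟧ℕ ρ → ⟦ a ⟧ℚ ρ ≤ ⟦ b ⟧ℚ ρ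
  cast-≤ ρ a b a≤b = subst₂ _≤_ (ι-⟦⟧ a ρ) (ι-⟦⟧ b ρ) (ι-mono-≤ a≤b)

  cast-≡ : ∀ {k} (ρ : Vec ℕ k) (a b : Expr k) → ⟦ a ⟧ℕ ρ ≡ ⟦ b ⟧ℕ ρ → ⟦ a ⟧ℚ ρ ≡ ⟦ b ⟧ℚ ρ
  cast-≡ ρ a b a≡b = trans (sym (ι-⟦⟧ a ρ)) (trans (cong ι a≡b) (ι-⟦⟧ b ρ))

  uncast-≤ : ∀ {k} (ρ : Vec ℕ k) (a b : Expr k) → ⟦ a ⟧ℚ ρ ≤ ⟦ b ⟧ℚ ρ → ⟦ a ⟧ℕ ρ ℕ.≤ ⟦ b ⟧ℕ ρ
  uncast-≤ ρ a b a≤b = ι-cancel-≤ (subst₂ _≤_ (sym (ι-⟦⟧ a ρ)) (sym (ι-⟦⟧ b ρ)) a≤b)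

  ≥0 : ∀ p {_ : T (0ℚ ≤ᵇ p)} → 0ℚ ≤ p
  ≥0 p {0≤p} = ≤ᵇ⇒≤ 0≤p

  ≤-by : ∀ {p q r} → q - p ≡ r → 0ℚ ≤ r → p ≤ q
  ≤-by q-p≡r 0≤r = 0≤q-p⇒p≤q (subst (0ℚ ≤_) (sym q-p≡r) 0≤r)

  -- A certificate in the style of the Positivstellensatz: modulo the relation x = y, the difference
  -- q - p is a visibly nonnegative r. The ring solver checks the identity, so an application
  -- consists of the multiplier `c` and the decomposition.
  ≤-modulo : ∀ {p q r x y} c → x ≡ y → q - p ≡ r + c * (x - y) → 0ℚ ≤ r → p ≤ q
  ≤-modulo {r = r} {x} c refl q-p≡ = ≤-by (trans q-p≡
    (solve 3 (λ r c x → r :+ c :* (x :- x) := r) refl r c x))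

-- Weighted edge counts and the effect of one new edge

module EdgeCounts where

  open import Data.Bool.Base using (T)
  open import Data.Bool.Properties using (¬-not)
  open import Data.Fin.Base using (zero; suc; _<_)
  open import Data.Fin.Properties using (_≟_; _<?_; <-cmp; <⇒≢)
  open import Data.Fin.Subset using (∣_∣)
  open import Data.List.Base using (mapMaybe; filter; cartesianProduct)
  open import Data.Nat.ListAction using () renaming (sum to sumₗ)
  open import Data.List.Membership.Propositional.Properties using (∈-filter⁻)
  open import Data.Maybe.Base as Maybe using (Maybe; just; nothing; maybe′)
  open import Data.Nat.Base using (_+_; _*_; _≤_)
  open import Data.Nat.Properties hiding (_≟_; _<?_; <-cmp; <⇒≢)
  open import Data.Nat.Solver using (module +-*-Solver)
  import Data.Vec.Base as Vec
  open import Relation.Binary.Definitions using (tri<; tri≈; tri>)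
  open import Relation.Nullary.Decidable using (dec⇒maybe)
  open import Relation.Unary using (Decidable)
  open import Algebra.Properties.Semiring.Sum +-*-semiring public
    using (sum; ∑-distrib-+; ∑-comm; sum-cong-≗; *-distribˡ-sum; *-distribʳ-sum; sum-syntax)
  open import Defs
  open Graph using (adj; adj-sym; adj-irrefl)
  open +-*-Solver using (solve; _:=_; _:+_; _:*_; con)

  private variable
    n : ℕ
    A B : Set

  χ : Bool → ℕ
  χ true  = 1
  χ false = 0

  χ≤1 : ∀ b → χ b ≤ 1
  χ≤1 true  = s≤s z≤n
  χ≤1 false = z≤n

  χ-not : ∀ b → χ (not b) + χ b ≡ 1
  χ-not true  = refl
  χ-not false = refl

  ⟦_≡_⟧ : Fin n → Fin n → ℕ
  ⟦ x ≡ y ⟧ = χ (does (x ≟ y))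

  sum-mono : {f g : Fin n → ℕ} → (∀ i → f i ≤ g i) → sum f ≤ sum g
  sum-mono {zero}  f≤g = z≤n
  sum-mono {suc n} f≤g = +-mono-≤ (f≤g zero) (sum-mono (f≤g ∘ suc))

  sum-const : ∀ n c → ∑[ i < n ] c ≡ n * c
  sum-const zero    c = refl
  sum-const (suc n) c = cong (c +_) (sum-const n c)

  sum-zero : ∀ n → ∑[ i < n ] 0 ≡ 0
  sum-zero n = trans (sum-const n 0) (*-zeroʳ n)

  term≤sum : (f : Fin n → ℕ) (i : Fin n) → f i ≤ sum f
  term≤sum f zero    = m≤m+n (f zero) _
  term≤sum f (suc i) = ≤-trans (term≤sum (f ∘ suc) i) (m≤n+m _ (f zero))

  sum-δ : (u : Fin n) (f : Fin n → ℕ) → ∑[ x < n ] (⟦ x ≡ u ⟧ * f x) ≡ f u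
  sum-δ {suc n} zero    f = begin
    f zero + 0 + ∑[ x < n ] (⟦ suc x ≡ zero ⟧ * f (suc x))  ≡⟨ cong₂ _+_ (+-identityʳ (f zero)) (sum-zero n) ⟩
    f zero + 0  ≡⟨ +-identityʳ (f zero) ⟩
    f zero  ∎
    where open ≡-Reasoning
  sum-δ {suc n} (suc u) f = sum-δ u (f ∘ suc)

  sum-χ≡ : (u : Fin n) → ∑[ x < n ] ⟦ x ≡ u ⟧ ≡ 1
  sum-χ≡ u = trans (sum-cong-≗ (λ x → sym (*-identityʳ ⟦ x ≡ u ⟧))) (sum-δ u (const 1))

  ∑∑ : (Fin n → Fin n → ℕ) → ℕ
  ∑∑ {n} F = ∑[ x < n ] ∑[ y < n ] F x y

  ∑∑-cong : {F F′ : Fin n → Fin n → ℕ} → (∀ x y → F x y ≡ F′ x y) → ∑∑ F ≡ ∑∑ F′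
  ∑∑-cong F≡F′ = sum-cong-≗ (λ x → sum-cong-≗ (F≡F′ x))

  ∑∑-mono : {F F′ : Fin n → Fin n → ℕ} → (∀ x y → F x y ≤ F′ x y) → ∑∑ F ≤ ∑∑ F′
  ∑∑-mono F≤F′ = sum-mono (λ x → sum-mono (F≤F′ x))

  ∑∑-+ : (F F′ : Fin n → Fin n → ℕ) → ∑∑ (λ x y → F x y + F′ x y) ≡ ∑∑ F + ∑∑ F′
  ∑∑-+ {n} F F′ = trans (sum-cong-≗ (λ x → ∑-distrib-+ (F x) (F′ x))) (∑-distrib-+ (sum ∘ F) (sum ∘ F′))

  ∑∑-flip : (F : Fin n → Fin n → ℕ) → ∑∑ F ≡ ∑∑ (λ x y → F y x)
  ∑∑-flip F = ∑-comm F

  ∑∑-product : (f g : Fin n → ℕ) → ∑∑ (λ x y → f x * g y) ≡ sum f * sum g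
  ∑∑-product f g = trans (sum-cong-≗ (λ x → sym (*-distribˡ-sum (f x) g))) (sym (*-distribʳ-sum (sum g) f))

  ∑∑-δ : (u v : Fin n) (F : Fin n → Fin n → ℕ) → ∑∑ (λ x y → ⟦ x ≡ u ⟧ * (⟦ y ≡ v ⟧ * F x y)) ≡ F u v
  ∑∑-δ u v F = trans (sum-cong-≗ (λ x → trans (sym (*-distribˡ-sum ⟦ x ≡ u ⟧ (λ y → ⟦ y ≡ v ⟧ * F x y))) (cong (⟦ x ≡ u ⟧ *_) (sum-δ v (F x)))))
                     (sum-δ u (λ x → F x v))

  ∑ₗ : List A → (A → ℕ) → ℕ
  ∑ₗ xs f = sumₗ (map f xs)

  ∑ₗ-++ : ∀ (xs ys : List A) f → ∑ₗ (xs ++ ys) f ≡ ∑ₗ xs f + ∑ₗ ys f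
  ∑ₗ-++ []       ys f = refl
  ∑ₗ-++ (x ∷ xs) ys f = trans (cong (f x +_) (∑ₗ-++ xs ys f)) (sym (+-assoc (f x) _ _))

  ∑ₗ-map : ∀ (h : A → B) xs f → ∑ₗ (map h xs) f ≡ ∑ₗ xs (f ∘ h)
  ∑ₗ-map h []       f = refl
  ∑ₗ-map h (x ∷ xs) f = cong (f (h x) +_) (∑ₗ-map h xs f)

  ∑ₗ-mapMaybe : ∀ (p : A → Maybe B) xs f → ∑ₗ (mapMaybe p xs) f ≡ ∑ₗ xs (λ x → maybe′ f 0 (p x))
  ∑ₗ-mapMaybe p []       f = refl
  ∑ₗ-mapMaybe p (x ∷ xs) f with p x
  ... | just y  = cong (f y +_) (∑ₗ-mapMaybe p xs f)
  ... | nothing = ∑ₗ-mapMaybe p xs f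

  ∑ₗ-filter : ∀ {P : A → Set} (P? : Decidable P) xs f → ∑ₗ (filter P? xs) f ≡ ∑ₗ xs (λ x → χ (does (P? x)) * f x)
  ∑ₗ-filter P? []       f = refl
  ∑ₗ-filter P? (x ∷ xs) f with does (P? x)
  ... | true  = cong₂ _+_ (sym (+-identityʳ (f x))) (∑ₗ-filter P? xs f)
  ... | false = ∑ₗ-filter P? xs f

  ∑ₗ-tabulate : ∀ (h : Fin n → A) f → ∑ₗ (List.tabulate h) f ≡ sum (f ∘ h)
  ∑ₗ-tabulate {zero}  h f = refl
  ∑ₗ-tabulate {suc n} h f = cong (f (h zero) +_) (∑ₗ-tabulate (h ∘ suc) f)

  ∑ₗ-cartesianProduct : ∀ (xs : List A) (ys : List B) f →
                        ∑ₗ (cartesianProduct xs ys) f ≡ ∑ₗ xs (λ x → ∑ₗ ys (λ y → f (x , y)))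
  ∑ₗ-cartesianProduct []       ys f = refl
  ∑ₗ-cartesianProduct (x ∷ xs) ys f = trans (∑ₗ-++ (map (x ,_) ys) _ f)
    (cong₂ _+_ (∑ₗ-map (x ,_) ys f) (∑ₗ-cartesianProduct xs ys f))

  ∑ₗ-const : ∀ (xs : List A) c → ∑ₗ xs (const c) ≡ length xs * c
  ∑ₗ-const []       c = refl
  ∑ₗ-const (x ∷ xs) c = cong (c +_) (∑ₗ-const xs c)

  ⟦_<_⟧ : Fin n → Fin n → ℕ
  ⟦ x < y ⟧ = χ (does (x <? y))

  ∑ₗ-pairs : ∀ n (F : Fin n → Fin n → ℕ) →
             ∑ₗ (pairs n) (λ ((u , v) , _) → F u v) ≡ ∑∑ (λ x y → ⟦ x < y ⟧ * F x y)
  ∑ₗ-pairs n F = begin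
    ∑ₗ (pairs n) (λ ((u , v) , _) → F u v)  ≡⟨ ∑ₗ-mapMaybe _ (cartesianProduct (allFin n) (allFin n)) (λ ((u , v) , _) → F u v) ⟩
    ∑ₗ (cartesianProduct (allFin n) (allFin n)) h  ≡⟨ ∑ₗ-cartesianProduct (allFin n) (allFin n) h ⟩
    ∑ₗ (allFin n) (λ x → ∑ₗ (allFin n) (λ y → h (x , y)))  ≡⟨ ∑ₗ-tabulate {n} _ (λ x → ∑ₗ (allFin n) (λ y → h (x , y))) ⟩
    (∑[ x < n ] ∑ₗ (allFin n) (λ y → h (x , y)))  ≡⟨ sum-cong-≗ {n} (λ x → ∑ₗ-tabulate {n} _ (λ y → h (x , y))) ⟩
    (∑[ x < n ] ∑[ y < n ] h (x , y))  ≡⟨ ∑∑-cong {n} pointwise ⟩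
    ∑∑ (λ x y → ⟦ x < y ⟧ * F x y)  ∎
    where
    open ≡-Reasoning
    h : Fin n × Fin n → ℕ
    h (x , y) = maybe′ (λ ((u , v) , _) → F u v) 0 (Maybe.map {B = Pair n} ((x , y) ,_) (dec⇒maybe (x <? y)))
    decided : ∀ x y (x<?y : Dec (x < y)) →
              maybe′ (λ ((u , v) , _) → F u v) 0 (Maybe.map {B = Pair n} ((x , y) ,_) (dec⇒maybe x<?y)) ≡ χ (does x<?y) * F x y
    decided x y (yes _) = sym (+-identityʳ (F x y))
    decided x y (no _)  = refl
    pointwise : ∀ x y → h (x , y) ≡ ⟦ x < y ⟧ * F x y
    pointwise x y = decided x y (x <? y)

  -- Every edge is counted in both directions.
  count : (Fin n → Fin n → ℕ) → Graph n → ℕ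
  count F G = ∑∑ (λ x y → χ (adj G x y) * F x y)

  diagonal : (Fin n → Fin n → ℕ) → ℕ
  diagonal {n} F = ∑[ x < n ] F x x

  -- The contribution of an edge to `count F`, in both orientations. An asymmetric `F` expresses
  -- degrees and edges leaving a set.
  symmetrise : (Fin n → Fin n → ℕ) → Pair n → ℕ
  symmetrise F ((u , v) , _) = F u v + F v u

  -- An ordered pair is diagonal, adjacent or missing. This determines the total weight of the
  -- candidates for the next edge, and so every average taken over that edge.
  ∑-missing : ∀ (G : Graph n) F → ∑ₗ (missing G) (symmetrise F) + count F G + diagonal F ≡ ∑∑ F
  ∑-missing {n} G F = begin
    ∑ₗ (missing G) (symmetrise F) + count F G + diagonal F
      ≡⟨ cong₂ (λ a b → a + count F G + b) missing≡ diagonal≡ ⟩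
    ∑∑ (λ x y → (⟦ x < y ⟧ + ⟦ y < x ⟧) * g x y) + count F G + ∑∑ (λ x y → ⟦ y ≡ x ⟧ * F x y)
      ≡⟨ trans (cong (_+ ∑∑ (λ x y → ⟦ y ≡ x ⟧ * F x y)) (sym (∑∑-+ {n} _ _))) (sym (∑∑-+ {n} _ _)) ⟩
    ∑∑ (λ x y → (⟦ x < y ⟧ + ⟦ y < x ⟧) * g x y + χ (adj G x y) * F x y + ⟦ y ≡ x ⟧ * F x y)
      ≡⟨ ∑∑-cong pointwise ⟩
    ∑∑ F ∎
    where
    open ≡-Reasoning
    g : Fin n → Fin n → ℕ
    g x y = χ (not (adj G x y)) * F x y

    missing≡ : ∑ₗ (missing G) (symmetrise F) ≡ ∑∑ (λ x y → (⟦ x < y ⟧ + ⟦ y < x ⟧) * g x y)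
    missing≡ = begin
      ∑ₗ (missing G) (symmetrise F)
        ≡⟨ ∑ₗ-filter _ (pairs n) (symmetrise F) ⟩
      ∑ₗ (pairs n) (λ ((u , v) , _) → χ (not (adj G u v)) * (F u v + F v u))
        ≡⟨ ∑ₗ-pairs n (λ u v → χ (not (adj G u v)) * (F u v + F v u)) ⟩
      ∑∑ (λ x y → ⟦ x < y ⟧ * (χ (not (adj G x y)) * (F x y + F y x)))
        ≡⟨ ∑∑-cong (λ x y → trans (cong (⟦ x < y ⟧ *_) (trans (*-distribˡ-+ (χ (not (adj G x y))) (F x y) (F y x))
             (cong (λ b → g x y + χ (not b) * F y x) (adj-sym G x y)))) (*-distribˡ-+ ⟦ x < y ⟧ (g x y) (g y x))) ⟩
      ∑∑ (λ x y → ⟦ x < y ⟧ * g x y + ⟦ x < y ⟧ * g y x)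
        ≡⟨ ∑∑-+ {n} _ _ ⟩
      ∑∑ (λ x y → ⟦ x < y ⟧ * g x y) + ∑∑ (λ x y → ⟦ x < y ⟧ * g y x)
        ≡⟨ cong (∑∑ (λ x y → ⟦ x < y ⟧ * g x y) +_) (∑∑-flip {n} _) ⟩
      ∑∑ (λ x y → ⟦ x < y ⟧ * g x y) + ∑∑ (λ x y → ⟦ y < x ⟧ * g x y)
        ≡⟨ ∑∑-+ {n} _ _ ⟨
      ∑∑ (λ x y → ⟦ x < y ⟧ * g x y + ⟦ y < x ⟧ * g x y)
        ≡⟨ ∑∑-cong (λ x y → *-distribʳ-+ (g x y) ⟦ x < y ⟧ ⟦ y < x ⟧) ⟨
      ∑∑ (λ x y → (⟦ x < y ⟧ + ⟦ y < x ⟧) * g x y) ∎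

    diagonal≡ : diagonal F ≡ ∑∑ (λ x y → ⟦ y ≡ x ⟧ * F x y)
    diagonal≡ = sum-cong-≗ (λ x → sym (sum-δ x (F x)))

    off-diagonal : ∀ b f → (χ (not b) * f + 0) + χ b * f + 0 ≡ f
    off-diagonal true  f = trans (+-identityʳ _) (+-identityʳ f)
    off-diagonal false f = trans (+-identityʳ _) (trans (+-identityʳ _) (trans (+-identityʳ _) (+-identityʳ f)))

    pointwise : ∀ x y → (⟦ x < y ⟧ + ⟦ y < x ⟧) * g x y + χ (adj G x y) * F x y + ⟦ y ≡ x ⟧ * F x y ≡ F x y
    pointwise x y with <-cmp x y
    ... | tri< x<y x≢y x≯y rewrite dec-true (x <? y) x<y | dec-false (y <? x) x≯y | dec-false (y ≟ x) (x≢y ∘ sym) =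
      off-diagonal (adj G x y) (F x y)
    ... | tri> x≮y x≢y y<x rewrite dec-true (y <? x) y<x | dec-false (x <? y) x≮y | dec-false (y ≟ x) (x≢y ∘ sym) =
      off-diagonal (adj G x y) (F x y)
    ... | tri≈ x≮x refl _ rewrite dec-false (x <? x) x≮x | dec-true (x ≟ x) refl | adj-irrefl G x = +-identityʳ (F x x)

  ∈-missing⇒¬adj : ∀ (G : Graph n) {u v u<v} → ((u , v) , u<v) ∈ missing G → adj G u v ≡ false
  ∈-missing⇒¬adj {n} G {u} {v} e∈ = ¬-not (λ adj≡true → proj₂ (∈-filter⁻ _ {xs = pairs n} e∈) (subst T (sym adj≡true) _))

  count-addEdge : ∀ (G : Graph n) F {e} → e ∈ missing G → count F (addEdge G e) ≡ count F G + symmetrise F e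
  count-addEdge {n} G F {(u , v) , u<v} e∈ = begin
    ∑∑ (λ x y → χ (adj (addEdge G ((u , v) , u<v)) x y) * F x y)
      ≡⟨ ∑∑-cong pointwise ⟩
    ∑∑ (λ x y → χ (adj G x y) * F x y + (⟦ x ≡ u ⟧ * (⟦ y ≡ v ⟧ * F x y) + ⟦ x ≡ v ⟧ * (⟦ y ≡ u ⟧ * F x y)))
      ≡⟨ trans (∑∑-+ {n} _ _) (cong (count F G +_) (∑∑-+ {n} _ _)) ⟩
    count F G + (∑∑ (λ x y → ⟦ x ≡ u ⟧ * (⟦ y ≡ v ⟧ * F x y)) + ∑∑ (λ x y → ⟦ x ≡ v ⟧ * (⟦ y ≡ u ⟧ * F x y)))
      ≡⟨ cong (count F G +_) (cong₂ _+_ (∑∑-δ u v F) (∑∑-δ v u F)) ⟩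
    count F G + (F u v + F v u) ∎
    where
    open ≡-Reasoning
    u≢v : u ≢ v
    u≢v = <⇒≢ u<v
    unchanged : ∀ b f → χ (b ∨ false) * f ≡ χ b * f + 0
    unchanged true  f = sym (+-identityʳ _)
    unchanged false f = refl
    pointwise : ∀ x y → χ (adj (addEdge G ((u , v) , u<v)) x y) * F x y ≡
                χ (adj G x y) * F x y + (⟦ x ≡ u ⟧ * (⟦ y ≡ v ⟧ * F x y) + ⟦ x ≡ v ⟧ * (⟦ y ≡ u ⟧ * F x y))
    pointwise x y with x ≟ u | y ≟ v | x ≟ v | y ≟ u
    ... | yes refl | _ | yes refl | _ = contradiction refl u≢v
    ... | _ | yes refl | _ | yes refl = contradiction refl u≢v
    -- Only at the two orientations of the new edge does it matter that the edge was missing: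
    -- otherwise the disjunction would add nothing.
    ... | yes refl | yes refl | no _ | no _ rewrite ∈-missing⇒¬adj G {u<v = u<v} e∈ =
      solve 1 (λ f → f :+ con 0 := f :+ con 0 :+ con 0 :+ con 0) refl (F u v)
    ... | no _ | no _ | yes refl | yes refl rewrite adj-sym G v u | ∈-missing⇒¬adj G {u<v = u<v} e∈ =
      solve 1 (λ f → f :+ con 0 := f :+ con 0 :+ con 0) refl (F v u)
    ... | yes _ | no _ | no _ | yes _ = unchanged (adj G x y) (F x y)
    ... | yes _ | no _ | no _ | no _ = unchanged (adj G x y) (F x y)
    ... | no _ | yes _ | yes _ | no _ = unchanged (adj G x y) (F x y)
    ... | no _ | yes _ | no _ | no _ = unchanged (adj G x y) (F x y)
    ... | no _ | no _ | yes _ | no _ = unchanged (adj G x y) (F x y)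
    ... | no _ | no _ | no _ | yes _ = unchanged (adj G x y) (F x y)
    ... | no _ | no _ | no _ | no _ = unchanged (adj G x y) (F x y)

  count-empty : ∀ (F : Fin n → Fin n → ℕ) → count F (emptyGraph n) ≡ 0
  count-empty {n} F = trans (sum-cong-≗ {n} (λ x → sum-zero n)) (sum-zero n)

  ∣tabulate∣ : (f : Fin n → Bool) → ∣ Vec.tabulate f ∣ ≡ ∑[ x < n ] χ (f x)
  ∣tabulate∣ {zero}  f = refl
  ∣tabulate∣ {suc n} f with f zero
  ... | true  = cong suc (∣tabulate∣ (f ∘ suc))
  ... | false = ∣tabulate∣ (f ∘ suc)

  deg≡sum : ∀ (G : Graph n) v → deg G v ≡ ∑[ y < n ] χ (adj G v y)
  deg≡sum G v = ∣tabulate∣ (adj G v)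

  deg≡count : ∀ (G : Graph n) v → deg G v ≡ count (λ x _ → ⟦ x ≡ v ⟧) G
  deg≡count {n} G v = begin
    deg G v  ≡⟨ deg≡sum G v ⟩
    (∑[ y < n ] χ (adj G v y))  ≡⟨ sum-δ v (λ x → ∑[ y < n ] χ (adj G x y)) ⟨
    (∑[ x < n ] (⟦ x ≡ v ⟧ * ∑[ y < n ] χ (adj G x y)))
      ≡⟨ sum-cong-≗ (λ x → trans (*-comm ⟦ x ≡ v ⟧ _) (*-distribʳ-sum ⟦ x ≡ v ⟧ (λ y → χ (adj G x y)))) ⟩
    count (λ x _ → ⟦ x ≡ v ⟧) G  ∎
    where open ≡-Reasoning

  length-missing : ∀ (G : Graph n) → length (missing G) * 2 + count (λ _ _ → 1) G + n ≡ n * n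
  length-missing {n} G = begin
    length (missing G) * 2 + count (λ _ _ → 1) G + n
      ≡⟨ cong₂ (λ a b → a + count (λ _ _ → 1) G + b) (sym (∑ₗ-const (missing G) 2)) (sym (trans (sum-const n 1) (*-identityʳ n))) ⟩
    ∑ₗ (missing G) (const 2) + count (λ _ _ → 1) G + diagonal {n} (λ _ _ → 1)
      ≡⟨ ∑-missing G (λ _ _ → 1) ⟩
    ∑∑ {n} (λ _ _ → 1)
      ≡⟨ trans (sum-cong-≗ {n} (λ _ → trans (sum-const n 1) (*-identityʳ n))) (sum-const n n) ⟩
    n * n ∎
    where open ≡-Reasoning

-- The random process and Ville's maximal inequality

module EdgeProcess where

  open import Data.Bool.Base using (T)
  open import Data.Bool.Properties using (T-∧)
  open import Data.Fin.Base using (zero; suc)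
  open import Data.Integer.Base using (+_; 1ℤ)
  open import Data.Nat.Combinatorics using (_C_; nCk+nC[k+1]≡[n+1]C[k+1]; nC1≡n)
  open import Data.Rational.Base
  open import Data.Rational.Properties
  open import Data.Rational.Solver using (module +-*-Solver)
  open import Data.Vec.Base using (Vec; []; _∷_; lookup)
  open import Relation.Nullary.Decidable using (toWitness; isYes)
  open import Defs
  open Rationals
  open EdgeCounts using (count; count-addEdge; length-missing)
  open +-*-Solver using (solve; _:=_; _:+_; _:*_; _:-_; con)

  private variable
    n : ℕ
    A B : Set

  E : Dist A → (A → ℚ) → ℚ
  E μ φ = ∑ μ (λ (p , a) → p * φ a)

  𝟙 : Bool → ℚ
  𝟙 b = if b then 1ℚ else 0ℚ

  0≤𝟙 : ∀ b → 0ℚ ≤ 𝟙 b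
  0≤𝟙 true  = 0≤1
  0≤𝟙 false = ≤-refl

  Pr≡E : (μ : Dist A) (B : A → Bool) → Pr μ B ≡ E μ (𝟙 ∘ B)
  Pr≡E []            B = refl
  Pr≡E ((p , a) ∷ μ) B = cong₂ _+_ (helper (B a)) (Pr≡E μ B)
    where
    helper : ∀ b → (if b then p else 0ℚ) ≡ p * 𝟙 b
    helper true  = sym (*-identityʳ p)
    helper false = sym (*-zeroʳ p)

  E->>= : (μ : Dist A) (f : A → Dist B) (φ : B → ℚ) → E (μ >>= f) φ ≡ E μ (λ a → E (f a) φ)
  E->>= []            f φ = refl
  E->>= ((p , a) ∷ μ) f φ = begin
    E (map _ (f a) ++ (μ >>= f)) φ  ≡⟨ ∑-++ (map _ (f a)) (μ >>= f) _ ⟩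
    E (map (λ (q , b) → p * q , b) (f a)) φ + E (μ >>= f) φ ≡⟨ cong₂ _+_ scaled (E->>= μ f φ) ⟩
    p * E (f a) φ + E μ (λ a → E (f a) φ)  ∎
    where
    open ≡-Reasoning
    scaled : E (map (λ (q , b) → p * q , b) (f a)) φ ≡ p * E (f a) φ
    scaled = begin
      E (map (λ (q , b) → p * q , b) (f a)) φ  ≡⟨ ∑-map (λ (q , b) → p * q , b) (f a) _ ⟩
      ∑ (f a) (λ (q , b) → p * q * φ b)  ≡⟨ ∑-cong (f a) (λ (q , b) → *-assoc p q (φ b)) ⟩
      ∑ (f a) (λ (q , b) → p * (q * φ b))  ≡⟨ ∑-*ˡ (f a) p _ ⟩
      p * E (f a) φ  ∎

  E-return : (a : A) (φ : A → ℚ) → E (return a) φ ≡ φ a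
  E-return a φ = trans (+-identityʳ _) (*-identityˡ (φ a))

  1/suc : ∀ k → ι (suc k) * (1ℤ / suc k) ≡ 1ℚ
  1/suc k = toℚᵘ-injective (begin
    toℚᵘ (ι (suc k) * (1ℤ / suc k))                     ≈⟨ toℚᵘ-homo-* (ι (suc k)) (1ℤ / suc k) ⟩
    toℚᵘ (ι (suc k)) ℚᵘ.* toℚᵘ (1ℤ / suc k)  ≡⟨ cong (λ x → toℚᵘ x ℚᵘ.* toℚᵘ (1ℤ / suc k)) (ι≡ℕtoℚ (suc k)) ⟩
    toℚᵘ (+ suc k / 1) ℚᵘ.* toℚᵘ (1ℤ / suc k)
      ≈⟨ ℚᵘ.*-cong (toℚᵘ-fromℚᵘ (ℚᵘ.mkℚᵘ (+ suc k) 0)) (toℚᵘ-fromℚᵘ (ℚᵘ.mkℚᵘ 1ℤ k)) ⟩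
    ℚᵘ.mkℚᵘ (+ suc k) 0 ℚᵘ.* ℚᵘ.1/ ℚᵘ.mkℚᵘ (+ suc k) 0  ≈⟨ ℚᵘ.*-inverseʳ (ℚᵘ.mkℚᵘ (+ suc k) 0) ⟩
    toℚᵘ 1ℚ  ∎)
    where open ℚᵘ.≃-Reasoning

  0≤1/suc : ∀ k → 0ℚ ≤ 1ℤ / suc k
  0≤1/suc k = nonNegative⁻¹ (1ℤ / suc k) {{normalize-nonNeg 1 (suc k)}}

  E-uniform : (x : A) (xs : List A) (φ : A → ℚ) →
              E (uniform (x ∷ xs)) φ ≡ (1ℤ / suc (length xs)) * ∑ (x ∷ xs) φ
  E-uniform x xs φ = trans (∑-map (λ x → 1ℤ / suc (length xs) , x) (x ∷ xs) (λ (p , a) → p * φ a))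
                           (∑-*ˡ (x ∷ xs) (1ℤ / suc (length xs)) φ)

  run-suc : ∀ k (G : Graph n) B →
            Pr (run (suc k) G) B ≡ E (uniform (missing G)) (λ e → Pr (run k (addEdge G e)) (B ∘ (G ∷_)))
  run-suc k G B = begin
    Pr (run (suc k) G) B
      ≡⟨ Pr≡E (run (suc k) G) B ⟩
    E (run (suc k) G) (𝟙 ∘ B)
      ≡⟨ E->>= (uniform (missing G)) _ (𝟙 ∘ B) ⟩
    E (uniform (missing G)) (λ e → E (run k (addEdge G e) >>= λ Gs → return (G ∷ Gs)) (𝟙 ∘ B))
      ≡⟨ ∑-cong (uniform (missing G)) (λ (p , e) → cong (p *_) (inner e)) ⟩
    E (uniform (missing G)) (λ e → Pr (run k (addEdge G e)) (B ∘ (G ∷_))) ∎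
    where
    open ≡-Reasoning
    inner : ∀ e → E (run k (addEdge G e) >>= λ Gs → return (G ∷ Gs)) (𝟙 ∘ B) ≡ Pr (run k (addEdge G e)) (B ∘ (G ∷_))
    inner e = begin
      E (run k (addEdge G e) >>= λ Gs → return (G ∷ Gs)) (𝟙 ∘ B)
        ≡⟨ E->>= (run k (addEdge G e)) (λ Gs → return (G ∷ Gs)) (𝟙 ∘ B) ⟩
      E (run k (addEdge G e)) (λ Gs → E (return (G ∷ Gs)) (𝟙 ∘ B))
        ≡⟨ ∑-cong (run k (addEdge G e)) (λ (p , Gs) → cong (p *_) (E-return (G ∷ Gs) (𝟙 ∘ B))) ⟩
      E (run k (addEdge G e)) (𝟙 ∘ B ∘ (G ∷_))
        ≡⟨ Pr≡E (run k (addEdge G e)) (B ∘ (G ∷_)) ⟨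
      Pr (run k (addEdge G e)) (B ∘ (G ∷_)) ∎

  0≤Pr-run : ∀ k (G : Graph n) B → 0ℚ ≤ Pr (run k G) B
  0≤Pr-run zero    G B = ≤-trans (0≤𝟙 (B (G ∷ []))) (≤-reflexive (sym (trans (Pr≡E (run zero G) B) (E-return (G ∷ []) (𝟙 ∘ B)))))
  0≤Pr-run (suc k) G B = subst (0ℚ ≤_) (sym (run-suc k G B)) (0≤average (missing G))
    where
    0≤average : ∀ es → 0ℚ ≤ E (uniform es) (λ e → Pr (run k (addEdge G e)) (B ∘ (G ∷_)))
    0≤average []       = ≤-refl
    0≤average (e ∷ es) = subst (0ℚ ≤_) (sym (E-uniform e es _))
      (0≤* (0≤1/suc (length es)) (0≤∑ (e ∷ es) (λ e → 0≤Pr-run k (addEdge G e) (B ∘ (G ∷_)))))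

  edges : Graph n → ℕ
  edges = count (λ _ _ → 1)

  edges-addEdge : ∀ (G : Graph n) {e t} → e ∈ missing G → edges G ≡ t ℕ.* 2 → edges (addEdge G e) ≡ suc t ℕ.* 2
  edges-addEdge G {t = t} e∈ edges≡ = trans (count-addEdge G _ e∈) (trans (cong (ℕ._+ 2) edges≡) (ℕ.+-comm (t ℕ.* 2) 2))

  length-missing-addEdge : ∀ (G : Graph n) {e} → e ∈ missing G → suc (length (missing (addEdge G e))) ≡ length (missing G)
  length-missing-addEdge {n} G {e} e∈ = ℕ.*-cancelʳ-≡ _ _ 2 (ℕ.+-cancelʳ-≡ (edges G ℕ.+ n) _ _ (begin
    suc l′ ℕ.* 2 ℕ.+ (edges G ℕ.+ n)  ≡⟨ solve-ℕ 3 (λ l c n → conℕ 2 :+ℕ l :*ℕ conℕ 2 :+ℕ (c :+ℕ n) :=ℕ l :*ℕ conℕ 2 :+ℕ (c :+ℕ conℕ 2) :+ℕ n) refl l′ (edges G) n ⟩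
    l′ ℕ.* 2 ℕ.+ (edges G ℕ.+ 2) ℕ.+ n  ≡⟨ cong (λ c → l′ ℕ.* 2 ℕ.+ c ℕ.+ n) (count-addEdge G _ e∈) ⟨
    l′ ℕ.* 2 ℕ.+ edges (addEdge G e) ℕ.+ n ≡⟨ length-missing (addEdge G e) ⟩
    n ℕ.* n  ≡⟨ length-missing G ⟨
    l ℕ.* 2 ℕ.+ edges G ℕ.+ n  ≡⟨ ℕ.+-assoc (l ℕ.* 2) (edges G) n ⟩
    l ℕ.* 2 ℕ.+ (edges G ℕ.+ n)  ∎))
    where
    open ≡-Reasoning
    l = length (missing G)
    l′ = length (missing (addEdge G e))

  nC2 : ∀ n → (n C 2) ℕ.* 2 ℕ.+ n ≡ n ℕ.* n
  nC2 zero    = refl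
  nC2 (suc n) = begin
    (suc n C 2) ℕ.* 2 ℕ.+ suc n  ≡⟨ cong (λ c → c ℕ.* 2 ℕ.+ suc n) (nCk+nC[k+1]≡[n+1]C[k+1] n 1) ⟨
    (n C 1 ℕ.+ n C 2) ℕ.* 2 ℕ.+ suc n  ≡⟨ cong (λ c → (c ℕ.+ n C 2) ℕ.* 2 ℕ.+ suc n) (nC1≡n n) ⟩
    (n ℕ.+ n C 2) ℕ.* 2 ℕ.+ suc n  ≡⟨ solve-ℕ 2 (λ n c → (n :+ℕ c) :*ℕ conℕ 2 :+ℕ (conℕ 1 :+ℕ n) :=ℕ conℕ 1 :+ℕ (n :+ℕ n :+ℕ (c :*ℕ conℕ 2 :+ℕ n))) refl n (n C 2) ⟩
    suc (n ℕ.+ n ℕ.+ ((n C 2) ℕ.* 2 ℕ.+ n)) ≡⟨ cong (λ c → suc (n ℕ.+ n ℕ.+ c)) (nC2 n) ⟩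
    suc (n ℕ.+ n ℕ.+ n ℕ.* n)  ≡⟨ solve-ℕ 1 (λ n → conℕ 1 :+ℕ (n :+ℕ n :+ℕ n :*ℕ n) :=ℕ (conℕ 1 :+ℕ n) :*ℕ (conℕ 1 :+ℕ n)) refl n ⟩
    suc n ℕ.* suc n  ∎
    where open ≡-Reasoning

  -- Averages are multiplied by the number of missing edges, which includes the complete graph
  -- without a division. At time `t` only graphs with `t` edges can occur, and `edges` counts each
  -- of them twice.
  Supermartingale : (ℕ → Graph n → ℚ) → Set
  Supermartingale {n} f = ∀ t (G : Graph n) → edges G ≡ t ℕ.* 2 →
    ∑ (missing G) (λ e → f (suc t) (addEdge G e)) ≤ ι (length (missing G)) * f t G

  below1 : (ℕ → Graph n → ℚ) → ℕ → ∀ {k} → Vec (Graph n) k → Bool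
  below1 f t []       = true
  below1 f t (G ∷ Gs) = isYes (f t G <? 1ℚ) ∧ below1 f (suc t) Gs

  below1-lookup : ∀ (f : ℕ → Graph n → ℚ) t {k} (Gs : Vec (Graph n) k) → T (below1 f t Gs) →
                  ∀ i → f (t ℕ.+ toℕ i) (lookup Gs i) < 1ℚ
  below1-lookup f t (G ∷ Gs) below zero    = subst (λ s → f s G < 1ℚ) (sym (ℕ.+-identityʳ t))
    (toWitness {a? = f t G <? 1ℚ} (proj₁ (Equivalence.to (T-∧ {isYes (f t G <? 1ℚ)}) below)))
  below1-lookup f t (G ∷ Gs) below (suc i) = subst (λ s → f s (lookup Gs i) < 1ℚ) (sym (ℕ.+-suc t (toℕ i)))
    (below1-lookup f (suc t) Gs (proj₂ (Equivalence.to (T-∧ {isYes (f t G <? 1ℚ)}) below)) i)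

  -- Recursion on the remaining steps in place of a stopping time. If `f t G` is at least 1 the
  -- lower bound is not positive; otherwise staying below 1 depends on the future alone, and 1 - f
  -- does not decrease on average.
  ville : ∀ {f : ℕ → Graph n → ℚ} → (∀ t G → 0ℚ ≤ f t G) → Supermartingale f →
          ∀ k t G → length (missing G) ≡ k → edges G ≡ t ℕ.* 2 → 1ℚ - f t G ≤ Pr (run k G) (below1 f t)
  ville {n} {f} 0≤f step k t G length≡ edges≡ with f t G <? 1ℚ in eq
  ... | no  f≮1 = ≤-trans (0≤q-p⇒p≤q (subst (0ℚ ≤_) (solve 1 (λ x → x :- con 1ℚ := con 0ℚ :- (con 1ℚ :- x)) refl (f t G)) (p≤q⇒0≤q-p (≮⇒≥ f≮1))))
                          (0≤Pr-run k G (below1 f t))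
  ... | yes f<1 = go k length≡
    where
    open ≤-Reasoning
    1-f≤1 : 1ℚ - f t G ≤ 1ℚ
    1-f≤1 = ≤-+ʳ (solve 1 (λ x → con 1ℚ := con 1ℚ :- x :+ x) refl (f t G)) (0≤f t G)
    below : ∀ {j} (Gs : Vec (Graph n) j) → below1 f t (G ∷ Gs) ≡ below1 f (suc t) Gs
    below Gs = cong (λ d → isYes d ∧ below1 f (suc t) Gs) eq
    go : ∀ k → length (missing G) ≡ k → 1ℚ - f t G ≤ Pr (run k G) (below1 f t)
    go zero    length≡ = begin
      1ℚ - f t G  ≤⟨ 1-f≤1 ⟩
      𝟙 true  ≡⟨ cong 𝟙 (below []) ⟨
      𝟙 (below1 f t (G ∷ []))  ≡⟨ E-return (G ∷ []) (𝟙 ∘ below1 f t) ⟨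
      E (run zero G) (𝟙 ∘ below1 f t)  ≡⟨ Pr≡E (run zero G) (below1 f t) ⟨
      Pr (run zero G) (below1 f t)  ∎
    go (suc k) length≡ = begin
      1ℚ - f t G
        ≤⟨ average (missing G) length≡ (step t G edges≡) next ⟩
      E (uniform (missing G)) (λ e → Pr (run k (addEdge G e)) (below1 f t ∘ (G ∷_)))
        ≡⟨ run-suc k G (below1 f t) ⟨
      Pr (run (suc k) G) (below1 f t) ∎
      where
      g Prₑ : Pair n → ℚ
      g e = f (suc t) (addEdge G e)
      Prₑ e = Pr (run k (addEdge G e)) (below1 f t ∘ (G ∷_))
      next : ∀ {e} → e ∈ missing G → 1ℚ - f (suc t) (addEdge G e) ≤ Prₑ e
      next {e} e∈ = begin
        1ℚ - f (suc t) (addEdge G e)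
          ≤⟨ ville 0≤f step k (suc t) (addEdge G e) (ℕ.suc-injective (trans (length-missing-addEdge G e∈) length≡)) (edges-addEdge G {t = t} e∈ edges≡) ⟩
        Pr (run k (addEdge G e)) (below1 f (suc t))
          ≡⟨ trans (Pr≡E (run k (addEdge G e)) _) (trans (∑-cong (run k (addEdge G e)) (λ (p , Gs) → cong (λ b → p * 𝟙 b) (sym (below Gs)))) (sym (Pr≡E (run k (addEdge G e)) _))) ⟩
        Prₑ e ∎
      average : ∀ es → length es ≡ suc k → ∑ es g ≤ ι (length es) * f t G →
                (∀ {e} → e ∈ es → 1ℚ - g e ≤ Prₑ e) → 1ℚ - f t G ≤ E (uniform es) Prₑ
      average (e ∷ es) _ step-es next-es = begin
        1ℚ - f t G
          -- Inserts `c * M` = 1, the uniform probability times the number of missing edges, so that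
          -- the undivided supermartingale inequality applies.
          ≡⟨ trans (sym (*-identityˡ _)) (cong (_* (1ℚ - f t G)) (sym (trans (*-comm c _) (1/suc (length es))))) ⟩
        c * M * (1ℚ - f t G)
          ≡⟨ solve 3 (λ c M x → c :* M :* (con 1ℚ :- x) := c :* (M :- M :* x)) refl c M (f t G) ⟩
        c * (M - M * f t G)
          ≤⟨ *-monoˡ c (0≤1/suc (length es)) (+-monoʳ-≤ M (neg-antimono-≤ step-es)) ⟩
        c * (M - ∑ (e ∷ es) (λ e → f (suc t) (addEdge G e)))
          ≡⟨ cong (c *_) difference ⟩
        c * ∑ (e ∷ es) (λ e → 1ℚ - f (suc t) (addEdge G e))
          ≤⟨ *-monoˡ c (0≤1/suc (length es)) (∑-mono (e ∷ es) next-es) ⟩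
        c * ∑ (e ∷ es) Prₑ
          ≡⟨ E-uniform e es Prₑ ⟨
        E (uniform (e ∷ es)) Prₑ ∎
        where
        c = 1ℤ / suc (length es)
        M = ι (length (e ∷ es))
        difference : M - ∑ (e ∷ es) g ≡ ∑ (e ∷ es) (λ e → 1ℚ - g e)
        difference = begin-equality
          M - ∑ (e ∷ es) g
            ≡⟨ solve 2 (λ M s → M :- s := M :* con 1ℚ :+ con (- 1ℚ) :* s) refl M (∑ (e ∷ es) g) ⟩
          M * 1ℚ + - 1ℚ * ∑ (e ∷ es) g
            ≡⟨ cong₂ _+_ (sym (∑-const (e ∷ es) 1ℚ)) (sym (∑-*ˡ (e ∷ es) (- 1ℚ) g)) ⟩
          ∑ (e ∷ es) (λ _ → 1ℚ) + ∑ (e ∷ es) (λ e → - 1ℚ * g e)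
            ≡⟨ sym (∑-+ (e ∷ es) (λ _ → 1ℚ) (λ e → - 1ℚ * g e)) ⟩
          ∑ (e ∷ es) (λ e → 1ℚ + - 1ℚ * g e)
            ≡⟨ ∑-cong (e ∷ es) (λ e → solve 1 (λ x → con 1ℚ :+ con (- 1ℚ) :* x := con 1ℚ :- x) refl (g e)) ⟩
          ∑ (e ∷ es) (λ e → 1ℚ - g e) ∎


-- Average growth of a weight in one step; isolated vertices

module Growth where

  open import Data.Fin.Properties using (_≟_; <⇒≢)
  open import Data.Rational.Base
  open import Data.Rational.Properties hiding (_≟_; <⇒≢)
  open import Data.Rational.Solver using (module +-*-Solver)
  open import Defs
  open Rationals
  open Casts using (≥0)
  open EdgeCounts
  open +-*-Solver using (solve; _:=_; _:+_; _:*_; _:-_; con)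

  private variable
    n : ℕ
    A : Set

  Weight : ℕ → Set
  Weight n = Fin n → Fin n → ℕ

  #missing : Graph n → ℕ
  #missing G = length (missing G)

  missingWeight : Weight n → Graph n → ℕ
  missingWeight F G = ∑ₗ (missing G) (symmetrise F)

  ∑-ι : ∀ (xs : List A) f → ∑ xs (ι ∘ f) ≡ ι (∑ₗ xs f)
  ∑-ι []       f = sym ι0
  ∑-ι (x ∷ xs) f = trans (cong (ι (f x) +_) (∑-ι xs f)) (sym (ι-+ (f x) (∑ₗ xs f)))

  -- The average over the missing edges, multiplied by their number.
  Growth : ℚ → (Graph n → ℚ) → Graph n → Set
  Growth r W G = ∑ (missing G) (W ∘ addEdge G) ≤ ι (#missing G) * (r * W G)

  -- Once the factor gained from an edge is bounded by an affine function of two edge weights, its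
  -- average involves only their totals over the missing edges, which `∑-missing` controls.
  growth : ∀ {W : Graph n → ℚ} {G r} a b F F′ → 0ℚ ≤ W G →
    (∀ {e} → e ∈ missing G → W (addEdge G e) ≤ W G * (1ℚ + a * ι (symmetrise F e) + b * ι (symmetrise F′ e))) →
    ι (#missing G) + a * ι (missingWeight F G) + b * ι (missingWeight F′ G) ≤ r * ι (#missing G) →
    Growth r W G
  growth {W = W} {G} {r} a b F F′ 0≤W W≤ sum≤ = begin
    ∑ es (W ∘ addEdge G)
      ≤⟨ ∑-mono es W≤ ⟩
    ∑ es (λ e → W G * (1ℚ + a * f e + b * f′ e))
      ≡⟨ ∑-*ˡ es (W G) _ ⟩
    W G * ∑ es (λ e → 1ℚ + a * f e + b * f′ e)
      ≡⟨ cong (W G *_) (trans (∑-+ es _ _) (cong₂ _+_ (∑-+ es _ _) refl)) ⟩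
    W G * (∑ es (λ _ → 1ℚ) + ∑ es (λ e → a * f e) + ∑ es (λ e → b * f′ e))
      ≡⟨ cong (W G *_) (cong₂ _+_ (cong₂ _+_ (trans (∑-const es 1ℚ) (*-identityʳ (ι (length es)))) (linear a F)) (linear b F′)) ⟩
    W G * (ι (#missing G) + a * ι (missingWeight F G) + b * ι (missingWeight F′ G))
      ≤⟨ *-monoˡ (W G) 0≤W sum≤ ⟩
    W G * (r * ι (#missing G))
      ≡⟨ solve 3 (λ W r M → W :* (r :* M) := M :* (r :* W)) refl (W G) r (ι (#missing G)) ⟩
    ι (#missing G) * (r * W G) ∎
    where
    open ≤-Reasoning
    es = missing G
    f f′ : _ → ℚ
    f  e = ι (symmetrise F e)
    f′ e = ι (symmetrise F′ e)
    linear : ∀ c F → ∑ es (λ e → c * ι (symmetrise F e)) ≡ c * ι (missingWeight F G)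
    linear c F = trans (∑-*ˡ es c _) (cong (c *_) (∑-ι es (symmetrise F)))

  -- The discount loses one factor `r` in the step, which pays for the growth of `W`.
  growth-< : ∀ {W : Graph n → ℚ} {G r m t} → t ℕ.< m → 0ℚ ≤ r → Growth r W G →
    ∑ (missing G) (λ e → W (addEdge G e) * r ^ (m ℕ.∸ suc t)) ≤ ι (#missing G) * (W G * r ^ (m ℕ.∸ t))
  growth-< {W = W} {G} {r} {m} {t} t<m 0≤r gr = begin
    ∑ (missing G) (λ e → W (addEdge G e) * r ^ (m ℕ.∸ suc t))
      ≡⟨ ∑-*ʳ (missing G) _ _ ⟩
    ∑ (missing G) (W ∘ addEdge G) * r ^ (m ℕ.∸ suc t)
      ≤⟨ *-monoʳ _ (0≤^ 0≤r (m ℕ.∸ suc t)) gr ⟩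
    ι (#missing G) * (r * W G) * r ^ (m ℕ.∸ suc t)
      ≡⟨ solve 4 (λ M r W p → M :* (r :* W) :* p := M :* (W :* (r :* p))) refl (ι (#missing G)) r (W G) (r ^ (m ℕ.∸ suc t)) ⟩
    ι (#missing G) * (W G * r ^ suc (m ℕ.∸ suc t))
      ≡⟨ cong (λ k → ι (#missing G) * (W G * r ^ k)) (ℕ.+-∸-assoc 1 t<m) ⟨
    ι (#missing G) * (W G * r ^ (m ℕ.∸ t)) ∎
    where open ≤-Reasoning

  -- From time `m` on, truncated subtraction freezes the discount at 1, and `r ≤ 1` makes `W` itself
  -- nonincreasing on average. This controls `W` at all times after `m` and not just at one.
  growth-≤1 : ∀ {W : Graph n → ℚ} {G r} m t → 0ℚ ≤ r → r ≤ 1ℚ → 0ℚ ≤ W G → Growth r W G →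
    ∑ (missing G) (λ e → W (addEdge G e) * r ^ (m ℕ.∸ suc t)) ≤ ι (#missing G) * (W G * r ^ (m ℕ.∸ t))
  growth-≤1 {W = W} {G} {r} m t 0≤r r≤1 0≤W gr with t ℕ.<? m
  ... | yes t<m = growth-< {W = W} {G = G} {t = t} t<m 0≤r gr
  ... | no  t≮m rewrite ℕ.m≤n⇒m∸n≡0 (ℕ.≮⇒≥ t≮m) | ℕ.m≤n⇒m∸n≡0 (ℕ.m≤n⇒m≤1+n (ℕ.≮⇒≥ t≮m)) = begin
    ∑ (missing G) (λ e → W (addEdge G e) * 1ℚ)  ≡⟨ trans (∑-*ʳ (missing G) 1ℚ _) (*-identityʳ _) ⟩
    ∑ (missing G) (W ∘ addEdge G)  ≤⟨ gr ⟩
    ι (#missing G) * (r * W G)  ≤⟨ *-monoˡ _ (0≤ι (#missing G)) (*-monoʳ (W G) 0≤W r≤1) ⟩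
    ι (#missing G) * (1ℚ * W G)  ≡⟨ cong (ι (#missing G) *_) (*-comm 1ℚ (W G)) ⟩
    ι (#missing G) * (W G * 1ℚ)  ∎
    where open ≤-Reasoning

  ^-addEdge : ∀ x F (G : Graph n) {e} → e ∈ missing G →
              x ^ count F (addEdge G e) ≡ x ^ count F G * x ^ symmetrise F e
  ^-addEdge x F G {e} e∈ = trans (cong (x ^_) (count-addEdge G F e∈)) (^-homo-* x (count F G) (symmetrise F e))

  ⟦≡⟧-refl : (x : Fin n) → ⟦ x ≡ x ⟧ ≡ 1
  ⟦≡⟧-refl x = cong χ (dec-true (x ≟ x) refl)

  ⟦≡⟧-≢ : {x y : Fin n} → x ≢ y → ⟦ x ≡ y ⟧ ≡ 0
  ⟦≡⟧-≢ {x = x} {y} x≢y = cong χ (dec-false (x ≟ y) x≢y)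

  ⟦≡⟧-sym : (x y : Fin n) → ⟦ x ≡ y ⟧ ≡ ⟦ y ≡ x ⟧
  ⟦≡⟧-sym x y with x ≟ y
  ... | yes refl = sym (⟦≡⟧-refl x)
  ... | no  x≢y  = sym (⟦≡⟧-≢ (x≢y ∘ sym))

  exclusiveˡ : {x y : Fin n} → x ≢ y → ∀ u → ⟦ x ≡ u ⟧ ℕ.+ ⟦ y ≡ u ⟧ ℕ.≤ 1
  exclusiveˡ {x = x} {y} x≢y u with x ≟ u
  ... | yes refl = ℕ.≤-reflexive (cong suc (⟦≡⟧-≢ (x≢y ∘ sym)))
  ... | no  _    = χ≤1 _

  exclusiveʳ : {u v : Fin n} → u ≢ v → ∀ x → ⟦ x ≡ u ⟧ ℕ.+ ⟦ x ≡ v ⟧ ℕ.≤ 1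
  exclusiveʳ {u = u} {v} u≢v x = subst₂ (λ a b → a ℕ.+ b ℕ.≤ 1) (⟦≡⟧-sym u x) (⟦≡⟧-sym v x) (exclusiveˡ u≢v x)

  sum-⟦≢⟧ : (v : Fin n) → ∑[ y < n ] χ (not (does (y ≟ v))) ℕ.+ 1 ≡ n
  sum-⟦≢⟧ {n} v = begin
    ∑[ y < n ] χ (not (does (y ≟ v))) ℕ.+ 1  ≡⟨ cong (∑[ y < n ] χ (not (does (y ≟ v))) ℕ.+_) (sum-χ≡ v) ⟨
    ∑[ y < n ] χ (not (does (y ≟ v))) ℕ.+ ∑[ y < n ] ⟦ y ≡ v ⟧  ≡⟨ ∑-distrib-+ {n} _ _ ⟨
    ∑[ y < n ] (χ (not (does (y ≟ v))) ℕ.+ ⟦ y ≡ v ⟧)  ≡⟨ sum-cong-≗ (λ y → χ-not (does (y ≟ v))) ⟩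
    ∑[ y < n ] 1  ≡⟨ trans (sum-const n 1) (ℕ.*-identityʳ n) ⟩
    n  ∎
    where open ≡-Reasoning

  -- The indicator of degree 0, as 0^0 = 1. Written as a power, it turns the sum of degrees in
  -- `deg-addEdge` into a product.
  isolated : Graph n → Fin n → ℕ
  isolated G v = 0 ℕ.^ deg G v

  0^≤1 : ∀ k → 0 ℕ.^ k ℕ.≤ 1
  0^≤1 zero    = ℕ.≤-refl
  0^≤1 (suc k) = ℕ.z≤n

  deg-addEdge : ∀ (G : Graph n) {e} → e ∈ missing G → ∀ x →
                deg (addEdge G e) x ≡ deg G x ℕ.+ symmetrise (λ y _ → ⟦ y ≡ x ⟧) e
  deg-addEdge G {e} e∈ x = begin
    deg (addEdge G e) x  ≡⟨ deg≡count (addEdge G e) x ⟩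
    count (λ y _ → ⟦ y ≡ x ⟧) (addEdge G e)  ≡⟨ count-addEdge G _ e∈ ⟩
    count (λ y _ → ⟦ y ≡ x ⟧) G ℕ.+ symmetrise (λ y _ → ⟦ y ≡ x ⟧) e ≡⟨ cong (ℕ._+ _) (deg≡count G x) ⟨
    deg G x ℕ.+ symmetrise (λ y _ → ⟦ y ≡ x ⟧) e  ∎
    where open ≡-Reasoning

  isolatedAt : Fin n → Graph n → ℚ
  isolatedAt v G = ι (isolated G v)

  isolated-addEdge : ∀ (G : Graph n) {e} → e ∈ missing G → ∀ x →
    isolated (addEdge G e) x ℕ.+ symmetrise (λ y _ → ⟦ y ≡ x ⟧ ℕ.* isolated G x) e ≡ isolated G x
  isolated-addEdge G {(a , b) , a<b} e∈ x
    rewrite deg-addEdge G e∈ x | ℕ.^-distribˡ-+-* 0 (deg G x) (⟦ a ≡ x ⟧ ℕ.+ ⟦ b ≡ x ⟧)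
    with a ≟ x
  ... | yes refl rewrite ⟦≡⟧-≢ {x = b} {a} (<⇒≢ a<b ∘ sym) = solve-ℕ 1 (λ i → i :*ℕ conℕ 0 :+ℕ (i :+ℕ conℕ 0 :+ℕ conℕ 0) :=ℕ i) refl (isolated G a)
  ... | no  a≢x with b ≟ x
  ...   | yes refl = solve-ℕ 1 (λ i → i :*ℕ conℕ 0 :+ℕ (i :+ℕ conℕ 0) :=ℕ i) refl (isolated G b)
  ...   | no  _    = solve-ℕ 1 (λ i → i :*ℕ conℕ 1 :+ℕ conℕ 0 :=ℕ i) refl (isolated G x)

  #isolated : Graph n → ℕ
  #isolated G = sum (isolated G)

  #isolated-addEdge : ∀ (G : Graph n) {e} → e ∈ missing G →
    #isolated (addEdge G e) ℕ.+ symmetrise (λ y _ → isolated G y) e ≡ #isolated G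
  #isolated-addEdge {n} G {e@((a , b) , a<b)} e∈ = begin
    #isolated (addEdge G e) ℕ.+ (isolated G a ℕ.+ isolated G b)
      ≡⟨ cong (#isolated (addEdge G e) ℕ.+_) (cong₂ ℕ._+_ (δ′ a) (δ′ b)) ⟨
    #isolated (addEdge G e) ℕ.+ (∑[ x < n ] (⟦ a ≡ x ⟧ ℕ.* isolated G x) ℕ.+ ∑[ x < n ] (⟦ b ≡ x ⟧ ℕ.* isolated G x))
      ≡⟨ cong (#isolated (addEdge G e) ℕ.+_) (∑-distrib-+ {n} _ _) ⟨
    #isolated (addEdge G e) ℕ.+ ∑[ x < n ] (⟦ a ≡ x ⟧ ℕ.* isolated G x ℕ.+ ⟦ b ≡ x ⟧ ℕ.* isolated G x)
      ≡⟨ ∑-distrib-+ {n} _ _ ⟨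
    ∑[ x < n ] (isolated (addEdge G e) x ℕ.+ (⟦ a ≡ x ⟧ ℕ.* isolated G x ℕ.+ ⟦ b ≡ x ⟧ ℕ.* isolated G x))
      ≡⟨ sum-cong-≗ (isolated-addEdge G e∈) ⟩
    #isolated G ∎
    where
    open ≡-Reasoning
    δ′ : ∀ a → ∑[ x < n ] (⟦ a ≡ x ⟧ ℕ.* isolated G x) ≡ isolated G a
    δ′ a = trans (sum-cong-≗ (λ x → cong (ℕ._* isolated G x) (⟦≡⟧-sym a x))) (sum-δ a (isolated G))

  growth-zero : ∀ {W : Graph n → ℚ} {G} r → W G ≡ 0ℚ → (∀ {e} → e ∈ missing G → W (addEdge G e) ≤ 0ℚ) → Growth r W G
  growth-zero {W = W} {G} r W≡0 W≤0 = begin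
    ∑ (missing G) (W ∘ addEdge G)  ≤⟨ ∑-mono (missing G) W≤0 ⟩
    ∑ (missing G) (λ _ → 0ℚ)  ≡⟨ ∑-zero (missing G) ⟩
    0ℚ  ≡⟨ solve 2 (λ M r → con 0ℚ := M :* (r :* con 0ℚ)) refl (ι (#missing G)) r ⟩
    ι (#missing G) * (r * 0ℚ)  ≡⟨ cong (λ w → ι (#missing G) * (r * w)) W≡0 ⟨
    ι (#missing G) * (r * W G)  ∎
    where open ≤-Reasoning

  -- All n - 1 pairs at an isolated vertex are missing, so with M missing edges it stays isolated
  -- with probability (M - n + 1)/M. A vertex that is not isolated never becomes so.
  isolatedAt-growth : ∀ (G : Graph n) v {r} → ι (#missing G) - ι n + 1ℚ ≤ r * ι (#missing G) → Growth r (isolatedAt v) G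
  isolatedAt-growth {n} G v {r} M-n≤ = by-degree (deg G v) refl
    where
    open ≤-Reasoning
    F : Weight n
    F x _ = ⟦ x ≡ v ⟧
    step : ∀ {e} → e ∈ missing G →
           ι (isolated (addEdge G e) v) ≤ ι (isolated G v) * (1ℚ + - 1ℚ * ι (symmetrise F e) + 0ℚ * ι (symmetrise F e))
    step {e@((a , b) , _)} e∈ = ≤-reflexive (begin-equality
      ι (isolated (addEdge G e) v)
        ≡⟨ solve 2 (λ x y → x := x :+ y :- y) refl _ (ι (isolated G v) * ι (symmetrise F e)) ⟩
      ι (isolated (addEdge G e) v) + ι (isolated G v) * ι (symmetrise F e) - ι (isolated G v) * ι (symmetrise F e)
        ≡⟨ cong (_- ι (isolated G v) * ι (symmetrise F e)) (trans (cong (_+_ (ι (isolated (addEdge G e) v))) (sym (ι-* (isolated G v) (symmetrise F e)))) (sym (ι-+ _ (isolated G v ℕ.* symmetrise F e)))) ⟩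
      ι (isolated (addEdge G e) v ℕ.+ isolated G v ℕ.* symmetrise F e) - ι (isolated G v) * ι (symmetrise F e)
        ≡⟨ cong (λ k → ι k - ι (isolated G v) * ι (symmetrise F e)) (trans (cong (isolated (addEdge G e) v ℕ.+_)
             (solve-ℕ 3 (λ i a b → i :*ℕ (a :+ℕ b) :=ℕ a :*ℕ i :+ℕ b :*ℕ i) refl (isolated G v) ⟦ a ≡ v ⟧ ⟦ b ≡ v ⟧))
             (isolated-addEdge G e∈ v)) ⟩
      ι (isolated G v) - ι (isolated G v) * ι (symmetrise F e)
        ≡⟨ solve 2 (λ i s → i :- i :* s := i :* (con 1ℚ :+ con (- 1ℚ) :* s :+ con 0ℚ :* s)) refl (ι (isolated G v)) (ι (symmetrise F e)) ⟩
      ι (isolated G v) * (1ℚ + - 1ℚ * ι (symmetrise F e) + 0ℚ * ι (symmetrise F e)) ∎)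
    by-degree : ∀ d → deg G v ≡ d → Growth r (isolatedAt v) G
    by-degree (suc d) deg≡ = growth-zero {W = isolatedAt v} {G} r (trans (cong ι isolated≡0) ι0)
      (λ {e} e∈ → subst (ι (isolated (addEdge G e) v) ≤_) ι0
        (ι-mono-≤ (subst (isolated (addEdge G e) v ℕ.≤_) (trans (isolated-addEdge G e∈ v) isolated≡0) (ℕ.m≤m+n _ _))))
      where
      isolated≡0 : isolated G v ≡ 0
      isolated≡0 = cong (0 ℕ.^_) deg≡
    by-degree zero    deg≡ = growth {W = isolatedAt v} {G = G} {r = r} (- 1ℚ) 0ℚ F F (0≤ι (isolated G v)) step (begin
      M + - 1ℚ * m + 0ℚ * m  ≡⟨ solve 2 (λ M m → M :+ con (- 1ℚ) :* m :+ con 0ℚ :* m := M :- (m :+ con 1ℚ) :+ con 1ℚ) refl M m ⟩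
      M - (m + 1ℚ) + 1ℚ  ≡⟨ cong (λ x → M - x + 1ℚ) (trans (cong (_+_ m) (sym ι1)) (sym (ι-+ (missingWeight F G) 1))) ⟩
      M - ι (missingWeight F G ℕ.+ 1) + 1ℚ  ≡⟨ cong (λ k → M - ι k + 1ℚ) missing≡ ⟩
      M - ι n + 1ℚ  ≤⟨ M-n≤ ⟩
      r * M  ∎)
      where
      M = ι (#missing G)
      m = ι (missingWeight F G)
      missing≡ : missingWeight F G ℕ.+ 1 ≡ n
      missing≡ = trans (cong (ℕ._+ 1) (sym (ℕ.+-identityʳ _)))
        (trans (cong₂ (λ a b → missingWeight F G ℕ.+ a ℕ.+ b) (trans (sym deg≡) (deg≡count G v)) (sym (sum-χ≡ v)))
        (trans (∑-missing G F)
        (trans (sum-cong-≗ {n} (λ x → trans (sum-const n ⟦ x ≡ v ⟧) (ℕ.*-comm n ⟦ x ≡ v ⟧)))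
               (sum-δ v (const n)))))

  -- A lower tail bound without second moments. With z = 1 - q, the power `z ^ #isolated` is the
  -- probability that no isolated vertex survives if each does so independently with probability q.
  -- Removing D of the I isolated vertices costs `x ^ D`, where `x` = 1/z′; this is linearised,
  -- averaged, and compared with (zx)^I ≥ 1 + I (z - z′) x.
  #isolated-growth : ∀ (G : Graph n) {z z′ x} → 0ℚ ≤ z′ → z′ ≤ z → 1ℚ ≤ x → x * z′ ≡ 1ℚ →
    (ℤ.+ 1 / 2) * (x * x - 1ℚ) * (ι n - 1ℚ) ≤ ι (#missing G) * ((z - z′) * x) →
    ∑ (missing G) (λ e → z′ ^ #isolated (addEdge G e)) ≤ ι (#missing G) * z ^ #isolated G
  #isolated-growth {n} G {z} {z′} {x} 0≤z′ z′≤z 1≤x xz′≡1 h≤ = begin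
    ∑ (missing G) (λ e → z′ ^ #isolated (addEdge G e))
      ≤⟨ growth {W = W} {G} {(z * x) ^ I} h 0ℚ F F (0≤^ 0≤z′ I) step sum≤ ⟩
    M * ((z * x) ^ I * z′ ^ I)
      ≡⟨ cong (M *_) (trans (sym (^-distrib-* (z * x) z′ I)) (cong (_^ I)
           (trans (*-assoc z x z′) (trans (cong (z *_) xz′≡1) (*-identityʳ z))))) ⟩
    M * z ^ I ∎
    where
    open ≤-Reasoning
    I = #isolated G
    M = ι (#missing G)
    h = (ℤ.+ 1 / 2) * (x * x - 1ℚ)
    W : Graph n → ℚ
    W G = z′ ^ #isolated G
    F : Weight n
    F y _ = isolated G y
    m = missingWeight F G
    0≤x : 0ℚ ≤ x
    0≤x = ≤-trans 0≤1 1≤x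
    0≤h : 0ℚ ≤ h
    0≤h = 0≤* (≥0 (ℤ.+ 1 / 2)) (p≤q⇒0≤q-p (≤-trans 1≤x (subst (_≤ x * x) (*-identityʳ x) (*-monoˡ x 0≤x 1≤x))))
    -- The chord of the convex function `x ^ k` between 0 and 2 suffices, since one edge removes at
    -- most two isolated vertices.
    power≤ : ∀ k → k ℕ.≤ 2 → x ^ k ≤ 1ℚ + h * ι k + 0ℚ * ι k
    power≤ 0 _ = ≤-reflexive (trans (solve 1 (λ h → con 1ℚ := con 1ℚ :+ h :* con 0ℚ :+ con 0ℚ :* con 0ℚ) refl h)
      (cong (λ i → 1ℚ + h * i + 0ℚ * i) (sym ι0)))
    power≤ 1 _ = ≤-trans (≤-+ʳ (solve 1 (λ x → con 1ℚ :+ con (ℤ.+ 1 / 2) :* (x :* x :- con 1ℚ) :* con 1ℚ :+ con 0ℚ :* con 1ℚ :=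
        x :* con 1ℚ :+ con (ℤ.+ 1 / 2) :* ((x :- con 1ℚ) :* (x :- con 1ℚ))) refl x)
        (0≤* (≥0 (ℤ.+ 1 / 2)) (0≤p² (x - 1ℚ))))
      (≤-reflexive (cong (λ i → 1ℚ + h * i + 0ℚ * i) (sym ι1)))
    power≤ 2 _ = ≤-reflexive (trans (solve 1 (λ x → x :* (x :* con 1ℚ) := con 1ℚ :+ con (ℤ.+ 1 / 2) :* (x :* x :- con 1ℚ) :* con (ℕtoℚ 2) :+ con 0ℚ :* con (ℕtoℚ 2)) refl x)
      (cong (λ i → 1ℚ + h * i + 0ℚ * i) (sym (ι≡ℕtoℚ 2))))
    power≤ (suc (suc (suc _))) (ℕ.s≤s (ℕ.s≤s ()))
    step : ∀ {e} → e ∈ missing G → W (addEdge G e) ≤ W G * (1ℚ + h * ι (symmetrise F e) + 0ℚ * ι (symmetrise F e))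
    step {e@((a , b) , _)} e∈ = begin
      z′ ^ I′  ≡⟨ trans (cong (z′ ^ I′ *_) (1^ D)) (*-identityʳ (z′ ^ I′)) ⟨
      z′ ^ I′ * 1ℚ ^ D  ≡⟨ cong (λ y → z′ ^ I′ * y ^ D) xz′≡1 ⟨
      z′ ^ I′ * (x * z′) ^ D  ≡⟨ cong (z′ ^ I′ *_) (^-distrib-* x z′ D) ⟩
      z′ ^ I′ * (x ^ D * z′ ^ D)  ≡⟨ solve 3 (λ a b c → a :* (b :* c) := a :* c :* b) refl (z′ ^ I′) (x ^ D) (z′ ^ D) ⟩
      z′ ^ I′ * z′ ^ D * x ^ D  ≡⟨ cong (_* x ^ D) (trans (sym (^-homo-* z′ I′ D)) (cong (z′ ^_) (#isolated-addEdge G e∈))) ⟩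
      z′ ^ I * x ^ D  ≤⟨ *-monoˡ (z′ ^ I) (0≤^ 0≤z′ I) (power≤ D (ℕ.+-mono-≤ (0^≤1 (deg G a)) (0^≤1 (deg G b)))) ⟩
      z′ ^ I * (1ℚ + h * ι D + 0ℚ * ι D)  ∎
      where
      I′ = #isolated (addEdge G e)
      D = symmetrise F e
    missing≤ : ι m ≤ (ι n - 1ℚ) * ι I
    missing≤ = begin
      ι m  ≡⟨ solve 2 (λ m i → m := m :+ i :- i) refl (ι m) (ι I) ⟩
      ι m + ι I - ι I  ≡⟨ cong (_- ι I) (ι-+ m I) ⟨
      ι (m ℕ.+ I) - ι I  ≤⟨ +-monoˡ-≤ (- ι I) (ι-mono-≤ (ℕ.≤-trans (ℕ.+-monoˡ-≤ I (ℕ.m≤m+n m (count F G)))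
                                         (ℕ.≤-reflexive (trans (∑-missing G F) total≡)))) ⟩
      ι (n ℕ.* I) - ι I  ≡⟨ cong (_- ι I) (ι-* n I) ⟩
      ι n * ι I - ι I  ≡⟨ solve 2 (λ n i → n :* i :- i := (n :- con 1ℚ) :* i) refl (ι n) (ι I) ⟩
      (ι n - 1ℚ) * ι I  ∎
      where
      total≡ : ∑∑ F ≡ n ℕ.* I
      total≡ = trans (sum-cong-≗ {n} (λ x → sum-const n (isolated G x))) (sym (*-distribˡ-sum n (isolated G)))
    sum≤ : M + h * ι m + 0ℚ * ι m ≤ (z * x) ^ I * M
    sum≤ = begin
      M + h * ι m + 0ℚ * ι m  ≡⟨ solve 3 (λ M h m → M :+ h :* m :+ con 0ℚ :* m := M :+ h :* m) refl M h (ι m) ⟩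
      M + h * ι m  ≤⟨ +-monoʳ-≤ M (*-monoˡ h 0≤h missing≤) ⟩
      M + h * ((ι n - 1ℚ) * ι I)  ≡⟨ cong (_+_ M) (*-assoc h (ι n - 1ℚ) (ι I)) ⟨
      M + h * (ι n - 1ℚ) * ι I  ≤⟨ +-monoʳ-≤ M (*-monoʳ (ι I) (0≤ι I) h≤) ⟩
      M + M * ((z - z′) * x) * ι I  ≡⟨ solve 4 (λ M i d x → M :+ M :* (d :* x) :* i := (con 1ℚ :+ i :* (d :* x)) :* M) refl M (ι I) (z - z′) x ⟩
      (1ℚ + ι I * ((z - z′) * x)) * M  ≤⟨ *-monoʳ M (0≤ι (#missing G)) (bernoulli _ (0≤+ 0≤1 (0≤* (p≤q⇒0≤q-p z′≤z) 0≤x)) I) ⟩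
      (1ℚ + (z - z′) * x) ^ I * M  ≡⟨ cong (λ y → y ^ I * M) (trans (solve 4 (λ o z z′ x → o :+ (z :- z′) :* x := z :* x :+ (o :- x :* z′)) refl 1ℚ z z′ x)
                                                      (trans (cong (λ y → z * x + (1ℚ - y)) xz′≡1) (+-identityʳ (z * x)))) ⟩
      (z * x) ^ I * M  ∎

-- Two vertices of low degree in one closed neighbourhood

module LowDegrees where

  open import Data.Bool.Base using (T)
  open import Data.Fin.Properties using (_≟_; <⇒≢)
  open import Data.Rational.Base
  open import Data.Rational.Properties hiding (_≟_; <⇒≢)
  open import Data.Rational.Solver using (module +-*-Solver)
  open import Defs
  open Graph using (adj)
  open Rationals
  open Casts using (≥0; ≤-by)
  open EdgeCounts
  open Growth
  open +-*-Solver using (solve; _:=_; _:+_; _:*_; _:-_; con)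

  module LowDegreePair {n} (u v w : Fin n) (u≢v : u ≢ v) (d : ℕ) (R R⁻¹ : ℚ)
                       (1≤R : 1ℚ ≤ R) (0≤R⁻¹ : 0ℚ ≤ R⁻¹) (RR⁻¹≡1 : R * R⁻¹ ≡ 1ℚ) where

    -- Each edge meeting {u, v} multiplies the weight by 1/16. This keeps 15/16 of the rate 4/n at
    -- which such edges arrive, at the price of the initial factor 16^d.
    λ′ Λ : ℚ
    λ′ = ℤ.+ 1 / 16
    Λ = ℕtoℚ 16

    0≤R : 0ℚ ≤ R
    0≤R = ≤-trans 0≤1 1≤R

    -- Edges meeting {u, v}, and edges from u or v to w; an edge uv is counted once.
    F J : Weight n
    F x y = ⟦ x ≡ u ⟧ ℕ.* χ (not (does (y ≟ v))) ℕ.+ ⟦ x ≡ v ⟧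
    J x y = ⟦ x ≡ u ⟧ ℕ.* ⟦ y ≡ w ⟧ ℕ.+ ⟦ x ≡ v ⟧ ℕ.* ⟦ y ≡ w ⟧

    -- Counts `w` itself when it is one of the two vertices, so that closed neighbourhoods are
    -- covered; `near` reaches 2 when both vertices lie in that of `w`.
    J₀ : ℕ
    J₀ = ⟦ u ≡ w ⟧ ℕ.+ ⟦ v ≡ w ⟧

    near : Graph n → ℕ
    near G = count J G ℕ.+ J₀

    full : Graph n → ℚ
    full G = Λ ^ d * (R⁻¹ * R⁻¹) * λ′ ^ count F G * R ^ near G

    -- Set to 0 as soon as more than `d` edges meet {u, v}, a condition that persists. Until then
    -- almost 2n such edges are missing (`missing-F`), and this forces the decay.
    W : Graph n → ℚ
    W G = if count F G ℕ.≤ᵇ d then full G else 0ℚ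

    0≤K : 0ℚ ≤ Λ ^ d * (R⁻¹ * R⁻¹)
    0≤K = 0≤* (0≤^ (≥0 Λ) d) (0≤* 0≤R⁻¹ 0≤R⁻¹)

    0≤W : ∀ G → 0ℚ ≤ W G
    0≤W G with count F G ℕ.≤ᵇ d
    ... | true  = 0≤* (0≤* 0≤K (0≤^ (≥0 λ′) (count F G))) (0≤^ 0≤R (near G))
    ... | false = ≤-refl

    F≤1 : ∀ e → symmetrise F e ℕ.≤ 1
    F≤1 ((a , b) , a<b) with a ≟ v | b ≟ v
    ... | yes refl | yes refl = contradiction refl (<⇒≢ a<b)
    ... | yes refl | no _ rewrite ⟦≡⟧-≢ (u≢v ∘ sym) = ℕ.≤-reflexive (solve-ℕ 1 (λ i → conℕ 0 :+ℕ conℕ 1 :+ℕ (i :*ℕ conℕ 0 :+ℕ conℕ 0) :=ℕ conℕ 1) refl ⟦ b ≡ u ⟧)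
    ... | no _ | yes refl rewrite ⟦≡⟧-≢ (u≢v ∘ sym) = ℕ.≤-reflexive (solve-ℕ 1 (λ i → i :*ℕ conℕ 0 :+ℕ conℕ 0 :+ℕ (conℕ 0 :+ℕ conℕ 1) :=ℕ conℕ 1) refl ⟦ a ≡ u ⟧)
    ... | no _ | no _ = subst (ℕ._≤ 1) (solve-ℕ 2 (λ i j → i :+ℕ j :=ℕ i :*ℕ conℕ 1 :+ℕ conℕ 0 :+ℕ (j :*ℕ conℕ 1 :+ℕ conℕ 0)) refl ⟦ a ≡ u ⟧ ⟦ b ≡ u ⟧)
                          (exclusiveˡ (<⇒≢ a<b) u)

    J≤1 : ∀ e → symmetrise J e ℕ.≤ 1
    J≤1 ((a , b) , a<b) = begin
      J a b ℕ.+ J b a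
        ≡⟨ cong₂ ℕ._+_ (sym (ℕ.*-distribʳ-+ ⟦ b ≡ w ⟧ ⟦ a ≡ u ⟧ _)) (sym (ℕ.*-distribʳ-+ ⟦ a ≡ w ⟧ ⟦ b ≡ u ⟧ _)) ⟩
      (⟦ a ≡ u ⟧ ℕ.+ ⟦ a ≡ v ⟧) ℕ.* ⟦ b ≡ w ⟧ ℕ.+ (⟦ b ≡ u ⟧ ℕ.+ ⟦ b ≡ v ⟧) ℕ.* ⟦ a ≡ w ⟧
        ≤⟨ ℕ.+-mono-≤ (ℕ.*-monoˡ-≤ ⟦ b ≡ w ⟧ (exclusiveʳ u≢v a)) (ℕ.*-monoˡ-≤ ⟦ a ≡ w ⟧ (exclusiveʳ u≢v b)) ⟩
      1 ℕ.* ⟦ b ≡ w ⟧ ℕ.+ 1 ℕ.* ⟦ a ≡ w ⟧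
        ≡⟨ cong₂ ℕ._+_ (ℕ.*-identityˡ ⟦ b ≡ w ⟧) (ℕ.*-identityˡ ⟦ a ≡ w ⟧) ⟩
      ⟦ b ≡ w ⟧ ℕ.+ ⟦ a ≡ w ⟧
        ≤⟨ exclusiveˡ (<⇒≢ a<b ∘ sym) w ⟩
      1 ∎
      where open ℕ.≤-Reasoning

    -- Exact for j = 0. Edges to `w` are overestimated, which costs little because at most two of
    -- them can still appear (`missing-J`).
    weight≤ : ∀ {f j} → f ℕ.≤ 1 → j ℕ.≤ 1 → λ′ ^ f * R ^ j ≤ 1ℚ + - (ℤ.+ 15 / 16) * ι f + R * ι j
    weight≤ {0} {0} _ _ rewrite ι0 = ≤-reflexive (solve 1 (λ R → con 1ℚ :* con 1ℚ := con 1ℚ :+ con (- (ℤ.+ 15 / 16)) :* con 0ℚ :+ R :* con 0ℚ) refl R)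
    weight≤ {1} {0} _ _ rewrite ι0 | ι1 = ≤-reflexive (solve 1 (λ R → con λ′ :* con 1ℚ :* con 1ℚ := con 1ℚ :+ con (- (ℤ.+ 15 / 16)) :* con 1ℚ :+ R :* con 0ℚ) refl R)
    weight≤ {0} {1} _ _ rewrite ι0 | ι1 = ≤-by (solve 1 (λ R → con 1ℚ :+ con (- (ℤ.+ 15 / 16)) :* con 0ℚ :+ R :* con 1ℚ :- con 1ℚ :* (R :* con 1ℚ) := con 1ℚ) refl R) 0≤1
    weight≤ {1} {1} _ _ rewrite ι1 = ≤-by (solve 1 (λ R → con 1ℚ :+ con (- (ℤ.+ 15 / 16)) :* con 1ℚ :+ R :* con 1ℚ :- con λ′ :* con 1ℚ :* (R :* con 1ℚ) := con (ℤ.+ 1 / 16) :+ con (ℤ.+ 15 / 16) :* R) refl R)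
      (0≤+ (≥0 (ℤ.+ 1 / 16)) (0≤* (≥0 (ℤ.+ 15 / 16)) 0≤R))
    weight≤ {suc (suc _)} (s≤s ())
    weight≤ {_} {suc (suc _)} _ (s≤s ())

    total-F : ∑∑ F ℕ.+ 1 ≡ n ℕ.+ n
    total-F = begin
      ∑∑ F ℕ.+ 1
        ≡⟨ cong (ℕ._+ 1) (∑∑-+ {n} _ _) ⟩
      ∑∑ (λ x y → ⟦ x ≡ u ⟧ ℕ.* χ (not (does (y ≟ v)))) ℕ.+ ∑∑ {n} (λ x y → ⟦ x ≡ v ⟧) ℕ.+ 1
        ≡⟨ cong₂ (λ a b → a ℕ.+ b ℕ.+ 1) (trans (∑∑-product (λ x → ⟦ x ≡ u ⟧) (λ y → χ (not (does (y ≟ v))))) (trans (cong (ℕ._* N′) (sum-χ≡ u)) (ℕ.*-identityˡ N′)))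
             (trans (sum-cong-≗ {n} (λ x → trans (sum-const n ⟦ x ≡ v ⟧) (ℕ.*-comm n ⟦ x ≡ v ⟧))) (sum-δ v (const n))) ⟩
      N′ ℕ.+ n ℕ.+ 1
        ≡⟨ solve-ℕ 2 (λ a b → a :+ℕ b :+ℕ conℕ 1 :=ℕ a :+ℕ conℕ 1 :+ℕ b) refl N′ n ⟩
      N′ ℕ.+ 1 ℕ.+ n
        ≡⟨ cong (ℕ._+ n) (sum-⟦≢⟧ v) ⟩
      n ℕ.+ n ∎
      where
      open ≡-Reasoning
      N′ = ∑[ y < n ] χ (not (does (y ≟ v)))

    diagonal-F : diagonal F ℕ.≤ 2
    diagonal-F = begin
      diagonal F
        ≤⟨ sum-mono (λ x → ℕ.+-monoˡ-≤ ⟦ x ≡ v ⟧ (ℕ.≤-trans (ℕ.*-monoʳ-≤ ⟦ x ≡ u ⟧ (χ≤1 (not (does (x ≟ v))))) (ℕ.≤-reflexive (ℕ.*-identityʳ ⟦ x ≡ u ⟧)))) ⟩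
      ∑[ x < n ] (⟦ x ≡ u ⟧ ℕ.+ ⟦ x ≡ v ⟧)
        ≡⟨ trans (∑-distrib-+ {n} _ _) (cong₂ ℕ._+_ (sum-χ≡ u) (sum-χ≡ v)) ⟩
      2 ∎
      where open ℕ.≤-Reasoning

    missing-F : ∀ G → count F G ℕ.≤ d → n ℕ.+ n ℕ.≤ missingWeight F G ℕ.+ (d ℕ.+ 3)
    missing-F G F≤d = begin
      n ℕ.+ n  ≡⟨ total-F ⟨
      ∑∑ F ℕ.+ 1  ≡⟨ cong (ℕ._+ 1) (∑-missing G F) ⟨
      missingWeight F G ℕ.+ count F G ℕ.+ diagonal F ℕ.+ 1  ≤⟨ ℕ.+-monoˡ-≤ 1 (ℕ.+-mono-≤ (ℕ.+-monoʳ-≤ (missingWeight F G) F≤d) diagonal-F) ⟩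
      missingWeight F G ℕ.+ d ℕ.+ 2 ℕ.+ 1  ≡⟨ solve-ℕ 2 (λ m d → m :+ℕ d :+ℕ conℕ 2 :+ℕ conℕ 1 :=ℕ m :+ℕ (d :+ℕ conℕ 3)) refl (missingWeight F G) d ⟩
      missingWeight F G ℕ.+ (d ℕ.+ 3)  ∎
      where open ℕ.≤-Reasoning

    missing-J : ∀ G → missingWeight J G ℕ.≤ 2
    missing-J G = begin
      missingWeight J G  ≤⟨ ℕ.≤-trans (ℕ.m≤m+n _ (count J G)) (ℕ.m≤m+n _ (diagonal J)) ⟩
      missingWeight J G ℕ.+ count J G ℕ.+ diagonal J  ≡⟨ ∑-missing G J ⟩
      ∑∑ J  ≡⟨ ∑∑-+ {n} _ _ ⟩
      ∑∑ (λ x y → ⟦ x ≡ u ⟧ ℕ.* ⟦ y ≡ w ⟧) ℕ.+ ∑∑ (λ x y → ⟦ x ≡ v ⟧ ℕ.* ⟦ y ≡ w ⟧)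
        ≡⟨ cong₂ ℕ._+_ (one u) (one v) ⟩
      2 ∎
      where
      open ℕ.≤-Reasoning
      one : ∀ u → ∑∑ (λ x y → ⟦ x ≡ u ⟧ ℕ.* ⟦ y ≡ w ⟧) ≡ 1
      one u = trans (∑∑-product (λ x → ⟦ x ≡ u ⟧) (λ y → ⟦ y ≡ w ⟧)) (cong₂ ℕ._*_ (sum-χ≡ u) (sum-χ≡ w))

    W-growth : ∀ G {r} →
      (∀ f j → n ℕ.+ n ℕ.≤ f ℕ.+ (d ℕ.+ 3) → j ℕ.≤ 2 →
        ι (#missing G) + - (ℤ.+ 15 / 16) * ι f + R * ι j ≤ r * ι (#missing G)) →
      Growth r W G
    W-growth G {r} sum≤ = by-degree (count F G ℕ.≤ᵇ d) refl
      where
      open ≤-Reasoning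
      count-mono : ∀ {e} → e ∈ missing G → count F G ℕ.≤ count F (addEdge G e)
      count-mono e∈ = ℕ.≤-trans (ℕ.m≤m+n (count F G) _) (ℕ.≤-reflexive (sym (count-addEdge G F e∈)))
      by-degree : ∀ b → (count F G ℕ.≤ᵇ d) ≡ b → Growth r W G
      by-degree false F>d = growth-zero {W = W} {G} r (cong (λ b → if b then full G else 0ℚ) F>d)
        (λ {e} e∈ → ≤-reflexive (cong (λ b → if b then full (addEdge G e) else 0ℚ) (dec-false (count F (addEdge G e) ℕ.≤? d)
          (λ F≤d → subst T F>d (ℕ.≤⇒≤ᵇ (ℕ.≤-trans (count-mono e∈) F≤d))))))
      by-degree true  F≤d = growth {W = W} {G} {r} (- (ℤ.+ 15 / 16)) R F J (0≤W G) step
        (sum≤ (missingWeight F G) (missingWeight J G)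
          (missing-F G (ℕ.≤ᵇ⇒≤ _ _ (subst T (sym F≤d) _))) (missing-J G))
        where
        step : ∀ {e} → e ∈ missing G →
               W (addEdge G e) ≤ W G * (1ℚ + - (ℤ.+ 15 / 16) * ι (symmetrise F e) + R * ι (symmetrise J e))
        step {e} e∈ = begin
          W (addEdge G e)
            ≤⟨ drop-if (count F (addEdge G e) ℕ.≤ᵇ d) ⟩
          K * λ′ ^ count F (addEdge G e) * R ^ (count J (addEdge G e) ℕ.+ J₀)
            ≡⟨ cong₂ (λ a b → K * a * b) (^-addEdge λ′ F G e∈) (trans (^-homo-* R (count J (addEdge G e)) J₀) (cong (_* R ^ J₀) (^-addEdge R J G e∈))) ⟩
          K * (λ′ ^ count F G * λ′ ^ f) * (R ^ count J G * R ^ j * R ^ J₀)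
            ≡⟨ solve 6 (λ K a b c d e → K :* (a :* b) :* (c :* d :* e) := K :* a :* (c :* e) :* (b :* d)) refl K (λ′ ^ count F G) (λ′ ^ f) (R ^ count J G) (R ^ j) (R ^ J₀) ⟩
          K * λ′ ^ count F G * (R ^ count J G * R ^ J₀) * (λ′ ^ f * R ^ j)
            ≡⟨ cong (λ a → K * λ′ ^ count F G * a * (λ′ ^ f * R ^ j)) (^-homo-* R (count J G) J₀) ⟨
          K * λ′ ^ count F G * R ^ near G * (λ′ ^ f * R ^ j)
            ≡⟨ cong (λ b → (if b then full G else 0ℚ) * (λ′ ^ f * R ^ j)) F≤d ⟨
          W G * (λ′ ^ f * R ^ j)
            ≤⟨ *-monoˡ (W G) (0≤W G) (weight≤ (F≤1 e) (J≤1 e)) ⟩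
          W G * (1ℚ + - (ℤ.+ 15 / 16) * ι f + R * ι j) ∎
          where
          K = Λ ^ d * (R⁻¹ * R⁻¹)
          f = symmetrise F e
          j = symmetrise J e
          0≤full : 0ℚ ≤ K * λ′ ^ count F (addEdge G e) * R ^ near (addEdge G e)
          0≤full = 0≤* (0≤* 0≤K (0≤^ (≥0 λ′) (count F (addEdge G e)))) (0≤^ 0≤R (near (addEdge G e)))
          drop-if : ∀ b → (if b then full (addEdge G e) else 0ℚ)
                          ≤ K * λ′ ^ count F (addEdge G e) * R ^ near (addEdge G e)
          drop-if true  = ≤-refl
          drop-if false = 0≤full

    adj-count : ∀ G x → ∑∑ (λ y z → χ (adj G y z) ℕ.* (⟦ y ≡ x ⟧ ℕ.* ⟦ z ≡ w ⟧)) ≡ χ (adj G x w)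
    adj-count G x = trans (∑∑-cong (λ y z → solve-ℕ 3 (λ a b c → a :*ℕ (b :*ℕ c) :=ℕ b :*ℕ (c :*ℕ a)) refl (χ (adj G y z)) ⟦ y ≡ x ⟧ ⟦ z ≡ w ⟧))
                          (∑∑-δ x w (λ y z → χ (adj G y z)))

    1≤W : ∀ G → deg G u ℕ.+ deg G v ℕ.≤ d →
          1 ℕ.≤ χ (adj G u w) ℕ.+ ⟦ u ≡ w ⟧ → 1 ℕ.≤ χ (adj G v w) ℕ.+ ⟦ v ≡ w ⟧ → 1ℚ ≤ W G
    1≤W G low near-u near-v = begin
      1ℚ
        ≡⟨ *-identityˡ 1ℚ ⟨
      1ℚ * 1ℚ
        ≤⟨ *-mono 0≤1 (0≤* (0≤^ (≥0 Λ) d) (0≤^ (≥0 λ′) (count F G))) degree-factor near-factor ⟩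
      Λ ^ d * λ′ ^ count F G * (R ^ near G * (R⁻¹ * R⁻¹))
        ≡⟨ solve 4 (λ a b c r → a :* b :* (c :* r) := a :* r :* b :* c) refl (Λ ^ d) (λ′ ^ count F G) (R ^ near G) (R⁻¹ * R⁻¹) ⟩
      Λ ^ d * (R⁻¹ * R⁻¹) * λ′ ^ count F G * R ^ near G
        ≡⟨ cong (λ b → if b then full G else 0ℚ) (dec-true (count F G ℕ.≤? d) F≤d) ⟨
      W G ∎
      where
      open ≤-Reasoning
      F≤d : count F G ℕ.≤ d
      F≤d = ℕ.≤-trans
        (ℕ.≤-trans (∑∑-mono (λ x y → ℕ.≤-trans (ℕ.*-monoʳ-≤ (χ (adj G x y)) (ℕ.+-monoˡ-≤ ⟦ x ≡ v ⟧
            (ℕ.≤-trans (ℕ.*-monoʳ-≤ ⟦ x ≡ u ⟧ (χ≤1 (not (does (y ≟ v))))) (ℕ.≤-reflexive (ℕ.*-identityʳ ⟦ x ≡ u ⟧)))))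
            (ℕ.≤-reflexive (ℕ.*-distribˡ-+ (χ (adj G x y)) ⟦ x ≡ u ⟧ ⟦ x ≡ v ⟧))))
          (ℕ.≤-reflexive (trans (∑∑-+ {n} _ _) (cong₂ ℕ._+_ (sym (deg≡count G u)) (sym (deg≡count G v))))))
        low
      degree-factor : 1ℚ ≤ Λ ^ d * λ′ ^ count F G
      degree-factor = begin
        1ℚ  ≡⟨ 1^ d ⟨
        (Λ * λ′) ^ d  ≡⟨ ^-distrib-* Λ λ′ d ⟩
        Λ ^ d * λ′ ^ d  ≤⟨ *-monoˡ (Λ ^ d) (0≤^ (≥0 Λ) d) (^-antiʳ (≥0 λ′) (≤ᵇ⇒≤ _) F≤d) ⟩
        Λ ^ d * λ′ ^ count F G  ∎
      2≤near : 2 ℕ.≤ near G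
      2≤near = ℕ.≤-trans (ℕ.+-mono-≤ near-u near-v) (ℕ.≤-reflexive (trans
        (solve-ℕ 4 (λ a b c d → a :+ℕ b :+ℕ (c :+ℕ d) :=ℕ a :+ℕ c :+ℕ (b :+ℕ d)) refl (χ (adj G u w)) ⟦ u ≡ w ⟧ (χ (adj G v w)) ⟦ v ≡ w ⟧)
        (cong (ℕ._+ J₀) (sym (trans (∑∑-cong (λ x y → ℕ.*-distribˡ-+ (χ (adj G x y)) (⟦ x ≡ u ⟧ ℕ.* ⟦ y ≡ w ⟧) (⟦ x ≡ v ⟧ ℕ.* ⟦ y ≡ w ⟧)))
          (trans (∑∑-+ {n} _ _) (cong₂ ℕ._+_ (adj-count G u) (adj-count G v))))))))
      near-factor : 1ℚ ≤ R ^ near G * (R⁻¹ * R⁻¹)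
      near-factor = begin
        1ℚ  ≡⟨ cong₂ _*_ RR⁻¹≡1 RR⁻¹≡1 ⟨
        R * R⁻¹ * (R * R⁻¹)  ≡⟨ solve 2 (λ R r → R :* r :* (R :* r) := R :* (R :* con 1ℚ) :* (r :* r)) refl R R⁻¹ ⟩
        R ^ 2 * (R⁻¹ * R⁻¹)  ≤⟨ *-monoʳ (R⁻¹ * R⁻¹) (0≤* 0≤R⁻¹ 0≤R⁻¹) (^-monoʳ 1≤R 2≤near) ⟩
        R ^ near G * (R⁻¹ * R⁻¹)  ∎

    -- Linear in `J₀`, which is at most 1 as u ≠ v: in a sum over all `w`, the term with `R` then
    -- contributes for two vertices only.
    W-empty : W (emptyGraph n) ≤ Λ ^ d * (R⁻¹ * R⁻¹) * (1ℚ + R * ι J₀)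
    W-empty rewrite count-empty F = *-mono (0≤^ 0≤R J₀) 0≤K
      (≤-reflexive (*-identityʳ (Λ ^ d * (R⁻¹ * R⁻¹))))
      (≤-trans (≤-reflexive (sym (*-identityˡ (R ^ J₀))))
      (≤-trans (weight≤ {0} {J₀} z≤n (exclusiveˡ u≢v w))
      (≤-reflexive (trans (cong (λ i → 1ℚ + - (ℤ.+ 15 / 16) * i + R * ι J₀) ι0)
        (solve 1 (λ x → con 1ℚ :+ con (- (ℤ.+ 15 / 16)) :* con 0ℚ :+ x := con 1ℚ :+ x) refl (R * ι J₀))))))

-- Weights for the edges inside a set and across its boundary

module Cuts where

  open import Data.Rational.Base
  open import Data.Rational.Properties
  open import Data.Rational.Solver using (module +-*-Solver)
  open import Data.Vec.Base using (lookup)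
  open import Defs
  open Graph using (adj)
  open Rationals
  open Casts using (≥0; ≤-by; ≤-modulo)
  open EdgeCounts
  open Growth
  open EdgeProcess using (edges)
  open +-*-Solver using (solve; _:=_; _:+_; _:*_; _:-_; :-_; con)

  module Cut {n} (S : Subset n) where

    size cosize : ℕ
    size   = ∑[ x < n ] χ (lookup S x)
    cosize = ∑[ x < n ] χ (not (lookup S x))

    size+cosize : size ℕ.+ cosize ≡ n
    size+cosize = trans (sym (∑-distrib-+ {n} _ _)) (trans (sum-cong-≗ {n} (λ x → trans (ℕ.+-comm (χ (lookup S x)) _) (χ-not (lookup S x))))
      (trans (sum-const n 1) (ℕ.*-identityʳ n)))

    -- Over ordered pairs, an edge inside S is counted twice by `Inner`, a boundary edge once by
    -- `Cross`.
    Inner Cross : Weight n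
    Inner x y = χ (lookup S x) ℕ.* χ (lookup S y)
    Cross x y = χ (lookup S x) ℕ.* χ (not (lookup S y))

    missing-Inner : ∀ G → missingWeight Inner G ℕ.≤ size ℕ.* size
    missing-Inner G = begin
      missingWeight Inner G  ≤⟨ ℕ.≤-trans (ℕ.m≤m+n _ (count Inner G)) (ℕ.m≤m+n _ (diagonal Inner)) ⟩
      missingWeight Inner G ℕ.+ count Inner G ℕ.+ diagonal Inner  ≡⟨ ∑-missing G Inner ⟩
      ∑∑ Inner  ≡⟨ ∑∑-product {n} _ _ ⟩
      size ℕ.* size  ∎
      where open ℕ.≤-Reasoning

    -- All edges of G are given away, which is affordable for sets of linear size: the graph has O(n
    -- log n) edges when this is applied.
    missing-Cross : ∀ G → size ℕ.* cosize ℕ.≤ missingWeight Cross G ℕ.+ edges G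
    missing-Cross G = begin
      size ℕ.* cosize  ≡⟨ ∑∑-product {n} _ _ ⟨
      ∑∑ Cross  ≡⟨ ∑-missing G Cross ⟨
      missingWeight Cross G ℕ.+ count Cross G ℕ.+ diagonal Cross  ≡⟨ cong (missingWeight Cross G ℕ.+ count Cross G ℕ.+_) diagonal≡0 ⟩
      missingWeight Cross G ℕ.+ count Cross G ℕ.+ 0  ≡⟨ ℕ.+-identityʳ _ ⟩
      missingWeight Cross G ℕ.+ count Cross G  ≤⟨ ℕ.+-monoʳ-≤ (missingWeight Cross G) (∑∑-mono (λ x y → ℕ.*-monoʳ-≤ (χ (adj G x y)) (ℕ.*-mono-≤ (χ≤1 (lookup S x)) (χ≤1 (not (lookup S y)))))) ⟩
      missingWeight Cross G ℕ.+ edges G  ∎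
      where
      open ℕ.≤-Reasoning
      χ*χ-not : ∀ b → χ b ℕ.* χ (not b) ≡ 0
      χ*χ-not true  = refl
      χ*χ-not false = refl
      diagonal≡0 : diagonal Cross ≡ 0
      diagonal≡0 = trans (sum-cong-≗ {n} (λ x → χ*χ-not (lookup S x))) (sum-zero n)

    module Dense (A A⁻¹ : ℚ) (ℓ : ℕ) (1≤A : 1ℚ ≤ A) (0≤A⁻¹ : 0ℚ ≤ A⁻¹) (AA⁻¹≡1 : A * A⁻¹ ≡ 1ℚ) where

      W : Graph n → ℚ
      W G = A⁻¹ ^ (ℓ ℕ.* size) * (A ^ 4) ^ count Inner G

      0≤A : 0ℚ ≤ A
      0≤A = ≤-trans 0≤1 1≤A

      0≤W : ∀ G → 0ℚ ≤ W G
      0≤W G = 0≤* (0≤^ 0≤A⁻¹ (ℓ ℕ.* size)) (0≤^ (0≤^ 0≤A 4) (count Inner G))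

      -- A new edge inside S raises `count Inner` by 2 and multiplies `W` by A^8 ≤ 1 + 2h. Hence the
      -- choice D = A^8: if A^8 |S| ≤ n, the growth factor is at most 1 + 2|S|/n.
      W-growth : ∀ G {r} → ι (#missing G) + (ℤ.+ 1 / 2) * A ^ 8 * ι (size ℕ.* size) ≤ r * ι (#missing G) → Growth r W G
      W-growth G {r} sum≤ = growth {W = W} {G} {r} h 0ℚ Inner Inner (0≤W G) step (begin
        M + h * ι m + 0ℚ * ι m  ≡⟨ solve 3 (λ M h m → M :+ h :* m :+ con 0ℚ :* m := M :+ h :* m) refl M h (ι m) ⟩
        M + h * ι m  ≤⟨ +-monoʳ-≤ M (*-monoˡ h 0≤h (ι-mono-≤ (missing-Inner G))) ⟩
        M + h * ι (size ℕ.* size)  ≤⟨ sum≤ ⟩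
        r * M  ∎)
        where
        open ≤-Reasoning
        h = (ℤ.+ 1 / 2) * A ^ 8
        M = ι (#missing G)
        m = missingWeight Inner G
        0≤h : 0ℚ ≤ h
        0≤h = 0≤* (≥0 (ℤ.+ 1 / 2)) (0≤^ 0≤A 8)
        pointwise : ∀ a b → (A ^ 4) ^ (χ a ℕ.* χ b ℕ.+ χ b ℕ.* χ a) ≤
                    1ℚ + h * ι (χ a ℕ.* χ b ℕ.+ χ b ℕ.* χ a) + 0ℚ * ι (χ a ℕ.* χ b ℕ.+ χ b ℕ.* χ a)
        pointwise true true rewrite ι≡ℕtoℚ 2 = ≤-by
          (solve 1 (λ z → con 1ℚ :+ con (ℤ.+ 1 / 2) :* z :* con (ℕtoℚ 2) :+ con 0ℚ :* con (ℕtoℚ 2) :- z := con 1ℚ) refl (A ^ 8) ∙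
           cong (λ z → 1ℚ + h * ℕtoℚ 2 + 0ℚ * ℕtoℚ 2 - z) (solve 1 (λ A → A :* (A :* (A :* (A :* con 1ℚ))) :* (A :* (A :* (A :* (A :* con 1ℚ))) :* con 1ℚ)
              := A :* (A :* (A :* (A :* (A :* (A :* (A :* (A :* con 1ℚ)))))))) refl A))
          0≤1
          where
          infixl 5 _∙_
          _∙_ : ∀ {a b c : ℚ} → b ≡ c → a ≡ b → a ≡ c
          q ∙ p = trans p q
        pointwise true  false rewrite ι0 = ≤-reflexive (solve 1 (λ h → con 1ℚ := con 1ℚ :+ h :* con 0ℚ :+ con 0ℚ :* con 0ℚ) refl h)
        pointwise false true  rewrite ι0 = ≤-reflexive (solve 1 (λ h → con 1ℚ := con 1ℚ :+ h :* con 0ℚ :+ con 0ℚ :* con 0ℚ) refl h)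
        pointwise false false rewrite ι0 = ≤-reflexive (solve 1 (λ h → con 1ℚ := con 1ℚ :+ h :* con 0ℚ :+ con 0ℚ :* con 0ℚ) refl h)
        step : ∀ {e} → e ∈ missing G → W (addEdge G e) ≤ W G * (1ℚ + h * ι (symmetrise Inner e) + 0ℚ * ι (symmetrise Inner e))
        step {e@((a , b) , _)} e∈ = begin
          A⁻¹ ^ (ℓ ℕ.* size) * (A ^ 4) ^ count Inner (addEdge G e)
            ≡⟨ cong (A⁻¹ ^ (ℓ ℕ.* size) *_) (^-addEdge (A ^ 4) Inner G e∈) ⟩
          A⁻¹ ^ (ℓ ℕ.* size) * ((A ^ 4) ^ count Inner G * (A ^ 4) ^ symmetrise Inner e)
            ≡⟨ *-assoc (A⁻¹ ^ (ℓ ℕ.* size)) _ _ ⟨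
          W G * (A ^ 4) ^ symmetrise Inner e
            ≤⟨ *-monoˡ (W G) (0≤W G) (pointwise (lookup S a) (lookup S b)) ⟩
          W G * (1ℚ + h * ι (symmetrise Inner e) + 0ℚ * ι (symmetrise Inner e)) ∎

      1≤W : ∀ G → ℓ ℕ.* size ℕ.≤ 4 ℕ.* count Inner G → 1ℚ ≤ W G
      1≤W G dense = begin
        1ℚ  ≡⟨ 1^ (ℓ ℕ.* size) ⟨
        1ℚ ^ (ℓ ℕ.* size)  ≡⟨ cong (_^ (ℓ ℕ.* size)) (trans (*-comm A⁻¹ A) AA⁻¹≡1) ⟨
        (A⁻¹ * A) ^ (ℓ ℕ.* size)  ≡⟨ ^-distrib-* A⁻¹ A (ℓ ℕ.* size) ⟩
        A⁻¹ ^ (ℓ ℕ.* size) * A ^ (ℓ ℕ.* size)  ≤⟨ *-monoˡ _ (0≤^ 0≤A⁻¹ (ℓ ℕ.* size)) (^-monoʳ 1≤A dense) ⟩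
        A⁻¹ ^ (ℓ ℕ.* size) * A ^ (4 ℕ.* count Inner G)  ≡⟨ cong (A⁻¹ ^ (ℓ ℕ.* size) *_) (^-assocʳ A 4 (count Inner G)) ⟨
        W G  ∎
        where open ≤-Reasoning

      W-empty : W (emptyGraph n) ≡ A⁻¹ ^ (ℓ ℕ.* size)
      W-empty rewrite count-empty Inner = *-identityʳ _

    -- The weights 1 + θ inside S and 1 - θ - θ² across the boundary are chosen with 3Kθ = 1, so that
    -- (1 + θ)^(K + 2) (1 - θ - θ²)^K ≥ 1.
    module Expanding (K : ℕ) (θ : ℚ) (0≤θ : 0ℚ ≤ θ) (3Kθ≡1 : ℕtoℚ 3 * ι K * θ ≡ 1ℚ) (1≤K : 1 ℕ.≤ K) where

      -- `β` and `ξ` make the one-step factor exactly affine: x² = 1 + 2β for an inner edge, counted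
      -- twice, and y = 1 - ξ for a boundary edge.
      x y β ξ : ℚ
      x = 1ℚ + θ
      y = 1ℚ - (θ + θ * θ)
      β = θ + (ℤ.+ 1 / 2) * (θ * θ)
      ξ = θ + θ * θ

      W : Graph n → ℚ
      W G = x ^ count Inner G * y ^ count Cross G

      3θ≤1 : ℕtoℚ 3 * θ ≤ 1ℚ
      3θ≤1 = begin
        ℕtoℚ 3 * θ  ≡⟨ solve 1 (λ θ → con (ℕtoℚ 3) :* θ := con (ℕtoℚ 3) :* con 1ℚ :* θ) refl θ ⟩
        ℕtoℚ 3 * 1ℚ * θ  ≤⟨ *-monoʳ θ 0≤θ (*-monoˡ (ℕtoℚ 3) (≥0 (ℕtoℚ 3)) (subst (_≤ ι K) ι1 (ι-mono-≤ 1≤K))) ⟩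
        ℕtoℚ 3 * ι K * θ  ≡⟨ 3Kθ≡1 ⟩
        1ℚ  ∎
        where open ≤-Reasoning

      0≤θ² : 0ℚ ≤ θ * θ
      0≤θ² = 0≤* 0≤θ 0≤θ

      ξ≤1 : ξ ≤ 1ℚ
      ξ≤1 = ≤-by (solve 1 (λ θ → con 1ℚ :- (θ :+ θ :* θ) := con (ℤ.+ 1 / 3) :* (con 1ℚ :- con (ℕtoℚ 3) :* θ) :* (θ :+ con (ℤ.+ 4 / 3)) :+ con (ℤ.+ 5 / 9)) refl θ)
        (0≤+ (0≤* (0≤* (≥0 (ℤ.+ 1 / 3)) (p≤q⇒0≤q-p 3θ≤1)) (0≤+ 0≤θ (≥0 (ℤ.+ 4 / 3)))) (≥0 (ℤ.+ 5 / 9)))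

      0≤x : 0ℚ ≤ x
      0≤x = 0≤+ 0≤1 0≤θ

      0≤y : 0ℚ ≤ y
      0≤y = p≤q⇒0≤q-p ξ≤1

      0≤W : ∀ G → 0ℚ ≤ W G
      0≤W G = 0≤* (0≤^ 0≤x (count Inner G)) (0≤^ 0≤y (count Cross G))

      W-growth : ∀ G {r} →
        (∀ i c → i ℕ.≤ size ℕ.* size → size ℕ.* cosize ℕ.≤ c ℕ.+ edges G →
          ι (#missing G) + β * ι i + - ξ * ι c ≤ r * ι (#missing G)) →
        Growth r W G
      W-growth G {r} sum≤ = growth {W = W} {G} {r} β (- ξ) Inner Cross (0≤W G) step
        (sum≤ _ _ (missing-Inner G) (missing-Cross G))
        where
        open ≤-Reasoning
        pointwise : ∀ a b → x ^ (χ a ℕ.* χ b ℕ.+ χ b ℕ.* χ a) * y ^ (χ a ℕ.* χ (not b) ℕ.+ χ b ℕ.* χ (not a)) ≡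
                    1ℚ + β * ι (χ a ℕ.* χ b ℕ.+ χ b ℕ.* χ a) + - ξ * ι (χ a ℕ.* χ (not b) ℕ.+ χ b ℕ.* χ (not a))
        pointwise true true rewrite ι0 | ι≡ℕtoℚ 2 = solve 2 (λ θ ξ → (con 1ℚ :+ θ) :* ((con 1ℚ :+ θ) :* con 1ℚ) :* con 1ℚ
          := con 1ℚ :+ (θ :+ con (ℤ.+ 1 / 2) :* (θ :* θ)) :* con (ℕtoℚ 2) :+ ξ :* con 0ℚ) refl θ (- ξ)
        pointwise true  false rewrite ι0 | ι1 = trans (solve 1 (λ ξ → con 1ℚ :* ((con 1ℚ :+ ξ) :* con 1ℚ) := con 1ℚ :+ ξ) refl (- ξ))
          (solve 2 (λ β ξ → con 1ℚ :+ ξ := con 1ℚ :+ β :* con 0ℚ :+ ξ :* con 1ℚ) refl β (- ξ))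
        pointwise false true  rewrite ι0 | ι1 = trans (solve 1 (λ ξ → con 1ℚ :* ((con 1ℚ :+ ξ) :* con 1ℚ) := con 1ℚ :+ ξ) refl (- ξ))
          (solve 2 (λ β ξ → con 1ℚ :+ ξ := con 1ℚ :+ β :* con 0ℚ :+ ξ :* con 1ℚ) refl β (- ξ))
        pointwise false false rewrite ι0 = solve 2 (λ β ξ → con 1ℚ :* con 1ℚ := con 1ℚ :+ β :* con 0ℚ :+ ξ :* con 0ℚ) refl β (- ξ)
        step : ∀ {e} → e ∈ missing G → W (addEdge G e) ≤ W G * (1ℚ + β * ι (symmetrise Inner e) + - ξ * ι (symmetrise Cross e))
        step {e@((a , b) , _)} e∈ = ≤-reflexive (begin-equality
          x ^ count Inner (addEdge G e) * y ^ count Cross (addEdge G e)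
            ≡⟨ cong₂ _*_ (^-addEdge x Inner G e∈) (^-addEdge y Cross G e∈) ⟩
          x ^ count Inner G * x ^ symmetrise Inner e * (y ^ count Cross G * y ^ symmetrise Cross e)
            ≡⟨ solve 4 (λ a b c d → a :* b :* (c :* d) := a :* c :* (b :* d)) refl (x ^ count Inner G) (x ^ symmetrise Inner e) (y ^ count Cross G) (y ^ symmetrise Cross e) ⟩
          W G * (x ^ symmetrise Inner e * y ^ symmetrise Cross e)
            ≡⟨ cong (W G *_) (pointwise (lookup S a) (lookup S b)) ⟩
          W G * (1ℚ + β * ι (symmetrise Inner e) + - ξ * ι (symmetrise Cross e)) ∎)

      g : ℚ
      g = ℕtoℚ 2 * (θ * θ) + θ * θ * θ

      x*y≡1-g : x * y ≡ 1ℚ + - g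
      x*y≡1-g = solve 1 (λ θ → (con 1ℚ :+ θ) :* (con 1ℚ :- (θ :+ θ :* θ)) := con 1ℚ :- (con (ℕtoℚ 2) :* (θ :* θ) :+ θ :* θ :* θ)) refl θ

      -- The product is (xy)^K x², where xy = 1 - g has no linear term in θ. By 3Kθ = 1, Kg = (2θ +
      -- θ²)/3, so Bernoulli leaves 1 + θ (4 - 5θ - 2θ²)/3, and θ ≤ 1/3. The two extra factors x
      -- win.
      base≥1 : 1ℚ ≤ x ^ (K ℕ.+ 2) * y ^ K
      base≥1 = begin
        1ℚ
          ≤⟨ ≤-modulo (- (ℤ.+ 1 / 3) * (ℕtoℚ 2 * θ + θ * θ) * (1ℚ + ℕtoℚ 2 * θ)) 3Kθ≡1
               (solve 2 (λ θ K → (con 1ℚ :+ K :* (:- (con (ℕtoℚ 2) :* (θ :* θ) :+ θ :* θ :* θ))) :* (con 1ℚ :+ con (ℕtoℚ 2) :* θ) :- con 1ℚ :=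
                  θ :* (con (ℤ.+ 19 / 27) :+ (con 1ℚ :- con (ℕtoℚ 3) :* θ) :* (con (ℤ.+ 17 / 27) :+ con (ℤ.+ 2 / 9) :* θ))
                  :+ con (- (ℤ.+ 1 / 3)) :* (con (ℕtoℚ 2) :* θ :+ θ :* θ) :* (con 1ℚ :+ con (ℕtoℚ 2) :* θ) :* (con (ℕtoℚ 3) :* K :* θ :- con 1ℚ)) refl θ (ι K))
               (0≤* 0≤θ (0≤+ (≥0 (ℤ.+ 19 / 27)) (0≤* (p≤q⇒0≤q-p 3θ≤1) (0≤+ (≥0 (ℤ.+ 17 / 27)) (0≤* (≥0 (ℤ.+ 2 / 9)) 0≤θ))))) ⟩
        (1ℚ + ι K * - g) * (1ℚ + ℕtoℚ 2 * θ)
          ≤⟨ *-mono (0≤+ 0≤1 (0≤* (≥0 (ℕtoℚ 2)) 0≤θ)) (0≤^ 0≤xy K) (bernoulli (- g) 0≤xy K)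
               (≤-+ʳ (solve 1 (λ θ → (con 1ℚ :+ θ) :* ((con 1ℚ :+ θ) :* con 1ℚ) := con 1ℚ :+ con (ℕtoℚ 2) :* θ :+ θ :* θ) refl θ) 0≤θ²) ⟩
        (1ℚ + - g) ^ K * x ^ 2
          ≡⟨ cong (λ z → z ^ K * x ^ 2) x*y≡1-g ⟨
        (x * y) ^ K * x ^ 2
          ≡⟨ cong (_* x ^ 2) (^-distrib-* x y K) ⟩
        x ^ K * y ^ K * x ^ 2
          ≡⟨ solve 3 (λ a b c → a :* b :* c := a :* c :* b) refl (x ^ K) (y ^ K) (x ^ 2) ⟩
        x ^ K * x ^ 2 * y ^ K
          ≡⟨ cong (_* y ^ K) (^-homo-* x K 2) ⟨
        x ^ (K ℕ.+ 2) * y ^ K ∎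
        where
        open ≤-Reasoning
        0≤xy : 0ℚ ≤ 1ℚ + - g
        0≤xy = subst (0ℚ ≤_) x*y≡1-g (0≤* 0≤x 0≤y)

      -- The ratio (K + 2)/K would be a fractional exponent, so the K-th power of `W` is compared
      -- with a power of the base instead.
      1≤W : ∀ G → (K ℕ.+ 2) ℕ.* count Cross G ℕ.≤ K ℕ.* count Inner G → 1ℚ ≤ W G
      1≤W G sparse = 1≤^⇒1≤ (0≤W G) K 1≤K (begin
        1ℚ  ≤⟨ 1≤^ base≥1 C ⟩
        (x ^ (K ℕ.+ 2) * y ^ K) ^ C  ≡⟨ ^-distrib-* (x ^ (K ℕ.+ 2)) (y ^ K) C ⟩
        (x ^ (K ℕ.+ 2)) ^ C * (y ^ K) ^ C  ≡⟨ cong₂ _*_ (^-assocʳ x (K ℕ.+ 2) C) (^-assocʳ y K C) ⟩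
        x ^ ((K ℕ.+ 2) ℕ.* C) * y ^ (K ℕ.* C)  ≤⟨ *-monoʳ (y ^ (K ℕ.* C)) (0≤^ 0≤y (K ℕ.* C)) (^-monoʳ (≤-+ʳ refl 0≤θ) sparse) ⟩
        x ^ (K ℕ.* I) * y ^ (K ℕ.* C)  ≡⟨ cong₂ (λ a b → x ^ a * y ^ b) (ℕ.*-comm K I) (ℕ.*-comm K C) ⟩
        x ^ (I ℕ.* K) * y ^ (C ℕ.* K)  ≡⟨ cong₂ _*_ (^-assocʳ x I K) (^-assocʳ y C K) ⟨
        (x ^ I) ^ K * (y ^ C) ^ K  ≡⟨ ^-distrib-* (x ^ I) (y ^ C) K ⟨
        W G ^ K  ∎)
        where
        open ≤-Reasoning
        I = count Inner G
        C = count Cross G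

      W-empty : W (emptyGraph n) ≡ 1ℚ
      W-empty rewrite count-empty Inner = refl

-- The deterministic part: resilience from the structural properties

module Connectivity where

  open import Data.Bool.Base using (T)
  open import Data.Bool.Properties using (T-≡; ¬-not; T?; not-involutive; T-∧; T-not-≡)
  open import Data.Empty using (⊥; ⊥-elim)
  open import Data.Fin.Base using (zero; suc)
  open import Data.Fin.Properties using (_≟_; any?)
  open import Data.Fin.Subset using (∁)
  open import Data.Nat.Base using (_+_; _*_; _≤_; _<_; _≤ᵇ_; >-nonZero)
  open import Data.Nat.Properties hiding (_≟_)
  open import Data.Nat.Solver using (module +-*-Solver)
  open import Data.Vec.Base using (lookup; _[_]≔_; replicate)
  open import Data.Vec.Properties using (lookup-replicate; lookup-map; lookup∘update; lookup∘update′)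
  open import Relation.Binary.Construct.Closure.ReflexiveTransitive using (Star; ε; _◅_; _◅◅_)
  open import Defs
  open Graph using (adj; adj-sym; adj-irrefl)
  open EdgeCounts
  open Growth using (⟦≡⟧-refl)
  open Cuts using (module Cut)
  open +-*-Solver using (solve; _:=_; _:+_; _:*_; con)

  sum-unique : ∀ {n} (f : Fin n → ℕ) → (∀ x → f x ≤ 1) → (∀ x y → 1 ≤ f x → 1 ≤ f y → x ≡ y) → sum f ≤ 1
  sum-unique {n} f f≤1 unique with any? (λ x → 1 ≤? f x)
  ... | no  none       = ≤-trans (≤-reflexive (trans (sum-cong-≗ (λ x → n<1⇒n≡0 (≰⇒> (λ 1≤fx → none (x , 1≤fx))))) (sum-zero n))) z≤n
  ... | yes (y , 1≤fy) = ≤-trans (sum-mono f≤) (≤-reflexive (sum-χ≡ y))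
    where
    f≤ : ∀ x → f x ≤ ⟦ x ≡ y ⟧
    f≤ x with x ≟ y
    ... | yes refl = f≤1 x
    ... | no  x≢y  = ≤-pred (≰⇒> (λ 1≤fx → x≢y (unique x y 1≤fx 1≤fy)))

  Closed : ∀ {n} → Graph n → Subset n → Set
  Closed G S = ∀ x y → lookup S x ≡ true → lookup S y ≡ false → adj G x y ≡ false

  module _ {n} (G : Graph n) where

    cross? : (S : Subset n) → Dec (∃[ x ] ∃[ y ] T (adj G x y ∧ (lookup S x ∧ not (lookup S y))))
    cross? S = any? (λ x → any? (λ y → T? (adj G x y ∧ (lookup S x ∧ not (lookup S y)))))

    size-insert : ∀ S y → lookup S y ≡ false → Cut.size (S [ y ]≔ true) ≡ Cut.size S + 1
    size-insert S y y∉S = trans (sum-cong-≗ {n} pointwise) (trans (∑-distrib-+ {n} (λ x → χ (lookup S x)) (λ x → ⟦ x ≡ y ⟧)) (cong (Cut.size S +_) (sum-χ≡ y)))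
      where
      pointwise : ∀ x → χ (lookup (S [ y ]≔ true) x) ≡ χ (lookup S x) + ⟦ x ≡ y ⟧
      pointwise x with x ≟ y
      ... | yes refl rewrite lookup∘update y S true | y∉S = refl
      ... | no  x≢y  rewrite lookup∘update′ x≢y S true = sym (+-identityʳ _)

    -- Search from `u`: while an edge leaves S, its end is added. Every insertion trades one unit of
    -- fuel for one of size; with no fuel left S has n vertices, contradicting that `v` lies
    -- outside.
    separate : ∀ u v fuel S → n ≤ fuel + Cut.size S → lookup S u ≡ true → (∀ x → lookup S x ≡ true → Star (Adj G) u x) →
               Star (Adj G) u v ⊎ (∃[ S ] Closed G S × lookup S u ≡ true × lookup S v ≡ false)
    separate u v fuel S n≤ u∈S reach with lookup S v in v∈S
    ... | true  = inj₁ (reach v v∈S)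
    ... | false with cross? S
    ...   | no  none = inj₂ (S , (λ x y x∈ y∉ → ¬-not (λ a → none (x , y , subst T (sym (cong₂ _∧_ a (cong₂ (λ b c → b ∧ not c) x∈ y∉))) _))) , u∈S , v∈S)
    ...   | yes (x , y , xy) with fuel
    ...     | zero  = contradiction n≤ (<⇒≱ (≤-trans (≤-reflexive (+-comm 1 (Cut.size S)))
                        (≤-trans (+-monoʳ-≤ (Cut.size S) (≤-trans (≤-reflexive (sym (cong (χ ∘ not) v∈S))) (term≤sum (λ x → χ (not (lookup S x))) v)))
                          (≤-reflexive (Cut.size+cosize S)))))
    ...     | suc f = separate u v f (S [ y ]≔ true)
                        (≤-trans n≤ (≤-reflexive (trans (sym (+-suc f _)) (cong (f +_) (trans (+-comm 1 _) (sym (size-insert S y y∉)))))))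
                        (inserted u (inj₁ u∈S)) reach′
      where
      parts = Equivalence.to (T-∧ {adj G x y}) xy
      parts′ = Equivalence.to (T-∧ {lookup S x}) (proj₂ parts)
      x∈ : lookup S x ≡ true
      x∈ = Equivalence.to T-≡ (proj₁ parts′)
      y∉ : lookup S y ≡ false
      y∉ = Equivalence.to T-not-≡ (proj₂ parts′)
      inserted : ∀ z → lookup S z ≡ true ⊎ z ≡ y → lookup (S [ y ]≔ true) z ≡ true
      inserted z (inj₂ refl) = lookup∘update y S true
      inserted z (inj₁ z∈) with z ≟ y
      ... | yes refl = lookup∘update y S true
      ... | no  z≢y  = trans (lookup∘update′ z≢y S true) z∈
      reach′ : ∀ z → lookup (S [ y ]≔ true) z ≡ true → Star (Adj G) u z
      reach′ z z∈ with z ≟ y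
      ... | yes refl = reach x x∈ ◅◅ (proj₁ parts ◅ ε)
      ... | no  z≢y  = reach z (trans (sym (lookup∘update′ z≢y S true)) z∈)

    connected-or-cut : ∀ u v → Star (Adj G) u v ⊎ (∃[ S ] Closed G S × lookup S u ≡ true × lookup S v ≡ false)
    connected-or-cut u v = separate u v n (replicate n false [ u ]≔ true) (m≤m+n n _) (lookup∘update u (replicate n false) true) only-u
      where
      only-u : ∀ x → lookup (replicate n false [ u ]≔ true) x ≡ true → Star (Adj G) u x
      only-u x x∈ with x ≟ u
      ... | yes refl = ε
      ... | no  x≢u with () ← trans (sym (trans (lookup∘update′ x≢u (replicate n false) true) (lookup-replicate x false))) x∈

  lookup-∁ : ∀ {n} (S : Subset n) x → lookup (∁ S) x ≡ not (lookup S x)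
  lookup-∁ S x = lookup-map x not S

  ∁-closed : ∀ {n} (G : Graph n) {S} → Closed G S → Closed G (∁ S)
  ∁-closed G {S} closed x y x∈∁ y∉∁ = trans (adj-sym G x y)
    (closed y x (trans (sym (not-involutive _)) (cong not (trans (sym (lookup-∁ S y)) y∉∁)))
                (trans (sym (not-involutive _)) (cong not (trans (sym (lookup-∁ S x)) x∈∁))))

  -- `few` is the degree condition on `H` with the constant 1/2 - 1/K, denominators cleared.
  module Robust {n} (G : Graph n) (ℓ K D : ℕ) (1≤K : 1 ≤ K)
    (1≤deg : ∀ v → 1 ≤ deg G v)
    (sparse-low : ∀ u v w → u ≢ v → 1 ≤ χ (adj G u w) + ⟦ u ≡ w ⟧ → 1 ≤ χ (adj G v w) + ⟦ v ≡ w ⟧ →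
                  ¬ (deg G u + deg G v ≤ ℓ + ℓ))
    (small-sparse : ∀ S → 1 ≤ Cut.size S → D * Cut.size S ≤ n → ¬ (ℓ * Cut.size S ≤ 4 * count (Cut.Inner S) G))
    (large-expand : ∀ S → n < D * Cut.size S → 2 * Cut.size S ≤ n →
                    ¬ ((K + 2) * count (Cut.Cross S) G ≤ K * count (Cut.Inner S) G))
    (H : Graph n) (few : ∀ v → 2 * K * deg H v + 2 * deg G v ≤ K * deg G v)
    where

    module Small (S : Subset n) (closed : Closed (G ∖ H) S) where

      open Cut S

      s : Fin n → ℕ
      s x = χ (lookup S x)

      inner cross : Fin n → ℕ
      inner x = ∑[ y < n ] (χ (adj G x y) * s y)
      cross x = ∑[ y < n ] (χ (adj G x y) * χ (not (lookup S y)))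

      deg≡ : ∀ x → deg G x ≡ cross x + inner x
      deg≡ x = begin
        deg G x  ≡⟨ deg≡sum G x ⟩
        (∑[ y < n ] χ (adj G x y))  ≡⟨ sum-cong-≗ (λ y → trans (sym (*-identityʳ _)) (trans (cong (χ (adj G x y) *_) (sym (χ-not (lookup S y)))) (*-distribˡ-+ (χ (adj G x y)) _ _))) ⟩
        ∑[ y < n ] (χ (adj G x y) * χ (not (lookup S y)) + χ (adj G x y) * s y)  ≡⟨ ∑-distrib-+ {n} _ _ ⟩
        cross x + inner x  ∎
        where open ≡-Reasoning

      cross≤deg : ∀ x → lookup S x ≡ true → cross x ≤ deg H x
      cross≤deg x x∈ = ≤-trans (sum-mono pointwise) (≤-reflexive (sym (deg≡sum H x)))
        where
        removed : ∀ a b → (a ∧ not b) ≡ false → χ a * 1 ≤ χ b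
        removed true  true  _ = ≤-refl
        removed false b     _ = z≤n
        pointwise : ∀ y → χ (adj G x y) * χ (not (lookup S y)) ≤ χ (adj H x y)
        pointwise y with lookup S y in y∈
        ... | true  = ≤-trans (≤-reflexive (*-zeroʳ (χ (adj G x y)))) z≤n
        ... | false = removed (adj G x y) (adj H x y) (closed x y x∈ y∈)

      -- Boundary edges belong to `H`, so cross ≤ (1/2 - 1/K)(cross + inner). This even gives (K +
      -- 2) cross ≤ (K - 2) inner; the surplus 2 inner is dropped.
      cross≤inner : ∀ x → lookup S x ≡ true → (K + 2) * cross x ≤ K * inner x
      cross≤inner x x∈ = +-cancelˡ-≤ (K * cross x + 2 * inner x) _ _ (begin
        K * cross x + 2 * inner x + (K + 2) * cross x
          ≡⟨ solve 3 (λ K c i → K :* c :+ con 2 :* i :+ (K :+ con 2) :* c := con 2 :* K :* c :+ con 2 :* (c :+ i)) refl K (cross x) (inner x) ⟩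
        2 * K * cross x + 2 * (cross x + inner x)
          ≤⟨ +-monoˡ-≤ _ (*-monoʳ-≤ (2 * K) (cross≤deg x x∈)) ⟩
        2 * K * deg H x + 2 * (cross x + inner x)
          ≡⟨ cong (λ d → 2 * K * deg H x + 2 * d) (deg≡ x) ⟨
        2 * K * deg H x + 2 * deg G x
          ≤⟨ few x ⟩
        K * deg G x
          ≡⟨ cong (K *_) (deg≡ x) ⟩
        K * (cross x + inner x)
          ≤⟨ m≤m+n _ (2 * inner x) ⟩
        K * (cross x + inner x) + 2 * inner x
          ≡⟨ solve 3 (λ K c i → K :* (c :+ i) :+ con 2 :* i := K :* c :+ con 2 :* i :+ K :* i) refl K (cross x) (inner x) ⟩
        K * cross x + 2 * inner x + K * inner x ∎)
        where open ≤-Reasoning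

      count-rows : ∀ (f : Fin n → ℕ) → count (λ x y → s x * f y) G ≡ ∑[ x < n ] (s x * ∑[ y < n ] (χ (adj G x y) * f y))
      count-rows f = sum-cong-≗ (λ x → trans
        (sum-cong-≗ (λ y → solve 3 (λ a b c → a :* (b :* c) := b :* (a :* c)) refl (χ (adj G x y)) (s x) (f y)))
        (sym (*-distribˡ-sum (s x) (λ y → χ (adj G x y) * f y))))

      sum-S-mono : ∀ {f g : Fin n → ℕ} → (∀ x → lookup S x ≡ true → f x ≤ g x) → ∑[ x < n ] (s x * f x) ≤ ∑[ x < n ] (s x * g x)
      sum-S-mono {f} {g} f≤g = sum-mono pointwise
        where
        pointwise : ∀ x → s x * f x ≤ s x * g x
        pointwise x with lookup S x in x∈
        ... | true  = *-monoʳ-≤ 1 (f≤g x x∈)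
        ... | false = z≤n

      sum-S-* : ∀ c (f : Fin n → ℕ) → ∑[ x < n ] (s x * (c * f x)) ≡ c * ∑[ x < n ] (s x * f x)
      sum-S-* c f = trans (sum-cong-≗ (λ x → solve 3 (λ a b c → a :* (b :* c) := b :* (a :* c)) refl (s x) c (f x))) (sym (*-distribˡ-sum c (λ x → s x * f x)))

      expands : (K + 2) * count Cross G ≤ K * count Inner G
      expands = begin
        (K + 2) * count Cross G  ≡⟨ cong ((K + 2) *_) (count-rows (λ y → χ (not (lookup S y)))) ⟩
        (K + 2) * ∑[ x < n ] (s x * cross x)  ≡⟨ sum-S-* (K + 2) cross ⟨
        ∑[ x < n ] (s x * ((K + 2) * cross x))  ≤⟨ sum-S-mono cross≤inner ⟩
        ∑[ x < n ] (s x * (K * inner x))  ≡⟨ sum-S-* K inner ⟩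
        K * ∑[ x < n ] (s x * inner x)  ≡⟨ cong (K *_) (count-rows s) ⟨
        K * count Inner G  ∎
        where open ≤-Reasoning

      deg≤2inner : ∀ x → lookup S x ≡ true → deg G x ≤ 2 * inner x
      deg≤2inner x x∈ = begin
        deg G x  ≡⟨ deg≡ x ⟩
        cross x + inner x  ≤⟨ +-monoˡ-≤ (inner x) cross≤ ⟩
        inner x + inner x  ≡⟨ cong (inner x +_) (+-identityʳ (inner x)) ⟨
        2 * inner x  ∎
        where
        open ≤-Reasoning
        cross≤ : cross x ≤ inner x
        cross≤ = *-cancelˡ-≤ K {{>-nonZero 1≤K}} (≤-trans (*-monoˡ-≤ (cross x) (m≤m+n K 2)) (cross≤inner x x∈))

      1≤inner : ∀ x → lookup S x ≡ true → 1 ≤ inner x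
      1≤inner x x∈ with inner x | deg≤2inner x x∈
      ... | zero  | le = contradiction (≤-trans (1≤deg x) le) λ ()
      ... | suc _ | _  = s≤s z≤n

      low : Fin n → Bool
      low x = deg G x ≤ᵇ ℓ

      low⇒≤ : ∀ x → 1 ≤ χ (low x) → deg G x ≤ ℓ
      low⇒≤ x 1≤ = ≤ᵇ⇒≤ _ _ (1≤χ⇒T (low x) 1≤)
        where
        1≤χ⇒T : ∀ b → 1 ≤ χ b → T b
        1≤χ⇒T true _ = _

      S-low S-high : ℕ
      S-low  = ∑[ x < n ] (s x * χ (low x))
      S-high = ∑[ x < n ] (s x * χ (not (low x)))

      size≡ : size ≡ S-low + S-high
      size≡ = trans (sum-cong-≗ (λ x → trans (sym (*-identityʳ (s x))) (trans (cong (s x *_) (trans (sym (χ-not (low x))) (+-comm _ (χ (low x))))) (*-distribˡ-+ (s x) _ _))))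
                    (∑-distrib-+ {n} _ _)

      1≤m*n⇒1≤m : ∀ a b → 1 ≤ a * b → 1 ≤ a × 1 ≤ b
      1≤m*n⇒1≤m zero    b       ()
      1≤m*n⇒1≤m (suc a) zero    1≤ = contradiction (≤-trans 1≤ (≤-reflexive (*-zeroʳ a))) λ ()
      1≤m*n⇒1≤m (suc a) (suc b) _ = s≤s z≤n , s≤s z≤n

      -- Two low neighbours of `w` lie in its closed neighbourhood, and so do a low `w` and a low
      -- neighbour. Hence at most one low neighbour, and none if `w` is low.
      low-neighbours : ∀ w → ∑[ x < n ] (χ (low x) * χ (adj G x w)) ≤ χ (not (low w))
      low-neighbours w with low w in low-w
      ... | false = sum-unique _ (λ x → *-mono-≤ (χ≤1 (low x)) (χ≤1 (adj G x w))) unique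
        where
        unique : ∀ x y → 1 ≤ χ (low x) * χ (adj G x w) → 1 ≤ χ (low y) * χ (adj G y w) → x ≡ y
        unique x y 1≤x 1≤y with x ≟ y
        ... | yes x≡y = x≡y
        ... | no  x≢y = let (lx , ax) = 1≤m*n⇒1≤m (χ (low x)) _ 1≤x ; (ly , ay) = 1≤m*n⇒1≤m (χ (low y)) _ 1≤y in
          ⊥-elim (sparse-low x y w x≢y (≤-trans ax (m≤m+n _ _)) (≤-trans ay (m≤m+n _ _)) (+-mono-≤ (low⇒≤ x lx) (low⇒≤ y ly)))
      ... | true = ≤-reflexive (trans (sum-cong-≗ zero-term) (sum-zero n))
        where
        zero-term : ∀ x → χ (low x) * χ (adj G x w) ≡ 0
        zero-term x = n<1⇒n≡0 (≰⇒> λ 1≤x → let (lx , ax) = 1≤m*n⇒1≤m (χ (low x)) _ 1≤x in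
          sparse-low x w w (λ { refl → contradiction (≤-trans ax (≤-reflexive (cong χ (adj-irrefl G x)))) λ () })
            (≤-trans ax (m≤m+n _ _)) (≤-trans (≤-reflexive (sym (⟦≡⟧-refl w))) (m≤n+m ⟦ w ≡ w ⟧ _))
            (+-mono-≤ (low⇒≤ x lx) (low⇒≤ w (≤-reflexive (sym (cong χ low-w))))))

      -- Double counting of adjacent pairs (x, w) with x low and w in S: each low x in S has such a
      -- w by `1≤inner`, and each w occurs at most once, only if it is high.
      S-low≤S-high : S-low ≤ S-high
      S-low≤S-high = begin
        ∑[ x < n ] (s x * χ (low x))
          ≤⟨ sum-S-mono (λ x x∈ → ≤-trans (≤-reflexive (sym (*-identityʳ (χ (low x))))) (*-monoʳ-≤ (χ (low x)) (1≤inner x x∈))) ⟩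
        ∑[ x < n ] (s x * (χ (low x) * inner x))
          ≤⟨ sum-mono (λ x → ≤-trans (*-monoˡ-≤ _ (χ≤1 (lookup S x))) (≤-reflexive (*-identityˡ _))) ⟩
        ∑[ x < n ] (χ (low x) * inner x)
          ≡⟨ sum-cong-≗ {n} (λ x → *-distribˡ-sum (χ (low x)) (λ w → χ (adj G x w) * s w)) ⟩
        ∑∑ (λ x w → χ (low x) * (χ (adj G x w) * s w))
          ≡⟨ ∑∑-flip {n} _ ⟩
        ∑∑ (λ w x → χ (low x) * (χ (adj G x w) * s w))
          ≡⟨ sum-cong-≗ (λ w → trans (sum-cong-≗ (λ x → solve 3 (λ a b c → a :* (b :* c) := c :* (a :* b)) refl (χ (low x)) (χ (adj G x w)) (s w)))
                                     (sym (*-distribˡ-sum (s w) (λ x → χ (low x) * χ (adj G x w))))) ⟩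
        ∑[ w < n ] (s w * ∑[ x < n ] (χ (low x) * χ (adj G x w)))
          ≤⟨ sum-mono (λ w → *-monoʳ-≤ (s w) (low-neighbours w)) ⟩
        S-high ∎
        where open ≤-Reasoning

      high-inner : ∀ x → lookup S x ≡ true → ℓ * χ (not (low x)) ≤ 2 * inner x
      high-inner x x∈ with low x in low-x
      ... | true  = ≤-trans (≤-reflexive (*-zeroʳ ℓ)) z≤n
      ... | false = ≤-trans (≤-reflexive (*-identityʳ ℓ)) (≤-trans (<⇒≤ (≰⇒> (λ d≤ℓ → subst T low-x (≤⇒≤ᵇ d≤ℓ)))) (deg≤2inner x x∈))

      -- One factor 2 because half of S is high, another because half of each degree stays inside S.
      dense : ℓ * size ≤ 4 * count Inner G
      dense = begin
        ℓ * size  ≡⟨ cong (ℓ *_) size≡ ⟩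
        ℓ * (S-low + S-high)  ≤⟨ *-monoʳ-≤ ℓ (+-monoˡ-≤ S-high S-low≤S-high) ⟩
        ℓ * (S-high + S-high)  ≡⟨ solve 2 (λ l h → l :* (h :+ h) := con 2 :* (l :* h)) refl ℓ S-high ⟩
        2 * (ℓ * S-high)  ≡⟨ cong (2 *_) (sum-S-* ℓ (λ x → χ (not (low x)))) ⟨
        2 * ∑[ x < n ] (s x * (ℓ * χ (not (low x)))) ≤⟨ *-monoʳ-≤ 2 (sum-S-mono high-inner) ⟩
        2 * ∑[ x < n ] (s x * (2 * inner x))  ≡⟨ cong (2 *_) (sum-S-* 2 inner) ⟩
        2 * (2 * ∑[ x < n ] (s x * inner x))  ≡⟨ cong (λ c → 2 * (2 * c)) (count-rows s) ⟨
        2 * (2 * count Inner G)  ≡⟨ *-assoc 2 2 (count Inner G) ⟨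
        4 * count Inner G  ∎
        where open ≤-Reasoning

      contradictory : 1 ≤ size → 2 * size ≤ n → ⊥
      contradictory 1≤size 2size≤n with D * size ≤? n
      ... | yes small = small-sparse S 1≤size small dense
      ... | no  large = large-expand S (≰⇒> large) 2size≤n expands

    connected : ∀ u v → Star (Adj (G ∖ H)) u v
    connected u v with connected-or-cut (G ∖ H) u v
    ... | inj₁ path = path
    ... | inj₂ (S , closed , u∈S , v∉S) = ⊥-elim (smaller (≤-total (Cut.size S) (Cut.cosize S)))
      where
      doubled : ∀ {a b} → a ≤ b → a + b ≡ n → 2 * a ≤ n
      doubled {a} {b} a≤b a+b≡n = ≤-trans (+-monoʳ-≤ a (≤-trans (≤-reflexive (+-identityʳ a)) a≤b)) (≤-reflexive a+b≡n)
      size-∁ : Cut.size (∁ S) ≡ Cut.cosize S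
      size-∁ = sum-cong-≗ (λ x → cong χ (lookup-∁ S x))
      smaller : Cut.size S ≤ Cut.cosize S ⊎ Cut.cosize S ≤ Cut.size S → ⊥
      smaller (inj₁ le) = Small.contradictory S closed
        (≤-trans (≤-reflexive (sym (cong χ u∈S))) (term≤sum (λ x → χ (lookup S x)) u))
        (doubled le (Cut.size+cosize S))
      smaller (inj₂ le) = Small.contradictory (∁ S) (∁-closed (G ∖ H) {S} closed)
        (≤-trans (≤-reflexive (sym (cong χ (trans (lookup-∁ S v) (cong not v∉S))))) (term≤sum (λ x → χ (lookup (∁ S) x)) v))
        (subst (λ m → 2 * m ≤ n) (sym size-∁) (doubled le (trans (+-comm (Cut.cosize S) _) (Cut.size+cosize S))))

-- Numerical one-step rates and estimates of powers

module Rates where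

  open import Data.Rational.Base
  open import Data.Rational.Properties
  open import Data.Rational.Solver using (module +-*-Solver)
  open import Defs using (ℕtoℚ)
  open Rationals
  open Casts using (≥0; ≤-by; ≤-modulo)
  open +-*-Solver using (solve; _:=_; _:+_; _:*_; _:-_; :-_; con)

  -- `N` is the number of vertices, `M` that of missing edges, and `i` is 1/N, kept as a variable
  -- with a relation so that all the inequalities are polynomial.
  module _ {N i M : ℚ} (Ni≡1 : N * i ≡ 1ℚ) (0≤N : 0ℚ ≤ N) (0≤i : 0ℚ ≤ i) where

    isolated-rate : ℕtoℚ 2 * M + N ≤ N * N → M - N + 1ℚ ≤ (1ℚ - ℕtoℚ 2 * i) * M
    isolated-rate M≤ = ≤-modulo (1ℚ - N) Ni≡1
      (solve 3 (λ N i M → (con 1ℚ :- con (ℕtoℚ 2) :* i) :* M :- (M :- N :+ con 1ℚ) :=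
        i :* (N :* N :- (con (ℕtoℚ 2) :* M :+ N)) :+ (con 1ℚ :- N) :* (N :* i :- con 1ℚ)) refl N i M)
      (0≤* 0≤i (p≤q⇒0≤q-p M≤))

    -- After division by x² q the claim is `core`. The true rate is 2/N; the constant 11/5 pays for
    -- the edges already present (1250/1249) and for the chord bound, which loses (1 - q/2)/(1 - q)
    -- ≤ 15/14.
    survival-rate : ∀ {q x} → (ℤ.+ 1249 / 1250) * (N * N) ≤ ℕtoℚ 2 * M → 0ℚ ≤ q → q ≤ ℤ.+ 1 / 8 → 0ℚ ≤ x → x * (1ℚ - q) ≡ 1ℚ →
      (ℤ.+ 1 / 2) * (x * x - 1ℚ) * (N - 1ℚ) ≤ M * ((1ℚ - q * (1ℚ - (ℤ.+ 11 / 5) * i) - (1ℚ - q)) * x)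
    survival-rate {q} {x} ≤M 0≤q q≤⅛ 0≤x xz≡1 = begin
      (ℤ.+ 1 / 2) * (x * x - 1ℚ) * (N - 1ℚ)
        ≡⟨ cong (λ y → (ℤ.+ 1 / 2) * (x * x - y * y) * (N - 1ℚ)) xz≡1 ⟨
      (ℤ.+ 1 / 2) * (x * x - x * (1ℚ - q) * (x * (1ℚ - q))) * (N - 1ℚ)
        ≡⟨ solve 3 (λ N q x → con (ℤ.+ 1 / 2) :* (x :* x :- x :* (con 1ℚ :- q) :* (x :* (con 1ℚ :- q))) :* (N :- con 1ℚ) :=
             x :* x :* q :* ((con 1ℚ :- con (ℤ.+ 1 / 2) :* q) :* (N :- con 1ℚ))) refl N q x ⟩
      x * x * q * ((1ℚ - (ℤ.+ 1 / 2) * q) * (N - 1ℚ))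
        ≤⟨ *-monoˡ (x * x * q) (0≤* (0≤* 0≤x 0≤x) 0≤q) core ⟩
      x * x * q * ((ℤ.+ 11 / 5) * i * M * (1ℚ - q))
        ≡⟨ solve 4 (λ i M q x → x :* x :* q :* (con (ℤ.+ 11 / 5) :* i :* M :* (con 1ℚ :- q)) := con (ℤ.+ 11 / 5) :* i :* M :* q :* x :* (x :* (con 1ℚ :- q))) refl i M q x ⟩
      (ℤ.+ 11 / 5) * i * M * q * x * (x * (1ℚ - q))
        ≡⟨ cong ((ℤ.+ 11 / 5) * i * M * q * x *_) xz≡1 ⟩
      (ℤ.+ 11 / 5) * i * M * q * x * 1ℚ
        ≡⟨ solve 4 (λ i M q x → con (ℤ.+ 11 / 5) :* i :* M :* q :* x :* con 1ℚ := M :* ((con 1ℚ :- q :* (con 1ℚ :- con (ℤ.+ 11 / 5) :* i) :- (con 1ℚ :- q)) :* x)) refl i M q x ⟩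
      M * ((1ℚ - q * (1ℚ - (ℤ.+ 11 / 5) * i) - (1ℚ - q)) * x) ∎
      where
      open ≤-Reasoning
      core : (1ℚ - (ℤ.+ 1 / 2) * q) * (N - 1ℚ) ≤ (ℤ.+ 11 / 5) * i * M * (1ℚ - q)
      core = ≤-modulo ((ℤ.+ 13739 / 12500) * (1ℚ - q) * N) Ni≡1
        (solve 4 (λ N i M q → con (ℤ.+ 11 / 5) :* i :* M :* (con 1ℚ :- q) :- (con 1ℚ :- con (ℤ.+ 1 / 2) :* q) :* (N :- con 1ℚ) :=
           con (ℤ.+ 11 / 10) :* i :* ((con (ℤ.+ 1 / 8) :- q) :+ con (ℤ.+ 7 / 8)) :* (con (ℕtoℚ 2) :* M :- con (ℤ.+ 1249 / 1250) :* (N :* N))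
           :+ con (ℤ.+ 7489 / 12500) :* (con (ℤ.+ 1 / 8) :- q) :* N :+ con (ℤ.+ 2423 / 100000) :* N
           :+ (con (ℤ.+ 1 / 2) :* (con (ℤ.+ 1 / 8) :- q) :+ con (ℤ.+ 15 / 16))
           :+ con (ℤ.+ 13739 / 12500) :* (con 1ℚ :- q) :* N :* (N :* i :- con 1ℚ)) refl N i M q)
        (0≤+ (0≤+ (0≤+ (0≤* (0≤* (0≤* (≥0 (ℤ.+ 11 / 10)) 0≤i) (0≤+ 0≤⅛-q (≥0 (ℤ.+ 7 / 8)))) (p≤q⇒0≤q-p ≤M))
          (0≤* (0≤* (≥0 (ℤ.+ 7489 / 12500)) 0≤⅛-q) 0≤N)) (0≤* (≥0 (ℤ.+ 2423 / 100000)) 0≤N))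
          (0≤+ (0≤* (≥0 (ℤ.+ 1 / 2)) 0≤⅛-q) (≥0 (ℤ.+ 15 / 16))))
        where
        0≤⅛-q = p≤q⇒0≤q-p q≤⅛

    -- Of the gain (15/16)·2N, edges to the common neighbour take N/32 and the claimed rate takes at
    -- most 7N/4. The remaining 3N/32 is exactly what the error 2ℓ + 3 ≤ N/10 needs.
    low-degree-rate : ∀ {ℓ f j} → ℕtoℚ 2 * M + N ≤ N * N → ℕtoℚ 2 * N ≤ f + (ℕtoℚ 2 * ℓ + ℕtoℚ 3) → j ≤ ℕtoℚ 2 →
      ℕtoℚ 10 * (ℕtoℚ 2 * ℓ + ℕtoℚ 3) ≤ N →
      M + - (ℤ.+ 15 / 16) * f + (ℤ.+ 1 / 64) * N * j ≤ (1ℚ - (ℤ.+ 7 / 2) * i) * M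
    low-degree-rate {ℓ} {f} {j} M≤ f≥ j≤ ℓ≤ = ≤-modulo ((ℤ.+ 7 / 4) - (ℤ.+ 7 / 4) * N) Ni≡1
      (solve 6 (λ N i M ℓ f j → (con 1ℚ :- con (ℤ.+ 7 / 2) :* i) :* M :- (M :+ con (- (ℤ.+ 15 / 16)) :* f :+ con (ℤ.+ 1 / 64) :* N :* j) :=
         con (ℤ.+ 7 / 4) :* i :* (N :* N :- (con (ℕtoℚ 2) :* M :+ N))
         :+ con (ℤ.+ 15 / 16) :* (f :+ (con (ℕtoℚ 2) :* ℓ :+ con (ℕtoℚ 3)) :- con (ℕtoℚ 2) :* N)
         :+ con (ℤ.+ 1 / 64) :* N :* (con (ℕtoℚ 2) :- j)
         :+ con (ℤ.+ 3 / 32) :* (N :- con (ℕtoℚ 10) :* (con (ℕtoℚ 2) :* ℓ :+ con (ℕtoℚ 3)))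
         :+ con (ℤ.+ 7 / 4)
         :+ (con (ℤ.+ 7 / 4) :- con (ℤ.+ 7 / 4) :* N) :* (N :* i :- con 1ℚ)) refl N i M ℓ f j)
      (0≤+ (0≤+ (0≤+ (0≤+ (0≤* (0≤* (≥0 (ℤ.+ 7 / 4)) 0≤i) (p≤q⇒0≤q-p M≤)) (0≤* (≥0 (ℤ.+ 15 / 16)) (p≤q⇒0≤q-p f≥)))
        (0≤* (0≤* (≥0 (ℤ.+ 1 / 64)) 0≤N) (p≤q⇒0≤q-p j≤))) (0≤* (≥0 (ℤ.+ 3 / 32)) (p≤q⇒0≤q-p ℓ≤))) (≥0 (ℤ.+ 7 / 4)))

    dense-rate : ∀ {s A} → N * N ≤ ℕtoℚ 4 * M → 0ℚ ≤ s → A * s ≤ N →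
      M + (ℤ.+ 1 / 2) * A * (s * s) ≤ (1ℚ + s * (ℕtoℚ 2 * i)) * M
    dense-rate {s} {A} ≤M 0≤s As≤N = ≤-modulo ((ℤ.+ 1 / 2) * s * N) Ni≡1
      (solve 5 (λ N i M s A → (con 1ℚ :+ s :* (con (ℕtoℚ 2) :* i)) :* M :- (M :+ con (ℤ.+ 1 / 2) :* A :* (s :* s)) :=
         con (ℤ.+ 1 / 2) :* i :* s :* (con (ℕtoℚ 4) :* M :- N :* N) :+ con (ℤ.+ 1 / 2) :* s :* (N :- A :* s)
         :+ con (ℤ.+ 1 / 2) :* s :* N :* (N :* i :- con 1ℚ)) refl N i M s A)
      (0≤+ (0≤* (0≤* (0≤* (≥0 (ℤ.+ 1 / 2)) 0≤i) 0≤s) (p≤q⇒0≤q-p ≤M)) (0≤* (0≤* (≥0 (ℤ.+ 1 / 2)) 0≤s) (p≤q⇒0≤q-p As≤N)))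

  -- With θ = τD the linear terms of the two weights cancel and leave -θ²s²/2, at most -τ²N²/2 as Ds
  -- ≥ N. The edges present give back at most E ≤ τ²N²/4, and what is left is at least (τ²/2)M.
  expanding-rate : ∀ {N M τ D s f c E} → 0ℚ ≤ N → 0ℚ ≤ τ → 0ℚ ≤ D → 0ℚ ≤ s → 0ℚ ≤ E →
    τ * D + τ * D * (τ * D) ≤ 1ℚ → ℕtoℚ 2 * M + N ≤ N * N → N ≤ D * s → ℕtoℚ 4 * E ≤ τ * τ * (N * N) →
    f ≤ s * s → s * s ≤ c + E →
    M + (τ * D + (ℤ.+ 1 / 2) * (τ * D * (τ * D))) * f + - (τ * D + τ * D * (τ * D)) * c ≤ (1ℚ - (ℤ.+ 1 / 2) * (τ * τ)) * M
  expanding-rate {N} {M} {τ} {D} {s} {f} {c} {E} 0≤N 0≤τ 0≤D 0≤s 0≤E ξ≤1 M≤ N≤Ds E≤ f≤ ≤c+E = ≤-by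
    (solve 8 (λ N M τ D s f c E →
       let θ = τ :* D ; β = θ :+ con (ℤ.+ 1 / 2) :* (θ :* θ) ; ξ = θ :+ θ :* θ in
       (con 1ℚ :- con (ℤ.+ 1 / 2) :* (τ :* τ)) :* M :- (M :+ β :* f :+ (:- ξ) :* c) :=
       β :* (s :* s :- f) :+ ξ :* (c :+ E :- s :* s) :+ (con 1ℚ :- ξ) :* E :+ con (ℤ.+ 1 / 4) :* (τ :* τ :* (N :* N) :- con (ℕtoℚ 4) :* E)
       :+ con (ℤ.+ 1 / 4) :* (τ :* τ) :* ((N :* N :- (con (ℕtoℚ 2) :* M :+ N)) :+ N)
       :+ con (ℤ.+ 1 / 2) :* (τ :* τ) :* ((D :* s :- N) :* (D :* s :+ N))) refl N M τ D s f c E)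
    (0≤+ (0≤+ (0≤+ (0≤+ (0≤+ (0≤* (0≤+ 0≤θ (0≤* (≥0 (ℤ.+ 1 / 2)) (0≤* 0≤θ 0≤θ))) (p≤q⇒0≤q-p f≤))
      (0≤* (0≤+ 0≤θ (0≤* 0≤θ 0≤θ)) (p≤q⇒0≤q-p ≤c+E))) (0≤* (p≤q⇒0≤q-p ξ≤1) 0≤E)) (0≤* (≥0 (ℤ.+ 1 / 4)) (p≤q⇒0≤q-p E≤)))
      (0≤* (0≤* (≥0 (ℤ.+ 1 / 4)) (0≤* 0≤τ 0≤τ)) (0≤+ (p≤q⇒0≤q-p M≤) 0≤N)))
      (0≤* (0≤* (≥0 (ℤ.+ 1 / 2)) (0≤* 0≤τ 0≤τ)) (0≤* (p≤q⇒0≤q-p N≤Ds) (0≤+ (0≤* 0≤D 0≤s) 0≤N))))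
    where
    0≤θ : 0ℚ ≤ τ * D
    0≤θ = 0≤* 0≤τ 0≤D

  half-power : ∀ {x c} ℓ → 0ℚ ≤ c → x * ℕtoℚ 2 ^ ℓ ≤ c → x ≤ c * ½ ^ ℓ
  half-power {x} {c} ℓ 0≤c x2^ℓ≤c = begin
    x  ≡⟨ *-identityʳ x ⟨
    x * 1ℚ  ≡⟨ cong (x *_) (1^ ℓ) ⟨
    x * (ℕtoℚ 2 * ½) ^ ℓ  ≡⟨ cong (x *_) (^-distrib-* (ℕtoℚ 2) ½ ℓ) ⟩
    x * (ℕtoℚ 2 ^ ℓ * ½ ^ ℓ)  ≡⟨ *-assoc x _ _ ⟨
    x * ℕtoℚ 2 ^ ℓ * ½ ^ ℓ  ≤⟨ *-monoʳ (½ ^ ℓ) (0≤^ (≥0 ½) ℓ) x2^ℓ≤c ⟩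
    c * ½ ^ ℓ  ∎
    where open ≤-Reasoning

  power-ratio : ∀ {ρ u v} → ρ * ι u ≡ ι v → 1 ℕ.≤ u → ∀ c b m → c ℕ.* u ℕ.^ m ℕ.≤ b ℕ.* v ℕ.^ m → ι c ≤ ι b * ρ ^ m
  power-ratio {ρ} {u} {v} ρu≡v 1≤u c b m c≤ = *-cancelʳ-≤-pos (ι u ^ m)
    {{positive (<-≤-trans {0ℚ} {1ℚ} (positive⁻¹ 1ℚ) (1≤^ (subst (_≤ ι u) ι1 (ι-mono-≤ 1≤u)) m))}} (begin
    ι c * ι u ^ m  ≡⟨ trans (cong (ι c *_) (sym (ι-^ u m))) (sym (ι-* c (u ℕ.^ m))) ⟩
    ι (c ℕ.* u ℕ.^ m)  ≤⟨ ι-mono-≤ c≤ ⟩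
    ι (b ℕ.* v ℕ.^ m)  ≡⟨ trans (ι-* b (v ℕ.^ m)) (cong (ι b *_) (ι-^ v m)) ⟩
    ι b * ι v ^ m  ≡⟨ cong (λ z → ι b * z ^ m) ρu≡v ⟨
    ι b * (ρ * ι u) ^ m  ≡⟨ cong (ι b *_) (^-distrib-* ρ (ι u) m) ⟩
    ι b * (ρ ^ m * ι u ^ m)  ≡⟨ *-assoc (ι b) _ _ ⟨
    ι b * ρ ^ m * ι u ^ m  ∎)
    where open ≤-Reasoning

  decay : ∀ {r x ρ} k → 0ℚ ≤ r → 0ℚ ≤ x → r * (1ℚ + x) ≤ 1ℚ → ρ ≤ 1ℚ + ι k * x → r ^ k * ρ ≤ 1ℚ
  decay k 0≤r 0≤x rx≤1 ρ≤ = ≤-trans (*-monoˡ _ (0≤^ 0≤r k) ρ≤) (inverse-bernoulli 0≤r 0≤x rx≤1 k)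

  ^-≤1 : ∀ {p c} → 0ℚ ≤ p → 0ℚ ≤ c → p * c ≤ 1ℚ → ∀ m → p ^ m * c ^ m ≤ 1ℚ
  ^-≤1 {p} {c} 0≤p 0≤c pc≤1 m = subst (_≤ 1ℚ) (^-distrib-* p c m) (^≤1 (0≤* 0≤p 0≤c) pc≤1 m)

  decay-power : ∀ {p c ρ} m → 0ℚ ≤ p → 0ℚ ≤ ρ → p * ρ ≤ 1ℚ → c ≤ ρ ^ m → p ^ m * c ≤ 1ℚ
  decay-power m 0≤p 0≤ρ pρ≤1 c≤ = ≤-trans (*-monoˡ _ (0≤^ 0≤p m) c≤) (^-≤1 0≤p 0≤ρ pρ≤1 m)

  [1-x][1+x]≤1 : ∀ x → (1ℚ - x) * (1ℚ + x) ≤ 1ℚ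
  [1-x][1+x]≤1 x = ≤-by (solve 1 (λ x → con 1ℚ :- (con 1ℚ :- x) :* (con 1ℚ :+ x) := x :* x) refl x) (0≤p² x)

-- The five potentials, their consequences and initial values

module Potentials where

  open import Data.Fin.Patterns using (0F; 1F; 2F)
  open import Data.Fin.Properties using (_≟_)
  open import Data.List.Properties using (length-tabulate)
  open import Data.List.Membership.Propositional.Properties using (∈-map⁺; ∈-++⁺ˡ; ∈-++⁺ʳ; ∈-allFin)
  open import Data.Rational.Base
  open import Data.Rational.Properties hiding (_≟_)
  open import Data.Rational.Solver using (module +-*-Solver)
  open import Data.Vec.Base as Vec using ([]; _∷_)
  open import Relation.Nullary.Decidable using (¬?; _×-dec_)
  open import Defs
  open Rationals
  open Casts
  open EdgeCounts
  open EdgeProcess using (edges; Supermartingale)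
  open Growth
  open LowDegrees using (module LowDegreePair)
  open Cuts using (module Cut)
  open Rates
  open +-*-Solver using (solve; _:=_; _:+_; _:*_; _:-_; :-_; con)

  -- The step is demanded before time `m` only, because the rates rely on most edges still being
  -- missing.
  record Potential {n} (m : ℕ) (f : ℕ → Graph n → ℚ) : Set where
    field
      nonneg : ∀ t G → 0ℚ ≤ f t G
      step   : ∀ t G → t ℕ.< m → edges G ≡ t ℕ.* 2 →
               ∑ (missing G) (f (suc t) ∘ addEdge G) ≤ ι (#missing G) * f t G

  open Potential public

  private variable
    n m : ℕ
    Index : Set

  0-potential : Potential {n} m (λ _ _ → 0ℚ)
  0-potential .nonneg _ _     = ≤-refl
  0-potential .step   _ G _ _ = ≤-reflexive (trans (∑-zero (missing G)) (sym (*-zeroʳ (ι (#missing G)))))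

  +-potential : ∀ {f g : ℕ → Graph n → ℚ} → Potential m f → Potential m g → Potential m (λ t G → f t G + g t G)
  +-potential pf pg .nonneg t G = 0≤+ (pf .nonneg t G) (pg .nonneg t G)
  +-potential {f = f} {g} pf pg .step t G t<m e≡ = begin
    ∑ (missing G) (λ e → f (suc t) (addEdge G e) + g (suc t) (addEdge G e))  ≡⟨ ∑-+ (missing G) _ _ ⟩
    ∑ (missing G) (f (suc t) ∘ addEdge G) + ∑ (missing G) (g (suc t) ∘ addEdge G)
                                                                              ≤⟨ +-mono-≤ (pf .step t G t<m e≡) (pg .step t G t<m e≡) ⟩
    ι (#missing G) * f t G + ι (#missing G) * g t G  ≡⟨ *-distribˡ-+ (ι (#missing G)) _ _ ⟨
    ι (#missing G) * (f t G + g t G)  ∎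
    where open ≤-Reasoning

  ∑-potential : ∀ (xs : List Index) {f : Index → ℕ → Graph n → ℚ} → (∀ x → Potential m (f x)) → Potential m (λ t G → ∑ xs (λ x → f x t G))
  ∑-potential []       pf = 0-potential
  ∑-potential (x ∷ xs) pf = +-potential (pf x) (∑-potential xs pf)

  -- An indicator whose value may use the proof, since the low-degree weight exists for distinct
  -- vertices only.
  when : ∀ {P : Set} → Dec P → (P → ℚ) → ℚ
  when (yes p) f = f p
  when (no  _) f = 0ℚ

  when-potential : ∀ {P : Set} (P? : Dec P) {f : P → ℕ → Graph n → ℚ} → (∀ p → Potential m (f p)) →
                   Potential m (λ t G → when P? (λ p → f p t G))
  when-potential (yes p) pf = pf p
  when-potential (no  _) pf = 0-potential

  when-≤ : ∀ {P : Set} (P? : Dec P) {f : P → ℚ} {c} → 0ℚ ≤ c → (∀ p → f p ≤ c) → when P? f ≤ c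
  when-≤ (yes p) 0≤c f≤c = f≤c p
  when-≤ (no  _) 0≤c f≤c = 0≤c

  when-yes : ∀ {P : Set} (P? : Dec P) {f : P → ℚ} → P → ∃[ p ] when P? f ≡ f p
  when-yes (yes p) _ = p , refl
  when-yes (no ¬p) p = contradiction p ¬p

  -- Dropping a nonnegative function to 0 after time `m` keeps it a supermartingale, now over the
  -- whole process, and loses nothing up to time `m`.
  cutoff : ℕ → (ℕ → Graph n → ℚ) → ℕ → Graph n → ℚ
  cutoff m f t G = if t ℕ.≤ᵇ m then f t G else 0ℚ

  cutoff-≤ : ∀ {f : ℕ → Graph n → ℚ} {t G} → t ℕ.≤ m → cutoff m f t G ≡ f t G
  cutoff-≤ {m = m} {f} {t} {G} t≤m = cong (λ b → if b then f t G else 0ℚ) (dec-true (t ℕ.≤? m) t≤m)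

  cutoff-> : ∀ {f : ℕ → Graph n → ℚ} {t G} → m ℕ.< t → cutoff m f t G ≡ 0ℚ
  cutoff-> {m = m} {f} {t} {G} m<t = cong (λ b → if b then f t G else 0ℚ) (dec-false (t ℕ.≤? m) (ℕ.<⇒≱ m<t))

  0≤cutoff : ∀ {f : ℕ → Graph n → ℚ} → (∀ t G → 0ℚ ≤ f t G) → ∀ t G → 0ℚ ≤ cutoff m f t G
  0≤cutoff {m = m} 0≤f t G with t ℕ.≤ᵇ m
  ... | true  = 0≤f t G
  ... | false = ≤-refl

  cutoff-step : ∀ {f : ℕ → Graph n → ℚ} t G → (∀ t G → 0ℚ ≤ f t G) →
    (t ℕ.< m → ∑ (missing G) (f (suc t) ∘ addEdge G) ≤ ι (#missing G) * f t G) →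
    ∑ (missing G) (cutoff m f (suc t) ∘ addEdge G) ≤ ι (#missing G) * cutoff m f t G
  cutoff-step {m = m} {f} t G 0≤f f-step with t ℕ.<? m
  ... | yes t<m = begin
    ∑ (missing G) (cutoff m f (suc t) ∘ addEdge G)  ≡⟨ ∑-cong (missing G) (λ e → cutoff-≤ {f = f} t<m) ⟩
    ∑ (missing G) (f (suc t) ∘ addEdge G)  ≤⟨ f-step t<m ⟩
    ι (#missing G) * f t G  ≡⟨ cong (ι (#missing G) *_) (cutoff-≤ {f = f} (ℕ.<⇒≤ t<m)) ⟨
    ι (#missing G) * cutoff m f t G  ∎
    where open ≤-Reasoning
  ... | no  t≮m = begin
    ∑ (missing G) (cutoff m f (suc t) ∘ addEdge G)  ≡⟨ ∑-cong (missing G) (λ e → cutoff-> {f = f} (s≤s (ℕ.≮⇒≥ t≮m))) ⟩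
    ∑ (missing G) (λ _ → 0ℚ)  ≡⟨ ∑-zero (missing G) ⟩
    0ℚ  ≤⟨ 0≤* (0≤ι (#missing G)) (0≤cutoff {m = m} 0≤f t G) ⟩
    ι (#missing G) * cutoff m f t G  ∎
    where open ≤-Reasoning

  cutoff-supermartingale : ∀ {f : ℕ → Graph n → ℚ} → Potential m f → Supermartingale (cutoff m f)
  cutoff-supermartingale {m = m} {f} pf t G e≡ =
    cutoff-step {m = m} {f} t G (pf .nonneg) (λ t<m → pf .step t G t<m e≡)

  subsets : ∀ n → List (Subset n)
  subsets zero    = [] ∷ []
  subsets (suc n) = map (true ∷_) (subsets n) ++ map (false ∷_) (subsets n)

  ∈-subsets : ∀ (S : Subset n) → S ∈ subsets n
  ∈-subsets []          = here refl
  ∈-subsets (true ∷ S)  = ∈-++⁺ˡ (∈-map⁺ (true ∷_) (∈-subsets S))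
  ∈-subsets {suc n} (false ∷ S) = ∈-++⁺ʳ (map (true ∷_) (subsets n)) (∈-map⁺ (false ∷_) (∈-subsets S))

  -- The binomial theorem in the form of a union bound: a cost `y` per vertex, summed over all sets.
  ∑-subsets : ∀ n y → ∑ (subsets n) (λ S → y ^ Cut.size S) ≡ (1ℚ + y) ^ n
  ∑-subsets zero    y = refl
  ∑-subsets (suc n) y = begin
    ∑ (subsets (suc n)) (λ S → y ^ Cut.size S)
      ≡⟨ ∑-++ (map (true ∷_) (subsets n)) _ _ ⟩
    ∑ (map (true ∷_) (subsets n)) (λ S → y ^ Cut.size S) + ∑ (map (false ∷_) (subsets n)) (λ S → y ^ Cut.size S)
      ≡⟨ cong₂ _+_ (trans (∑-map (true ∷_) (subsets n) _) (∑-*ˡ (subsets n) y _)) (∑-map (false ∷_) (subsets n) _) ⟩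
    y * ∑ (subsets n) (λ S → y ^ Cut.size S) + ∑ (subsets n) (λ S → y ^ Cut.size S)
      ≡⟨ cong (λ z → y * z + z) (∑-subsets n y) ⟩
    y * (1ℚ + y) ^ n + (1ℚ + y) ^ n
      ≡⟨ solve 2 (λ y p → y :* p :+ p := (con 1ℚ :+ y) :* p) refl y ((1ℚ + y) ^ n) ⟩
    (1ℚ + y) ^ suc n ∎
    where open ≡-Reasoning

  reciprocal : ∀ {x} → 0ℚ < x → ∃[ y ] 0ℚ ≤ y × x * y ≡ 1ℚ
  reciprocal {x} 0<x = let instance
                             x≥0 = positive 0<x
                             x≢0 = pos⇒nonZero x
                       in 1/ x , nonNegative⁻¹ (1/ x) {{pos⇒nonNeg (1/ x) {{1/pos⇒pos x}}}} , *-inverseʳ x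

  -- `i`, `τ` and `A⁻¹` are the reciprocals of n, T and A₀, given by their equations. A block has
  -- `k` steps, and m₀ consists of `a` blocks for each unit of ℓ.
  module Family (n ℓ k a A₀ D T K : ℕ) (i τ A⁻¹ : ℚ)
    (1≤K : 1 ℕ.≤ K) (1≤A₀ : 1 ℕ.≤ A₀) (a≤220 : a ℕ.≤ 220) (22k≤n : 22 ℕ.* k ℕ.≤ n)
    (D≡A₀⁸ : D ≡ A₀ ℕ.^ 8) (T≡3KD : T ≡ 3 ℕ.* K ℕ.* D) (768≤T : 768 ℕ.≤ T)
    (large : 160 ℕ.* (T ℕ.* T) ℕ.* (ℓ ℕ.+ 1) ℕ.≤ n)
    (0≤i : 0ℚ ≤ i) (Ni≡1 : ι n * i ≡ 1ℚ) (0≤τ : 0ℚ ≤ τ) (Tτ≡1 : ι T * τ ≡ 1ℚ)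
    (0≤A⁻¹ : 0ℚ ≤ A⁻¹) (AA⁻¹≡1 : ι A₀ * A⁻¹ ≡ 1ℚ) where

    N A : ℚ
    N = ι n
    A = ι A₀

    m₀ m₁ : ℕ
    m₀ = k ℕ.* (a ℕ.* ℓ)
    m₁ = m₀ ℕ.+ m₀

    0≤N : 0ℚ ≤ N
    0≤N = 0≤ι n

    L : ℚ
    L = ι ℓ

    m₀≤ : ι m₀ ≤ ℕtoℚ 10 * (N * L)
    m₀≤ = begin
      ι m₀  ≡⟨ ι-⟦⟧ (var 0F ⊗ (var 1F ⊗ var 2F)) (k ∷ a ∷ ℓ ∷ []) ⟩
      ι k * (ι a * L)  ≤⟨ *-monoˡ (ι k) (0≤ι k) (*-monoʳ L (0≤ι ℓ) (cast-≤ (a ∷ []) (var 0F) (# 220) a≤220)) ⟩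
      ι k * (ℕtoℚ 220 * L)  ≡⟨ solve 2 (λ k L → k :* (con (ℕtoℚ 220) :* L) := con (ℕtoℚ 22) :* k :* (con (ℕtoℚ 10) :* L)) refl (ι k) L ⟩
      ℕtoℚ 22 * ι k * (ℕtoℚ 10 * L)  ≤⟨ *-monoʳ (ℕtoℚ 10 * L) (0≤* (≥0 (ℕtoℚ 10)) (0≤ι ℓ)) (cast-≤ (k ∷ n ∷ []) (# 22 ⊗ var 0F) (var 1F) 22k≤n) ⟩
      N * (ℕtoℚ 10 * L)  ≡⟨ solve 2 (λ N L → N :* (con (ℕtoℚ 10) :* L) := con (ℕtoℚ 10) :* (N :* L)) refl N L ⟩
      ℕtoℚ 10 * (N * L)  ∎
      where open ≤-Reasoning

    768≤ιT : ℕtoℚ 768 ≤ ι T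
    768≤ιT = cast-≤ (T ∷ []) (# 768) (var 0F) 768≤T

    160T²[L+1]≤N : ℕtoℚ 160 * (ι T * ι T) * (L + 1ℚ) ≤ N
    160T²[L+1]≤N = cast-≤ (T ∷ ℓ ∷ n ∷ []) (# 160 ⊗ (var 0F ⊗ var 0F) ⊗ (var 1F ⊕ # 1)) (var 2F) large

    50000[L+1]≤N : ℕtoℚ 50000 * (L + 1ℚ) ≤ N
    50000[L+1]≤N = ≤-by
      (solve 3 (λ N T L → N :- con (ℕtoℚ 50000) :* (L :+ con 1ℚ) :=
        (N :- con (ℕtoℚ 160) :* (T :* T) :* (L :+ con 1ℚ)) :+
        con (ℕtoℚ 160) :* ((T :- con (ℕtoℚ 768)) :* (T :+ con (ℕtoℚ 768))) :* (L :+ con 1ℚ) :+ con (ℕtoℚ 94321840) :* (L :+ con 1ℚ)) refl N (ι T) L)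
      (0≤+ (0≤+ (p≤q⇒0≤q-p 160T²[L+1]≤N)
        (0≤* (0≤* (≥0 (ℕtoℚ 160)) (0≤* (p≤q⇒0≤q-p 768≤ιT) (0≤+ (0≤ι T) (≥0 (ℕtoℚ 768))))) 0≤L+1))
        (0≤* (≥0 (ℕtoℚ 94321840)) 0≤L+1))
      where
      0≤L+1 : 0ℚ ≤ L + 1ℚ
      0≤L+1 = 0≤+ (0≤ι ℓ) 0≤1

    missing-identity : ∀ t (G : Graph n) → edges G ≡ t ℕ.* 2 → ι (#missing G) * ℕtoℚ 2 + ι t * ℕtoℚ 2 + N ≡ N * N
    missing-identity t G e≡ = cast-≡ (#missing G ∷ t ∷ n ∷ []) (var 0F ⊗ # 2 ⊕ var 1F ⊗ # 2 ⊕ var 2F) (var 2F ⊗ var 2F)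
      (trans (cong (λ e → #missing G ℕ.* 2 ℕ.+ e ℕ.+ n) (sym e≡)) (length-missing {n} G))

    #missing≤ : ∀ t (G : Graph n) → edges G ≡ t ℕ.* 2 → ℕtoℚ 2 * ι (#missing G) + N ≤ N * N
    #missing≤ t G e≡ = ≤-+ʳ (trans (sym (missing-identity t G e≡))
      (solve 3 (λ M t N → M :* con (ℕtoℚ 2) :+ t :* con (ℕtoℚ 2) :+ N := con (ℕtoℚ 2) :* M :+ N :+ t :* con (ℕtoℚ 2)) refl (ι (#missing G)) (ι t) N))
      (0≤* (0≤ι t) (≥0 (ℕtoℚ 2)))

    t≤20NL : ∀ t → t ℕ.≤ m₁ → ι t ≤ ℕtoℚ 20 * (N * L)
    t≤20NL t t≤m₁ = begin
      ι t  ≤⟨ ι-mono-≤ t≤m₁ ⟩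
      ι m₁  ≡⟨ ι-+ m₀ m₀ ⟩
      ι m₀ + ι m₀  ≤⟨ +-mono-≤ m₀≤ m₀≤ ⟩
      ℕtoℚ 10 * (N * L) + ℕtoℚ 10 * (N * L)  ≡⟨ solve 1 (λ x → con (ℕtoℚ 10) :* x :+ con (ℕtoℚ 10) :* x := con (ℕtoℚ 20) :* x) refl (N * L) ⟩
      ℕtoℚ 20 * (N * L)  ∎
      where open ≤-Reasoning

    -- At most 20NL edges are present, and 40N(L + 1) is at most the fraction 40/50000 = 1/1250 of
    -- N².
    ≤#missing : ∀ t (G : Graph n) → t ℕ.≤ m₁ → edges G ≡ t ℕ.* 2 → (ℤ.+ 1249 / 1250) * (N * N) ≤ ℕtoℚ 2 * ι (#missing G)
    ≤#missing t G t≤m₁ e≡ = ≤-modulo 1ℚ (missing-identity t G e≡)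
      (solve 4 (λ N L M t → con (ℕtoℚ 2) :* M :- con (ℤ.+ 1249 / 1250) :* (N :* N) :=
        con (ℕtoℚ 2) :* (con (ℕtoℚ 20) :* (N :* L) :- t) :+ con (ℤ.+ 1 / 1250) :* N :* (N :- con (ℕtoℚ 50000) :* (L :+ con 1ℚ)) :+ con (ℕtoℚ 39) :* N
        :+ con 1ℚ :* (M :* con (ℕtoℚ 2) :+ t :* con (ℕtoℚ 2) :+ N :- N :* N)) refl N L (ι (#missing G)) (ι t))
      (0≤+ (0≤+ (0≤* (≥0 (ℕtoℚ 2)) (p≤q⇒0≤q-p (t≤20NL t t≤m₁)))
        (0≤* (0≤* (≥0 (ℤ.+ 1 / 1250)) 0≤N) (p≤q⇒0≤q-p 50000[L+1]≤N))) (0≤* (≥0 (ℕtoℚ 39)) 0≤N))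

    quarter≤#missing : ∀ t (G : Graph n) → t ℕ.≤ m₁ → edges G ≡ t ℕ.* 2 → N * N ≤ ℕtoℚ 4 * ι (#missing G)
    quarter≤#missing t G t≤m₁ e≡ = ≤-by
      (solve 2 (λ N M → con (ℕtoℚ 4) :* M :- N :* N := con (ℕtoℚ 2) :* (con (ℕtoℚ 2) :* M :- con (ℤ.+ 1249 / 1250) :* (N :* N)) :+ con (ℤ.+ 1248 / 1250) :* (N :* N)) refl N (ι (#missing G)))
      (0≤+ (0≤* (≥0 (ℕtoℚ 2)) (p≤q⇒0≤q-p (≤#missing t G t≤m₁ e≡))) (0≤* (≥0 (ℤ.+ 1248 / 1250)) (0≤* 0≤N 0≤N)))

    50000≤N : ℕtoℚ 50000 ≤ N
    50000≤N = ≤-trans (≤-+ʳ (solve 1 (λ L → con (ℕtoℚ 50000) :* (L :+ con 1ℚ) := con (ℕtoℚ 50000) :+ con (ℕtoℚ 50000) :* L) refl L)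
      (0≤* (≥0 (ℕtoℚ 50000)) (0≤ι ℓ))) 50000[L+1]≤N

    i≤1/50000 : ℕtoℚ 50000 * i ≤ 1ℚ
    i≤1/50000 = ≤-trans (*-monoʳ i 0≤i 50000≤N) (≤-reflexive Ni≡1)

    0≤1-ci : ∀ c → {_ : Bool.T (0ℚ ≤ᵇ c)} {_ : Bool.T (c ≤ᵇ ℕtoℚ 50000)} → 0ℚ ≤ 1ℚ - c * i
    0≤1-ci c {_} {c≤} = p≤q⇒0≤q-p (≤-trans (*-monoʳ i 0≤i (≤ᵇ⇒≤ {c} {ℕtoℚ 50000} c≤)) i≤1/50000)

    1-ci≤1 : ∀ c → {_ : Bool.T (0ℚ ≤ᵇ c)} → 1ℚ - c * i ≤ 1ℚ
    1-ci≤1 c {0≤c} = ≤-by (solve 1 (λ x → con 1ℚ :- (con 1ℚ :- x) := x) refl (c * i)) (0≤* (≥0 c {0≤c}) 0≤i)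

    -- (A) An isolated vertex up to time m₀

    rA rB rC rE : ℚ
    rA = 1ℚ - (ℤ.+ 11 / 5) * i
    rB = 1ℚ - ℕtoℚ 2 * i
    rC = 1ℚ - (ℤ.+ 7 / 2) * i
    rE = 1ℚ - (ℤ.+ 1 / 2) * (τ * τ)

    0≤rA : 0ℚ ≤ rA
    0≤rA = 0≤1-ci (ℤ.+ 11 / 5)

    -- A pessimistic probability that a vertex isolated at time t is still isolated at m₀. It is
    -- capped at 1/8 to keep the loss in `survival-rate` small, and at m₀ it is 1/8, so `fA` is 1
    -- exactly when no vertex is isolated.
    q : ℕ → ℚ
    q t = (ℤ.+ 1 / 8) * rA ^ (m₀ ℕ.∸ t)

    0≤q : ∀ t → 0ℚ ≤ q t
    0≤q t = 0≤* (≥0 (ℤ.+ 1 / 8)) (0≤^ 0≤rA (m₀ ℕ.∸ t))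

    q≤⅛ : ∀ t → q t ≤ ℤ.+ 1 / 8
    q≤⅛ t = ≤-trans (*-monoˡ (ℤ.+ 1 / 8) (≥0 (ℤ.+ 1 / 8)) (^≤1 0≤rA (1-ci≤1 (ℤ.+ 11 / 5)) (m₀ ℕ.∸ t))) (≤-reflexive (*-identityʳ (ℤ.+ 1 / 8)))

    0≤1-q : ∀ t → 0ℚ ≤ 1ℚ - q t
    0≤1-q t = p≤q⇒0≤q-p {q t} {1ℚ} (≤-trans (q≤⅛ t) (≤ᵇ⇒≤ {ℤ.+ 1 / 8} {1ℚ} _))

    fA : ℕ → Graph n → ℚ
    fA = cutoff m₀ (λ t G → (1ℚ - q t) ^ #isolated G)

    fA-potential : Potential m₁ fA
    fA-potential .nonneg = 0≤cutoff {m = m₀} (λ t G → 0≤^ (0≤1-q t) (#isolated G))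
    fA-potential .step t G t<m₁ e≡ = cutoff-step {m = m₀} t G (λ t G → 0≤^ (0≤1-q t) (#isolated G)) early
      where
      early : t ℕ.< m₀ → ∑ (missing G) (λ e → (1ℚ - q (suc t)) ^ #isolated (addEdge G e)) ≤ ι (#missing G) * (1ℚ - q t) ^ #isolated G
      early t<m₀ = by-inverse (reciprocal (<-≤-trans {0ℚ} {ℤ.+ 7 / 8} {1ℚ - q′} (positive⁻¹ (ℤ.+ 7 / 8))
          (≤-by (solve 1 (λ q → con 1ℚ :- q :- con (ℤ.+ 7 / 8) := con (ℤ.+ 1 / 8) :- q) refl q′) (p≤q⇒0≤q-p (q≤⅛ (suc t))))))
        where
        q′ : ℚ
        q′ = q (suc t)
        q≡ : q t ≡ q′ * rA
        q≡ = trans (cong (λ j → (ℤ.+ 1 / 8) * rA ^ j) (ℕ.+-∸-assoc 1 t<m₀))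
          (solve 3 (λ c r p → c :* (r :* p) := c :* p :* r) refl (ℤ.+ 1 / 8) rA (rA ^ (m₀ ℕ.∸ suc t)))
        z′≤z : 1ℚ - q′ ≤ 1ℚ - q t
        z′≤z = +-monoʳ-≤ 1ℚ (neg-antimono-≤ (≤-trans (≤-reflexive q≡) (≤-trans (*-monoˡ q′ (0≤q (suc t)) (1-ci≤1 (ℤ.+ 11 / 5))) (≤-reflexive (*-identityʳ q′)))))
        by-inverse : ∃[ x ] 0ℚ ≤ x × (1ℚ - q′) * x ≡ 1ℚ →
                     ∑ (missing G) (λ e → (1ℚ - q′) ^ #isolated (addEdge G e)) ≤ ι (#missing G) * (1ℚ - q t) ^ #isolated G
        by-inverse (x , 0≤x , zx≡1) = #isolated-growth G {1ℚ - q t} {1ℚ - q′} {x} (0≤1-q (suc t)) z′≤z 1≤x xz≡1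
            (subst (λ p → (ℤ.+ 1 / 2) * (x * x - 1ℚ) * (N - 1ℚ) ≤ ι (#missing G) * ((1ℚ - p - (1ℚ - q′)) * x)) (sym q≡)
              (survival-rate {N} {i} {ι (#missing G)} Ni≡1 0≤N 0≤i {q′} {x} (≤#missing t G (ℕ.<⇒≤ t<m₁) e≡) (0≤q (suc t)) (q≤⅛ (suc t)) 0≤x xz≡1))
          where
          xz≡1 : x * (1ℚ - q′) ≡ 1ℚ
          xz≡1 = trans (*-comm x _) zx≡1
          1≤x : 1ℚ ≤ x
          1≤x = ≤-trans (≤-reflexive (sym xz≡1)) (≤-trans (*-monoˡ x 0≤x (≤-by (solve 1 (λ q → con 1ℚ :- (con 1ℚ :- q) := q) refl q′) (0≤q (suc t)))) (≤-reflexive (*-identityʳ x)))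

    -- (B) No isolated vertex at time m₁

    fB : ℕ → Graph n → ℚ
    fB t G = ∑ (allFin n) (λ v → isolatedAt v G * rB ^ (m₁ ℕ.∸ t))

    fB-potential : Potential m₁ fB
    fB-potential = ∑-potential (allFin n) λ v → record
      { nonneg = λ t G → 0≤* (0≤ι (isolated G v)) (0≤^ (0≤1-ci (ℕtoℚ 2)) (m₁ ℕ.∸ t))
      ; step   = λ t G t<m₁ e≡ → growth-< {W = isolatedAt v} {G = G} {r = rB} {t = t} t<m₁ (0≤1-ci (ℕtoℚ 2))
          (isolatedAt-growth G v {rB} (isolated-rate {N} {i} {ι (#missing G)} Ni≡1 0≤N 0≤i (#missing≤ t G e≡)))
      }

    -- (C) Vertices of low degree

    -- The weight of an edge to the common neighbour is proportional to n, so that two such edges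
    -- save n². The factor 1/64 keeps their effect on the decay rate near 1/(16n), against 4/n.
    R R⁻¹ : ℚ
    R   = (ℤ.+ 1 / 64) * N
    R⁻¹ = ℕtoℚ 64 * i

    1≤R : 1ℚ ≤ R
    1≤R = *-monoˡ (ℤ.+ 1 / 64) (≥0 (ℤ.+ 1 / 64)) (≤-trans (≤ᵇ⇒≤ {ℕtoℚ 64} _) 50000≤N)

    RR⁻¹≡1 : R * R⁻¹ ≡ 1ℚ
    RR⁻¹≡1 = trans (solve 2 (λ N i → con (ℤ.+ 1 / 64) :* N :* (con (ℕtoℚ 64) :* i) := N :* i) refl N i) Ni≡1

    0≤R⁻¹ : 0ℚ ≤ R⁻¹
    0≤R⁻¹ = 0≤* (≥0 (ℕtoℚ 64)) 0≤i

    module Low u v w (u≢v : u ≢ v) = LowDegreePair {n} u v w u≢v (ℓ ℕ.+ ℓ) R R⁻¹ 1≤R 0≤R⁻¹ RR⁻¹≡1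

    fC : ℕ → Graph n → ℚ
    fC t G = ∑ (allFin n) λ u → ∑ (allFin n) λ v → ∑ (allFin n) λ w →
             when (¬? (u ≟ v)) (λ u≢v → Low.W u v w u≢v G * rC ^ (m₀ ℕ.∸ t))

    fC-potential : Potential m₁ fC
    fC-potential = ∑-potential (allFin n) λ u → ∑-potential (allFin n) λ v → ∑-potential (allFin n) λ w →
      when-potential (¬? (u ≟ v)) λ u≢v → let open Low u v w u≢v in record
      { nonneg = λ t G → 0≤* (0≤W G) (0≤^ (0≤1-ci (ℤ.+ 7 / 2)) (m₀ ℕ.∸ t))
      ; step   = λ t G t<m₁ e≡ → growth-≤1 {W = W} {G} {rC} m₀ t (0≤1-ci (ℤ.+ 7 / 2)) (1-ci≤1 (ℤ.+ 7 / 2)) (0≤W G)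
          (W-growth G {rC} (λ f j f≥ j≤2 → low-degree-rate {N} {i} {ι (#missing G)} Ni≡1 0≤N 0≤i {ι ℓ} {ι f} {ι j} (#missing≤ t G e≡)
            (cast-≤ (n ∷ f ∷ ℓ ∷ []) (# 2 ⊗ var 0F) (var 1F ⊕ (# 2 ⊗ var 2F ⊕ # 3))
              (subst₂ ℕ._≤_ (cong (n ℕ.+_) (sym (ℕ.+-identityʳ n))) (cong (λ x → f ℕ.+ (x ℕ.+ 3)) (cong (ℓ ℕ.+_) (sym (ℕ.+-identityʳ ℓ)))) f≥))
            (cast-≤ (j ∷ []) (var 0F) (# 2) j≤2)
            10[2L+3]≤N))
      }
      where
      10[2L+3]≤N : ℕtoℚ 10 * (ℕtoℚ 2 * L + ℕtoℚ 3) ≤ N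
      10[2L+3]≤N = ≤-by (solve 2 (λ N L → N :- con (ℕtoℚ 10) :* (con (ℕtoℚ 2) :* L :+ con (ℕtoℚ 3)) :=
        (N :- con (ℕtoℚ 50000) :* (L :+ con 1ℚ)) :+ con (ℕtoℚ 49980) :* L :+ con (ℕtoℚ 49970)) refl N L)
        (0≤+ (0≤+ (p≤q⇒0≤q-p 50000[L+1]≤N) (0≤* (≥0 (ℕtoℚ 49980)) (0≤ι ℓ))) (≥0 (ℕtoℚ 49970)))

    -- (D) Small sets

    ιD≡A⁸ : ι D ≡ A ^ 8
    ιD≡A⁸ = trans (cong ι D≡A₀⁸) (ι-^ A₀ 8)

    1≤A : 1ℚ ≤ A
    1≤A = subst (_≤ A) ι1 (ι-mono-≤ 1≤A₀)

    0≤1+2i : 0ℚ ≤ 1ℚ + ℕtoℚ 2 * i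
    0≤1+2i = 0≤+ 0≤1 (0≤* (≥0 (ℕtoℚ 2)) 0≤i)

    -- A power instead of 1 + 2|S|/n, so that the potential factorises over the vertices of S and
    -- `∑-subsets` applies.
    rD : Subset n → ℚ
    rD S = (1ℚ + ℕtoℚ 2 * i) ^ Cut.size S

    Small Large : Subset n → Set
    Small S = 1 ℕ.≤ Cut.size S × D ℕ.* Cut.size S ℕ.≤ n
    Large S = n ℕ.< D ℕ.* Cut.size S × 2 ℕ.* Cut.size S ℕ.≤ n

    small? : ∀ S → Dec (Small S)
    small? S = (1 ℕ.≤? Cut.size S) ×-dec (D ℕ.* Cut.size S ℕ.≤? n)

    large? : ∀ S → Dec (Large S)
    large? S = (n ℕ.<? D ℕ.* Cut.size S) ×-dec (2 ℕ.* Cut.size S ℕ.≤? n)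

    module DenseSet S = Cut.Dense {n} S A A⁻¹ ℓ 1≤A 0≤A⁻¹ AA⁻¹≡1

    fD : ℕ → Graph n → ℚ
    fD t G = ∑ (subsets n) λ S → when (small? S) (λ _ → DenseSet.W S G * rD S ^ (m₁ ℕ.∸ t))

    fD-potential : Potential m₁ fD
    fD-potential = ∑-potential (subsets n) λ S → when-potential (small? S) λ (_ , Ds≤n) → record
      { nonneg = λ t G → 0≤* (DenseSet.0≤W S G) (0≤^ (0≤rD S) (m₁ ℕ.∸ t))
      ; step   = λ t G t<m₁ e≡ → growth-< {W = DenseSet.W S} {G = G} {r = rD S} {t = t} t<m₁ (0≤rD S)
          (DenseSet.W-growth S G {rD S} (rate S Ds≤n t G t<m₁ e≡))
      }
      where
      0≤rD : ∀ S → 0ℚ ≤ rD S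
      0≤rD S = 0≤^ 0≤1+2i (Cut.size S)
      rate : ∀ S → D ℕ.* Cut.size S ℕ.≤ n → ∀ t (G : Graph n) → t ℕ.< m₁ → edges G ≡ t ℕ.* 2 →
             ι (#missing G) + (ℤ.+ 1 / 2) * A ^ 8 * ι (Cut.size S ℕ.* Cut.size S) ≤ rD S * ι (#missing G)
      rate S Ds≤n t G t<m₁ e≡ = begin
        M + (ℤ.+ 1 / 2) * A ^ 8 * ι (s ℕ.* s)
          ≡⟨ cong (λ x → M + (ℤ.+ 1 / 2) * A ^ 8 * x) (ι-* s s) ⟩
        M + (ℤ.+ 1 / 2) * A ^ 8 * (ι s * ι s)
          ≤⟨ dense-rate {N} {i} {M} Ni≡1 0≤N 0≤i {ι s} {A ^ 8} (quarter≤#missing t G (ℕ.<⇒≤ t<m₁) e≡) (0≤ι s)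
               (subst (λ d → d * ι s ≤ N) ιD≡A⁸ (subst (_≤ N) (ι-* D s) (ι-mono-≤ Ds≤n))) ⟩
        (1ℚ + ι s * (ℕtoℚ 2 * i)) * M
          ≤⟨ *-monoʳ M (0≤ι (#missing G)) (bernoulli (ℕtoℚ 2 * i) 0≤1+2i s) ⟩
        rD S * M ∎
        where
        open ≤-Reasoning
        s = Cut.size S
        M = ι (#missing G)

    -- (E) Large sets

    θ : ℚ
    θ = τ * ι D

    3Kθ≡1 : ℕtoℚ 3 * ι K * θ ≡ 1ℚ
    3Kθ≡1 = trans (solve 3 (λ K τ D → con (ℕtoℚ 3) :* K :* (τ :* D) := con (ℕtoℚ 3) :* K :* D :* τ) refl (ι K) τ (ι D))
      (trans (cong (_* τ) (sym (cast-≡ (T ∷ K ∷ D ∷ []) (var 0F) (# 3 ⊗ var 1F ⊗ var 2F) T≡3KD))) Tτ≡1)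

    0≤θ : 0ℚ ≤ θ
    0≤θ = 0≤* 0≤τ (0≤ι D)

    module Expansion S = Cut.Expanding {n} S K θ 0≤θ 3Kθ≡1 1≤K

    τ≤1 : τ ≤ 1ℚ
    τ≤1 = begin
      τ  ≡⟨ *-identityˡ τ ⟨
      1ℚ * τ  ≤⟨ *-monoʳ τ 0≤τ (≤-trans (≤ᵇ⇒≤ {1ℚ} {ℕtoℚ 768} _) 768≤ιT) ⟩
      ι T * τ  ≡⟨ Tτ≡1 ⟩
      1ℚ  ∎
      where open ≤-Reasoning

    0≤κ : 0ℚ ≤ (ℤ.+ 1 / 2) * (τ * τ)
    0≤κ = 0≤* (≥0 (ℤ.+ 1 / 2)) (0≤* 0≤τ 0≤τ)

    0≤rE : 0ℚ ≤ rE
    0≤rE = ≤-trans (≥0 (ℤ.+ 1 / 2)) (≤-by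
      (solve 1 (λ τ → con 1ℚ :- con (ℤ.+ 1 / 2) :* (τ :* τ) :- con (ℤ.+ 1 / 2) := con (ℤ.+ 1 / 2) :* (con 1ℚ :- τ) :* (con 1ℚ :+ τ)) refl τ)
      (0≤* (0≤* (≥0 (ℤ.+ 1 / 2)) (p≤q⇒0≤q-p τ≤1)) (0≤+ 0≤1 0≤τ)))

    rE≤1 : rE ≤ 1ℚ
    rE≤1 = ≤-by (solve 1 (λ x → con 1ℚ :- (con 1ℚ :- x) := x) refl ((ℤ.+ 1 / 2) * (τ * τ))) 0≤κ

    fE : ℕ → Graph n → ℚ
    fE t G = ∑ (subsets n) λ S → when (large? S) (λ _ → Expansion.W S G * rE ^ (m₀ ℕ.∸ t))

    -- The origin of the hypothesis `large`: 4 `edges` = 8t ≤ 160NL, to be compared with N²/T².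
    4E≤τ²N² : ∀ t (G : Graph n) → t ℕ.≤ m₁ → edges G ≡ t ℕ.* 2 → ℕtoℚ 4 * ι (edges G) ≤ τ * τ * (N * N)
    4E≤τ²N² t G t≤m₁ e≡ = subst (λ x → ℕtoℚ 4 * x ≤ τ * τ * (N * N)) (sym (trans (cong ι e≡) (ι-⟦⟧ (var 0F ⊗ # 2) (t ∷ []))))
      (≤-modulo (ℕtoℚ 160 * N * L * (ι T * τ + 1ℚ)) Tτ≡1
        (solve 5 (λ N L T τ t → τ :* τ :* (N :* N) :- con (ℕtoℚ 4) :* (t :* con (ℕtoℚ 2)) :=
          con (ℕtoℚ 8) :* (con (ℕtoℚ 20) :* (N :* L) :- t) :+ τ :* τ :* N :* (N :- con (ℕtoℚ 160) :* (T :* T) :* (L :+ con 1ℚ))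
          :+ con (ℕtoℚ 160) :* (T :* T) :* (τ :* τ) :* N
          :+ con (ℕtoℚ 160) :* N :* L :* (T :* τ :+ con 1ℚ) :* (T :* τ :- con 1ℚ)) refl N L (ι T) τ (ι t))
        (0≤+ (0≤+ (0≤* (≥0 (ℕtoℚ 8)) (p≤q⇒0≤q-p (t≤20NL t t≤m₁))) (0≤* (0≤* (0≤* 0≤τ 0≤τ) 0≤N) (p≤q⇒0≤q-p 160T²[L+1]≤N)))
          (0≤* (0≤* (0≤* (≥0 (ℕtoℚ 160)) (0≤* (0≤ι T) (0≤ι T))) (0≤* 0≤τ 0≤τ)) 0≤N)))

    fE-potential : Potential m₁ fE
    fE-potential = ∑-potential (subsets n) λ S → when-potential (large? S) λ (n<Ds , 2s≤n) → record
      { nonneg = λ t G → 0≤* (Expansion.0≤W S G) (0≤^ 0≤rE (m₀ ℕ.∸ t))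
      ; step   = λ t G t<m₁ e≡ → growth-≤1 {W = Expansion.W S} {G} {rE} m₀ t 0≤rE rE≤1 (Expansion.0≤W S G)
          (Expansion.W-growth S G {rE} (rate S n<Ds 2s≤n t G t<m₁ e≡))
      }
      where
      rate : ∀ S → n ℕ.< D ℕ.* Cut.size S → 2 ℕ.* Cut.size S ℕ.≤ n → ∀ t (G : Graph n) → t ℕ.< m₁ → edges G ≡ t ℕ.* 2 →
        ∀ f c → f ℕ.≤ Cut.size S ℕ.* Cut.size S → Cut.size S ℕ.* Cut.cosize S ℕ.≤ c ℕ.+ edges G →
        ι (#missing G) + Expansion.β S * ι f + - Expansion.ξ S * ι c ≤ rE * ι (#missing G)
      rate S n<Ds 2s≤n t G t<m₁ e≡ f c f≤ c≥ = expanding-rate {N} {ι (#missing G)} {τ} {ι D} {ι s} {ι f} {ι c} {ι (edges G)}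
        0≤N 0≤τ (0≤ι D) (0≤ι s) (0≤ι (edges G)) (Expansion.ξ≤1 S) (#missing≤ t G e≡)
        (subst (N ≤_) (ι-* D s) (ι-mono-≤ (ℕ.<⇒≤ n<Ds)))
        (4E≤τ²N² t G (ℕ.<⇒≤ t<m₁) e≡)
        (subst (ι f ≤_) (ι-* s s) (ι-mono-≤ f≤))
        (subst₂ _≤_ (ι-* s s) (ι-+ c (edges G)) (ι-mono-≤ (ℕ.≤-trans (ℕ.*-monoʳ-≤ s s≤cosize) c≥)))
        where
        s = Cut.size S
        s≤cosize : s ℕ.≤ Cut.cosize S
        s≤cosize = ℕ.+-cancelˡ-≤ s _ _ (ℕ.≤-trans (ℕ.≤-reflexive (cong (s ℕ.+_) (sym (ℕ.+-identityʳ s))))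
          (ℕ.≤-trans 2s≤n (ℕ.≤-reflexive (sym (Cut.size+cosize S)))))

    f : ℕ → Graph n → ℚ
    f t G = fA t G + fB t G + fC t G + fD t G + fE t G

    f-potential : Potential m₁ f
    f-potential = +-potential (+-potential (+-potential (+-potential fA-potential fB-potential) fC-potential) fD-potential) fE-potential

    module Consequences (t : ℕ) (G : Graph n) (f<1 : f t G < 1ℚ) where

      private
        pA = fA-potential .nonneg t G
        pB = fB-potential .nonneg t G
        pC = fC-potential .nonneg t G
        pD = fD-potential .nonneg t G
        pE = fE-potential .nonneg t G

        <⇒≱ : ∀ {p q} → p < q → ¬ (q ≤ p)
        <⇒≱ p<q q≤p = <-irrefl refl (<-≤-trans p<q q≤p)

        refute : ∀ {g h} → f t G ≡ g + h → 0ℚ ≤ h → ¬ (1ℚ ≤ g)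
        refute f≡g+h 0≤h 1≤g = <⇒≱ f<1 (≤-trans 1≤g (≤-+ʳ f≡g+h 0≤h))

      fA<1 : ¬ (1ℚ ≤ fA t G)
      fA<1 = refute (solve 5 (λ a b c d e → a :+ b :+ c :+ d :+ e := a :+ (b :+ c :+ d :+ e)) refl (fA t G) (fB t G) (fC t G) (fD t G) (fE t G))
        (0≤+ (0≤+ (0≤+ pB pC) pD) pE)

      fB<1 : ¬ (1ℚ ≤ fB t G)
      fB<1 = refute (solve 5 (λ a b c d e → a :+ b :+ c :+ d :+ e := b :+ (a :+ c :+ d :+ e)) refl (fA t G) (fB t G) (fC t G) (fD t G) (fE t G))
        (0≤+ (0≤+ (0≤+ pA pC) pD) pE)

      fC<1 : ¬ (1ℚ ≤ fC t G)
      fC<1 = refute (solve 5 (λ a b c d e → a :+ b :+ c :+ d :+ e := c :+ (a :+ b :+ d :+ e)) refl (fA t G) (fB t G) (fC t G) (fD t G) (fE t G))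
        (0≤+ (0≤+ (0≤+ pA pB) pD) pE)

      fD<1 : ¬ (1ℚ ≤ fD t G)
      fD<1 = refute (solve 5 (λ a b c d e → a :+ b :+ c :+ d :+ e := d :+ (a :+ b :+ c :+ e)) refl (fA t G) (fB t G) (fC t G) (fD t G) (fE t G))
        (0≤+ (0≤+ (0≤+ pA pB) pC) pE)

      fE<1 : ¬ (1ℚ ≤ fE t G)
      fE<1 = refute (solve 5 (λ a b c d e → a :+ b :+ c :+ d :+ e := e :+ (a :+ b :+ c :+ d)) refl (fA t G) (fB t G) (fC t G) (fD t G) (fE t G))
        (0≤+ (0≤+ (0≤+ pA pB) pC) pD)

      0≤when : ∀ {P : Set} (P? : Dec P) {g : P → ℚ} → (∀ p → 0ℚ ≤ g p) → 0ℚ ≤ when P? g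
      0≤when (yes p) 0≤g = 0≤g p
      0≤when (no  _) 0≤g = ≤-refl

      expired : ∀ {m} → m ℕ.≤ t → ∀ x r → x * r ^ (m ℕ.∸ t) ≡ x
      expired m≤t x r = trans (cong (λ j → x * r ^ j) (ℕ.m≤n⇒m∸n≡0 m≤t)) (*-identityʳ x)

      some-isolated : t ℕ.≤ m₀ → 1 ℕ.≤ #isolated G
      some-isolated t≤m₀ = ℕ.≮⇒≥ λ I<1 → fA<1 (≤-reflexive (sym
        (trans (cutoff-≤ {f = λ t G → (1ℚ - q t) ^ #isolated G} {t} {G} t≤m₀) (cong ((1ℚ - q t) ^_) (ℕ.n<1⇒n≡0 I<1)))))

      none-isolated : m₁ ℕ.≤ t → ∀ v → 1 ℕ.≤ deg G v
      none-isolated m₁≤t v = ℕ.≮⇒≥ λ deg<1 → fB<1 (begin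
        1ℚ  ≡⟨ trans (cong (λ d → ι (0 ℕ.^ d)) (ℕ.n<1⇒n≡0 deg<1)) ι1 ⟨
        isolatedAt v G  ≡⟨ expired m₁≤t (isolatedAt v G) rB ⟨
        isolatedAt v G * rB ^ (m₁ ℕ.∸ t)  ≤⟨ ∈⇒≤∑ {f = λ v → isolatedAt v G * rB ^ (m₁ ℕ.∸ t)} (λ v → 0≤* (0≤ι (isolated G v)) (0≤^ (0≤1-ci (ℕtoℚ 2)) (m₁ ℕ.∸ t))) (∈-allFin v) ⟩
        fB t G  ∎)
        where open ≤-Reasoning

      low-degrees-apart : m₀ ℕ.≤ t → ∀ u v w → u ≢ v →
        1 ℕ.≤ χ (Graph.adj G u w) ℕ.+ ⟦ u ≡ w ⟧ → 1 ℕ.≤ χ (Graph.adj G v w) ℕ.+ ⟦ v ≡ w ⟧ → ¬ (deg G u ℕ.+ deg G v ℕ.≤ ℓ ℕ.+ ℓ)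
      low-degrees-apart m₀≤t u v w u≢v near-u near-v low = fC<1 (begin
        1ℚ
          ≤⟨ Low.1≤W u v w (proj₁ found) G low near-u near-v ⟩
        Low.W u v w (proj₁ found) G
          ≡⟨ expired m₀≤t (Low.W u v w (proj₁ found) G) rC ⟨
        Low.W u v w (proj₁ found) G * rC ^ (m₀ ℕ.∸ t)
          ≡⟨ proj₂ found ⟨
        term u v w
          ≤⟨ ∈⇒≤∑ {f = term u v} (0≤term u v) (∈-allFin w) ⟩
        ∑ (allFin n) (term u v)
          ≤⟨ ∈⇒≤∑ {f = λ v → ∑ (allFin n) (term u v)} (λ v → 0≤∑ (allFin n) (0≤term u v)) (∈-allFin v) ⟩
        ∑ (allFin n) (λ v → ∑ (allFin n) (term u v))
          ≤⟨ ∈⇒≤∑ {f = λ u → ∑ (allFin n) (λ v → ∑ (allFin n) (term u v))} (λ u → 0≤∑ (allFin n) (λ v → 0≤∑ (allFin n) (0≤term u v))) (∈-allFin u) ⟩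
        fC t G ∎)
        where
        open ≤-Reasoning
        term : Fin n → Fin n → Fin n → ℚ
        term u v w = when (¬? (u ≟ v)) (λ u≢v → Low.W u v w u≢v G * rC ^ (m₀ ℕ.∸ t))
        0≤term : ∀ u v w → 0ℚ ≤ term u v w
        0≤term u v w = 0≤when (¬? (u ≟ v)) (λ u≢v → 0≤* (Low.0≤W u v w u≢v G) (0≤^ (0≤1-ci (ℤ.+ 7 / 2)) (m₀ ℕ.∸ t)))
        found = when-yes (¬? (u ≟ v)) {λ u≢v → Low.W u v w u≢v G * rC ^ (m₀ ℕ.∸ t)} u≢v

      small-sparse : ∀ S → 1 ℕ.≤ Cut.size S → D ℕ.* Cut.size S ℕ.≤ n → ¬ (ℓ ℕ.* Cut.size S ℕ.≤ 4 ℕ.* count (Cut.Inner S) G)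
      small-sparse S 1≤s Ds≤n dense = fD<1 (begin
        1ℚ  ≤⟨ DenseSet.1≤W S G dense ⟩
        DenseSet.W S G  ≡⟨ *-identityʳ _ ⟨
        -- The factor `rD S` is at least 1, so the discount only helps and the bound holds at every
        -- time, not just after m₀.
        DenseSet.W S G * 1ℚ  ≤⟨ *-monoˡ (DenseSet.W S G) (DenseSet.0≤W S G) (1≤^ (1≤^ (≤-+ʳ refl (0≤* (≥0 (ℕtoℚ 2)) 0≤i)) (Cut.size S)) (m₁ ℕ.∸ t)) ⟩
        DenseSet.W S G * rD S ^ (m₁ ℕ.∸ t)
                                 ≡⟨ proj₂ (when-yes (small? S) {λ _ → DenseSet.W S G * rD S ^ (m₁ ℕ.∸ t)} (1≤s , Ds≤n)) ⟨
        term S  ≤⟨ ∈⇒≤∑ {f = term} 0≤term (∈-subsets S) ⟩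
        fD t G  ∎)
        where
        open ≤-Reasoning
        term : Subset n → ℚ
        term S = when (small? S) (λ _ → DenseSet.W S G * rD S ^ (m₁ ℕ.∸ t))
        0≤term : ∀ S → 0ℚ ≤ term S
        0≤term S = 0≤when (small? S) (λ _ → 0≤* (DenseSet.0≤W S G) (0≤^ (0≤^ 0≤1+2i (Cut.size S)) (m₁ ℕ.∸ t)))

      large-expand : m₀ ℕ.≤ t → ∀ S → n ℕ.< D ℕ.* Cut.size S → 2 ℕ.* Cut.size S ℕ.≤ n →
        ¬ ((K ℕ.+ 2) ℕ.* count (Cut.Cross S) G ℕ.≤ K ℕ.* count (Cut.Inner S) G)
      large-expand m₀≤t S n<Ds 2s≤n few = fE<1 (begin
        1ℚ  ≤⟨ Expansion.1≤W S G few ⟩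
        Expansion.W S G  ≡⟨ expired m₀≤t (Expansion.W S G) rE ⟨
        Expansion.W S G * rE ^ (m₀ ℕ.∸ t)
                                 ≡⟨ proj₂ (when-yes (large? S) {λ _ → Expansion.W S G * rE ^ (m₀ ℕ.∸ t)} (n<Ds , 2s≤n)) ⟨
        term S  ≤⟨ ∈⇒≤∑ {f = term} 0≤term (∈-subsets S) ⟩
        fE t G  ∎)
        where
        open ≤-Reasoning
        term : Subset n → ℚ
        term S = when (large? S) (λ _ → Expansion.W S G * rE ^ (m₀ ℕ.∸ t))
        0≤term : ∀ S → 0ℚ ≤ term S
        0≤term S = 0≤when (large? S) (λ _ → 0≤* (Expansion.0≤W S G) (0≤^ 0≤rE (m₀ ℕ.∸ t)))

    module Initial (B : ℕ)
      (B^ℓ≤n : B ℕ.^ ℓ ℕ.≤ n) (n≤B^ℓ⁺¹ : n ℕ.≤ B ℕ.* B ℕ.^ ℓ) (n≤23k : n ℕ.≤ 23 ℕ.* k)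
      (2B≤B^ℓ : 2 ℕ.* B ℕ.≤ B ℕ.^ ℓ) (ℓ≤n : ℓ ℕ.≤ n) (T²≤ℓ : T ℕ.* T ℕ.≤ ℓ) (138≤a : 138 ℕ.≤ a)
      (A₀≡ : A₀ ≡ 2 ℕ.^ (a ℕ.+ a) ℕ.* (2 ℕ.* (B ℕ.* B)))
      (B-survive : 2 ℕ.* 10 ℕ.^ a ℕ.≤ B ℕ.* 9 ℕ.^ a)
      (B-isolated : 2 ℕ.* B ℕ.* 25 ℕ.^ (a ℕ.+ a) ℕ.≤ 1 ℕ.* 27 ℕ.^ (a ℕ.+ a))
      (B-low : 512 ℕ.* B ℕ.* 20 ℕ.^ a ℕ.≤ 1 ℕ.* 23 ℕ.^ a)
      where

      h b : ℚ
      h = ½ ^ ℓ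
      b = ι B

      0≤h : 0ℚ ≤ h
      0≤h = 0≤^ (≥0 ½) ℓ

      0≤b : 0ℚ ≤ b
      0≤b = 0≤ι B

      N≤b^ : N ≤ b * b ^ ℓ
      N≤b^ = ≤-trans (ι-mono-≤ n≤B^ℓ⁺¹) (≤-reflexive (trans (ι-* B _) (cong (b *_) (ι-^ B ℓ))))

      -- Three scales: r^k is compared with a fixed fraction, its a-th power with `B`, and the ℓ-th
      -- power of that with n, which lies between B^ℓ and B^(ℓ+1).
      ^m₀ : ∀ r → r ^ m₀ ≡ ((r ^ k) ^ a) ^ ℓ
      ^m₀ r = trans (sym (^-assocʳ r k (a ℕ.* ℓ))) (sym (^-assocʳ (r ^ k) a ℓ))

      ^m₁ : ∀ r → r ^ m₁ ≡ ((r ^ k) ^ (a ℕ.+ a)) ^ ℓ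
      ^m₁ r = begin
        r ^ (m₀ ℕ.+ m₀)  ≡⟨ ^-homo-* r m₀ m₀ ⟩
        r ^ m₀ * r ^ m₀  ≡⟨ cong₂ _*_ (^m₀ r) (^m₀ r) ⟩
        ((r ^ k) ^ a) ^ ℓ * ((r ^ k) ^ a) ^ ℓ  ≡⟨ ^-distrib-* _ _ ℓ ⟨
        ((r ^ k) ^ a * (r ^ k) ^ a) ^ ℓ  ≡⟨ cong (_^ ℓ) (^-homo-* (r ^ k) a a) ⟨
        ((r ^ k) ^ (a ℕ.+ a)) ^ ℓ  ∎
        where open ≡-Reasoning

      N≤23k : N ≤ ℕtoℚ 23 * ι k
      N≤23k = cast-≤ (n ∷ k ∷ []) (var 0F) (# 23 ⊗ var 1F) n≤23k

      22k≤N : ℕtoℚ 22 * ι k ≤ N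
      22k≤N = cast-≤ (k ∷ n ∷ []) (# 22 ⊗ var 0F) (var 1F) 22k≤n

      isolated-empty : ∀ v → isolated (emptyGraph n) v ≡ 1
      isolated-empty v = cong (0 ℕ.^_) (trans (deg≡sum (emptyGraph n) v) (sum-zero n))

      -- (1 - q)^n ≤ 1/(1 + nq) for q = `q 0`. Here nq, an eighth of the expected number of
      -- survivors, is at least 2^ℓ/8, as each unit of ℓ contributes `B` times the decay over `a`
      -- blocks, at least 2.
      fA-empty : fA 0 (emptyGraph n) ≤ ℕtoℚ 8 * h
      fA-empty = half-power ℓ (≥0 (ℕtoℚ 8)) (begin
        fA 0 (emptyGraph n) * ℕtoℚ 2 ^ ℓ
          ≡⟨ cong (_* ℕtoℚ 2 ^ ℓ) (trans (cutoff-≤ {m = m₀} {f = λ t G → (1ℚ - q t) ^ #isolated G} {0} {emptyGraph n} z≤n)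
               (cong ((1ℚ - q 0) ^_) (trans (sum-cong-≗ isolated-empty) (trans (sum-const n 1) (ℕ.*-identityʳ n))))) ⟩
        (1ℚ - q 0) ^ n * ℕtoℚ 2 ^ ℓ
          ≡⟨ solve 2 (λ p t → p :* t := con (ℕtoℚ 8) :* (p :* (con (ℤ.+ 1 / 8) :* t))) refl ((1ℚ - q 0) ^ n) (ℕtoℚ 2 ^ ℓ) ⟩
        ℕtoℚ 8 * ((1ℚ - q 0) ^ n * ((ℤ.+ 1 / 8) * ℕtoℚ 2 ^ ℓ))
          ≤⟨ *-monoˡ (ℕtoℚ 8) (≥0 (ℕtoℚ 8)) (decay n (0≤1-q 0) (0≤q 0) ([1-x][1+x]≤1 (q 0)) (begin
               (ℤ.+ 1 / 8) * ℕtoℚ 2 ^ ℓ  ≤⟨ *-monoˡ (ℤ.+ 1 / 8) (≥0 (ℤ.+ 1 / 8)) (^-monoˡ (≥0 (ℕtoℚ 2)) 2≤ ℓ) ⟩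
               (ℤ.+ 1 / 8) * (b * (rA ^ k) ^ a) ^ ℓ  ≡⟨ cong ((ℤ.+ 1 / 8) *_) (^-distrib-* b ((rA ^ k) ^ a) ℓ) ⟩
               (ℤ.+ 1 / 8) * (b ^ ℓ * ((rA ^ k) ^ a) ^ ℓ) ≡⟨ cong (λ x → (ℤ.+ 1 / 8) * (b ^ ℓ * x)) (^m₀ rA) ⟨
               (ℤ.+ 1 / 8) * (b ^ ℓ * rA ^ m₀)  ≡⟨ solve 3 (λ c x y → c :* (x :* y) := x :* (c :* y)) refl (ℤ.+ 1 / 8) (b ^ ℓ) (rA ^ m₀) ⟩
               b ^ ℓ * q 0  ≤⟨ *-monoʳ (q 0) (0≤q 0) (≤-trans (≤-reflexive (sym (ι-^ B ℓ))) (ι-mono-≤ B^ℓ≤n)) ⟩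
               N * q 0  ≤⟨ ≤-+ʳ (+-comm 1ℚ (N * q 0)) 0≤1 ⟩
               1ℚ + N * q 0  ∎)) ⟩
        ℕtoℚ 8 * 1ℚ
          ≡⟨ *-identityʳ (ℕtoℚ 8) ⟩
        ℕtoℚ 8 ∎)
        where
        open ≤-Reasoning
        9/10≤ : ℤ.+ 9 / 10 ≤ rA ^ k
        9/10≤ = begin
          ℤ.+ 9 / 10  ≤⟨ ≤-modulo (- (ℤ.+ 1 / 10)) Ni≡1 (solve 3 (λ N i k → con 1ℚ :+ k :* (:- (con (ℤ.+ 11 / 5) :* i)) :- con (ℤ.+ 9 / 10) :=
                                                    con (ℤ.+ 1 / 10) :* i :* (N :- con (ℕtoℚ 22) :* k) :+ con (- (ℤ.+ 1 / 10)) :* (N :* i :- con 1ℚ)) refl N i (ι k))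
                                                    (0≤* (0≤* (≥0 (ℤ.+ 1 / 10)) 0≤i) (p≤q⇒0≤q-p 22k≤N)) ⟩
          1ℚ + ι k * - ((ℤ.+ 11 / 5) * i)  ≤⟨ bernoulli (- ((ℤ.+ 11 / 5) * i)) 0≤rA k ⟩
          rA ^ k  ∎
        2≤ : ℕtoℚ 2 ≤ b * (rA ^ k) ^ a
        2≤ = begin
          ℕtoℚ 2  ≡⟨ ι≡ℕtoℚ 2 ⟨
          ι 2  ≤⟨ power-ratio {ℤ.+ 9 / 10} {10} {9} (trans (cong ((ℤ.+ 9 / 10) *_) (ι≡ℕtoℚ 10)) (sym (ι≡ℕtoℚ 9))) (s≤s z≤n) 2 B a B-survive ⟩
          b * (ℤ.+ 9 / 10) ^ a  ≤⟨ *-monoˡ b 0≤b (^-monoˡ (≥0 (ℤ.+ 9 / 10)) 9/10≤ a) ⟩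
          b * (rA ^ k) ^ a  ∎

      -- A decay by 1/(2cB) per unit of ℓ beats the factor n c^ℓ.
      absorb : ∀ {X} c → 0ℚ ≤ X → 0ℚ ≤ c → X ^ ℓ * (ℕtoℚ 2 * c * b) ^ ℓ ≤ 1ℚ → N * (c ^ ℓ * X ^ ℓ) ≤ b * h
      absorb {X} c 0≤X 0≤c ≤1 = half-power ℓ 0≤b (begin
        N * (c ^ ℓ * X ^ ℓ) * ℕtoℚ 2 ^ ℓ
          ≤⟨ *-monoʳ (ℕtoℚ 2 ^ ℓ) (0≤^ (≥0 (ℕtoℚ 2)) ℓ) (*-monoʳ _ (0≤* (0≤^ 0≤c ℓ) (0≤^ 0≤X ℓ)) N≤b^) ⟩
        b * b ^ ℓ * (c ^ ℓ * X ^ ℓ) * ℕtoℚ 2 ^ ℓ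
          ≡⟨ solve 5 (λ b p c x t → b :* p :* (c :* x) :* t := b :* (x :* (t :* c :* p))) refl b (b ^ ℓ) (c ^ ℓ) (X ^ ℓ) (ℕtoℚ 2 ^ ℓ) ⟩
        b * (X ^ ℓ * (ℕtoℚ 2 ^ ℓ * c ^ ℓ * b ^ ℓ))
          ≡⟨ cong (λ x → b * (X ^ ℓ * x)) (trans (cong (_* b ^ ℓ) (sym (^-distrib-* (ℕtoℚ 2) c ℓ))) (sym (^-distrib-* (ℕtoℚ 2 * c) b ℓ))) ⟩
        b * (X ^ ℓ * (ℕtoℚ 2 * c * b) ^ ℓ)
          ≤⟨ *-monoˡ b 0≤b ≤1 ⟩
        b * 1ℚ
          ≡⟨ *-identityʳ b ⟩
        b ∎)
        where open ≤-Reasoning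

      length-allFin : length (allFin n) ≡ n
      length-allFin = length-tabulate (λ x → x)

      ∑-allFin : ∀ c → ∑ (allFin n) (λ _ → c) ≡ N * c
      ∑-allFin c = trans (∑-const (allFin n) c) (cong (λ m → ι m * c) length-allFin)

      fB-empty : fB 0 (emptyGraph n) ≤ b * h
      fB-empty = begin
        fB 0 (emptyGraph n)
          ≡⟨ ∑-cong (allFin n) (λ v → trans (cong (λ x → ι x * rB ^ m₁) (isolated-empty v)) (trans (cong (_* rB ^ m₁) ι1) (*-identityˡ (rB ^ m₁)))) ⟩
        ∑ (allFin n) (λ _ → rB ^ m₁)
          ≡⟨ ∑-allFin (rB ^ m₁) ⟩
        N * rB ^ m₁
          ≡⟨ cong (N *_) (trans (^m₁ rB) (sym (trans (cong (_* X ^ ℓ) (1^ ℓ)) (*-identityˡ (X ^ ℓ))))) ⟩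
        N * (1ℚ ^ ℓ * X ^ ℓ)
          ≤⟨ absorb {X} 1ℚ (0≤^ (0≤^ 0≤rB k) (a ℕ.+ a)) 0≤1 (^-≤1 (0≤^ (0≤^ 0≤rB k) (a ℕ.+ a)) (0≤* (≥0 (ℕtoℚ 2 * 1ℚ)) 0≤b)
               (decay-power (a ℕ.+ a) (0≤^ 0≤rB k) (≥0 (ℤ.+ 27 / 25)) (decay k 0≤rB (0≤* (≥0 (ℕtoℚ 2)) 0≤i) ([1-x][1+x]≤1 (ℕtoℚ 2 * i)) 27/25≤) 2b≤) ℓ) ⟩
        b * h ∎
        where
        open ≤-Reasoning
        X : ℚ
        X = (rB ^ k) ^ (a ℕ.+ a)
        0≤rB : 0ℚ ≤ rB
        0≤rB = 0≤1-ci (ℕtoℚ 2)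
        -- Since 23k ≥ n, the right side is at least 1 + 2/23, and 2/23 - 2/25 = 4/575.
        27/25≤ : ℤ.+ 27 / 25 ≤ 1ℚ + ι k * (ℕtoℚ 2 * i)
        27/25≤ = ≤-modulo (ℤ.+ 2 / 23) Ni≡1 (solve 3 (λ N i k → con 1ℚ :+ k :* (con (ℕtoℚ 2) :* i) :- con (ℤ.+ 27 / 25) :=
          con (ℤ.+ 2 / 23) :* i :* (con (ℕtoℚ 23) :* k :- N) :+ con (ℤ.+ 4 / 575) :+ con (ℤ.+ 2 / 23) :* (N :* i :- con 1ℚ)) refl N i (ι k))
          (0≤+ (0≤* (0≤* (≥0 (ℤ.+ 2 / 23)) 0≤i) (p≤q⇒0≤q-p N≤23k)) (≥0 (ℤ.+ 4 / 575)))
        2b≤ : ℕtoℚ 2 * 1ℚ * b ≤ (ℤ.+ 27 / 25) ^ (a ℕ.+ a)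
        2b≤ = begin
          ℕtoℚ 2 * 1ℚ * b  ≡⟨ cong (_* b) (*-identityʳ (ℕtoℚ 2)) ⟩
          ℕtoℚ 2 * b  ≡⟨ ι-⟦⟧ (# 2 ⊗ var 0F) (B ∷ []) ⟨
          ι (2 ℕ.* B)  ≤⟨ power-ratio {ℤ.+ 27 / 25} {25} {27} (trans (cong ((ℤ.+ 27 / 25) *_) (ι≡ℕtoℚ 25)) (sym (ι≡ℕtoℚ 27))) (s≤s z≤n) (2 ℕ.* B) 1 (a ℕ.+ a) B-isolated ⟩
          ι 1 * (ℤ.+ 27 / 25) ^ (a ℕ.+ a)  ≡⟨ trans (cong (_* (ℤ.+ 27 / 25) ^ (a ℕ.+ a)) ι1) (*-identityˡ _) ⟩
          (ℤ.+ 27 / 25) ^ (a ℕ.+ a)  ∎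

      -- The factor R⁻² cancels n² of the n³ triples and leaves 64²(1 + 2/64) = 4224 times n; the
      -- 2/64 comes from `w` being one of the two vertices. Then n and 16^(2ℓ) are absorbed by the
      -- decay.
      fC-empty : fC 0 (emptyGraph n) ≤ ℕtoℚ 4224 * (b * h)
      fC-empty = begin
        fC 0 (emptyGraph n)
          ≤⟨ ∑-mono (allFin n) (λ {u} _ → ∑-mono (allFin n) (λ {v} _ → inner u v)) ⟩
        ∑ (allFin n) (λ _ → ∑ (allFin n) (λ _ → C * (N + R * ℕtoℚ 2)))
          ≡⟨ trans (∑-cong (allFin n) (λ _ → ∑-allFin (C * (N + R * ℕtoℚ 2)))) (∑-allFin (N * (C * (N + R * ℕtoℚ 2)))) ⟩
        N * (N * (C * (N + R * ℕtoℚ 2)))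
          ≡⟨ solve 4 (λ N i p x → N :* (N :* (p :* (con (ℕtoℚ 64) :* i :* (con (ℕtoℚ 64) :* i)) :* x :* (N :+ con (ℤ.+ 1 / 64) :* N :* con (ℕtoℚ 2)))) :=
               con (ℕtoℚ 4224) :* (N :* i :* (N :* i) :* (N :* (p :* x)))) refl N i (Λ ^ (ℓ ℕ.+ ℓ)) (rC ^ m₀) ⟩
        ℕtoℚ 4224 * (N * i * (N * i) * (N * (Λ ^ (ℓ ℕ.+ ℓ) * rC ^ m₀)))
          ≡⟨ cong (ℕtoℚ 4224 *_) (trans (cong₂ (λ x y → x * y * (N * (Λ ^ (ℓ ℕ.+ ℓ) * rC ^ m₀))) Ni≡1 Ni≡1) (*-identityˡ (N * (Λ ^ (ℓ ℕ.+ ℓ) * rC ^ m₀)))) ⟩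
        ℕtoℚ 4224 * (N * (Λ ^ (ℓ ℕ.+ ℓ) * rC ^ m₀))
          ≡⟨ cong₂ (λ x y → ℕtoℚ 4224 * (N * (x * y))) (trans (^-homo-* Λ ℓ ℓ) (sym (^-distrib-* Λ Λ ℓ))) (^m₀ rC) ⟩
        ℕtoℚ 4224 * (N * ((Λ * Λ) ^ ℓ * X ^ ℓ))
          ≤⟨ *-monoˡ (ℕtoℚ 4224) (≥0 (ℕtoℚ 4224)) (absorb {X} (Λ * Λ) (0≤^ (0≤^ 0≤rC k) a) (≥0 (Λ * Λ)) (^-≤1 (0≤^ (0≤^ 0≤rC k) a) (0≤* (≥0 (ℕtoℚ 2 * (Λ * Λ))) 0≤b)
               (decay-power a (0≤^ 0≤rC k) (≥0 (ℤ.+ 23 / 20)) (decay k 0≤rC (0≤* (≥0 (ℤ.+ 7 / 2)) 0≤i) ([1-x][1+x]≤1 ((ℤ.+ 7 / 2) * i)) 23/20≤) 512b≤) ℓ)) ⟩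
        ℕtoℚ 4224 * (b * h) ∎
        where
        open ≤-Reasoning
        Λ C X : ℚ
        Λ = ℕtoℚ 16
        C = Λ ^ (ℓ ℕ.+ ℓ) * (R⁻¹ * R⁻¹) * rC ^ m₀
        X = (rC ^ k) ^ a
        0≤rC : 0ℚ ≤ rC
        0≤rC = 0≤1-ci (ℤ.+ 7 / 2)
        0≤C : 0ℚ ≤ C
        0≤C = 0≤* (0≤* (0≤^ (≥0 Λ) (ℓ ℕ.+ ℓ)) (0≤* 0≤R⁻¹ 0≤R⁻¹)) (0≤^ 0≤rC m₀)
        0≤R : 0ℚ ≤ R
        0≤R = ≤-trans 0≤1 1≤R
        J₀ : Fin n → Fin n → Fin n → ℕ
        J₀ u v w = ⟦ u ≡ w ⟧ ℕ.+ ⟦ v ≡ w ⟧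
        term : ∀ u v w → when (¬? (u ≟ v)) (λ u≢v → Low.W u v w u≢v (emptyGraph n) * rC ^ (m₀ ℕ.∸ 0)) ≤ C * (1ℚ + R * ι (J₀ u v w))
        term u v w = when-≤ (¬? (u ≟ v)) (0≤* 0≤C (0≤+ 0≤1 (0≤* 0≤R (0≤ι (J₀ u v w))))) λ u≢v →
          ≤-trans (*-monoʳ (rC ^ m₀) (0≤^ 0≤rC m₀) (Low.W-empty u v w u≢v))
            (≤-reflexive (solve 3 (λ p x y → p :* y :* x := p :* x :* y) refl (Λ ^ (ℓ ℕ.+ ℓ) * (R⁻¹ * R⁻¹)) (rC ^ m₀) (1ℚ + R * ι (J₀ u v w))))
        ∑J₀ : ∀ u v → ∑ (allFin n) (λ w → ι (J₀ u v w)) ≡ ℕtoℚ 2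
        ∑J₀ u v = trans (∑-ι (allFin n) (J₀ u v)) (trans (cong ι (trans (∑ₗ-tabulate {n} (λ x → x) (J₀ u v))
          (trans (∑-distrib-+ {n} (λ w → ⟦ u ≡ w ⟧) (λ w → ⟦ v ≡ w ⟧))
            (cong₂ ℕ._+_ (trans (sum-cong-≗ {n} (λ w → ⟦≡⟧-sym u w)) (sum-χ≡ u)) (trans (sum-cong-≗ {n} (λ w → ⟦≡⟧-sym v w)) (sum-χ≡ v)))))) (ι≡ℕtoℚ 2))
        inner : ∀ u v → ∑ (allFin n) (λ w → when (¬? (u ≟ v)) (λ u≢v → Low.W u v w u≢v (emptyGraph n) * rC ^ (m₀ ℕ.∸ 0))) ≤ C * (N + R * ℕtoℚ 2)
        inner u v = begin
          ∑ (allFin n) (λ w → when (¬? (u ≟ v)) (λ u≢v → Low.W u v w u≢v (emptyGraph n) * rC ^ (m₀ ℕ.∸ 0)))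
            ≤⟨ ∑-mono (allFin n) (λ {w} _ → term u v w) ⟩
          ∑ (allFin n) (λ w → C * (1ℚ + R * ι (J₀ u v w)))
            ≡⟨ ∑-*ˡ (allFin n) C (λ w → 1ℚ + R * ι (J₀ u v w)) ⟩
          C * ∑ (allFin n) (λ w → 1ℚ + R * ι (J₀ u v w))
            ≡⟨ cong (C *_) (trans (∑-+ (allFin n) (λ _ → 1ℚ) (λ w → R * ι (J₀ u v w)))
                 (cong₂ _+_ (trans (∑-allFin 1ℚ) (*-identityʳ N)) (trans (∑-*ˡ (allFin n) R (λ w → ι (J₀ u v w))) (cong (R *_) (∑J₀ u v))))) ⟩
          C * (N + R * ℕtoℚ 2) ∎
        23/20≤ : ℤ.+ 23 / 20 ≤ 1ℚ + ι k * ((ℤ.+ 7 / 2) * i)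
        23/20≤ = ≤-modulo (ℤ.+ 7 / 46) Ni≡1 (solve 3 (λ N i k → con 1ℚ :+ k :* (con (ℤ.+ 7 / 2) :* i) :- con (ℤ.+ 23 / 20) :=
          con (ℤ.+ 7 / 46) :* i :* (con (ℕtoℚ 23) :* k :- N) :+ con (ℤ.+ 1 / 460) :+ con (ℤ.+ 7 / 46) :* (N :* i :- con 1ℚ)) refl N i (ι k))
          (0≤+ (0≤* (0≤* (≥0 (ℤ.+ 7 / 46)) 0≤i) (p≤q⇒0≤q-p N≤23k)) (≥0 (ℤ.+ 1 / 460)))
        -- 512 = 2·16²: per unit of ℓ, a factor 16² from the degree bound 2ℓ and a factor 2 for the
        -- gain `h`.
        512b≤ : ℕtoℚ 2 * (Λ * Λ) * b ≤ (ℤ.+ 23 / 20) ^ a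
        512b≤ = begin
          ℕtoℚ 512 * b  ≡⟨ ι-⟦⟧ (# 512 ⊗ var 0F) (B ∷ []) ⟨
          ι (512 ℕ.* B)  ≤⟨ power-ratio {ℤ.+ 23 / 20} {20} {23} (trans (cong ((ℤ.+ 23 / 20) *_) (ι≡ℕtoℚ 20)) (sym (ι≡ℕtoℚ 23))) (s≤s z≤n) (512 ℕ.* B) 1 a B-low ⟩
          ι 1 * (ℤ.+ 23 / 20) ^ a  ≡⟨ trans (cong (_* (ℤ.+ 23 / 20) ^ a) ι1) (*-identityˡ _) ⟩
          (ℤ.+ 23 / 20) ^ a  ∎

      -- y is the cost per vertex of a small set; half of it is spent on the factor h.
      fD-empty : fD 0 (emptyGraph n) ≤ ℕtoℚ 2 * h
      fD-empty = begin
        fD 0 (emptyGraph n)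
          ≤⟨ ∑-mono (subsets n) (λ {S} _ → term S) ⟩
        ∑ (subsets n) (λ S → h * y ^ Cut.size S)
          ≡⟨ trans (∑-*ˡ (subsets n) h (λ S → y ^ Cut.size S)) (cong (h *_) (∑-subsets n y)) ⟩
        h * (1ℚ + y) ^ n
          ≤⟨ *-monoˡ h 0≤h total≤2 ⟩
        h * ℕtoℚ 2
          ≡⟨ *-comm h (ℕtoℚ 2) ⟩
        ℕtoℚ 2 * h ∎
        where
        open ≤-Reasoning
        g p z y : ℚ
        g = 1ℚ + ℕtoℚ 2 * i
        p = ℕtoℚ 2 ^ (a ℕ.+ a)
        z = A⁻¹ * p * ℕtoℚ 2
        y = z ^ ℓ
        0≤p : 0ℚ ≤ p
        0≤p = 0≤^ (≥0 (ℕtoℚ 2)) (a ℕ.+ a)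
        0≤z : 0ℚ ≤ z
        0≤z = 0≤* (0≤* 0≤A⁻¹ 0≤p) (≥0 (ℕtoℚ 2))
        0≤y : 0ℚ ≤ y
        0≤y = 0≤^ 0≤z ℓ
        -- `A₀` was chosen for this: y = B^(-2ℓ) beats n ≤ B^(ℓ+1).
        zb²≡1 : z * (b * b) ≡ 1ℚ
        zb²≡1 = trans (solve 3 (λ α p b → α :* p :* con (ℕtoℚ 2) :* (b :* b) := p :* (con (ℕtoℚ 2) :* (b :* b)) :* α) refl A⁻¹ p b)
          (trans (cong (_* A⁻¹) (sym (trans (cong ι A₀≡) (trans (ι-* (2 ℕ.^ (a ℕ.+ a)) _)
            (cong₂ _*_ (trans (ι-^ 2 (a ℕ.+ a)) (cong (_^ (a ℕ.+ a)) (ι≡ℕtoℚ 2))) (ι-⟦⟧ (# 2 ⊗ (var 0F ⊗ var 0F)) (B ∷ []))))))) AA⁻¹≡1)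
        -- A growing power is bounded through its mirror image: (1 - 2i)^k is at least 1/2 by
        -- Bernoulli, and (1 + 2i)^k (1 - 2i)^k ≤ 1. The same device proves `total≤2`.
        g^k≤2 : g ^ k ≤ ℕtoℚ 2
        g^k≤2 = begin
          g ^ k
            ≡⟨ solve 1 (λ x → x := con (ℕtoℚ 2) :* (x :* con ½)) refl (g ^ k) ⟩
          ℕtoℚ 2 * (g ^ k * ½)
            ≤⟨ *-monoˡ (ℕtoℚ 2) (≥0 (ℕtoℚ 2)) (≤-trans (*-monoˡ (g ^ k) (0≤^ 0≤1+2i k) (≤-trans half≤ (bernoulli (- (ℕtoℚ 2 * i)) (0≤1-ci (ℕtoℚ 2)) k)))
                 (^-≤1 0≤1+2i (0≤1-ci (ℕtoℚ 2)) (≤-trans (≤-reflexive (*-comm g _)) ([1-x][1+x]≤1 (ℕtoℚ 2 * i))) k)) ⟩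
          ℕtoℚ 2 * 1ℚ
            ≡⟨ *-identityʳ (ℕtoℚ 2) ⟩
          ℕtoℚ 2 ∎
          where
          half≤ : ½ ≤ 1ℚ + ι k * - (ℕtoℚ 2 * i)
          half≤ = ≤-modulo (- (ℤ.+ 1 / 11)) Ni≡1 (solve 3 (λ N i k → con 1ℚ :+ k :* (:- (con (ℕtoℚ 2) :* i)) :- con ½ :=
            con (ℤ.+ 1 / 11) :* i :* (N :- con (ℕtoℚ 22) :* k) :+ con (ℤ.+ 9 / 22) :+ con (- (ℤ.+ 1 / 11)) :* (N :* i :- con 1ℚ)) refl N i (ι k))
            (0≤+ (0≤* (0≤* (≥0 (ℤ.+ 1 / 11)) 0≤i) (p≤q⇒0≤q-p 22k≤N)) (≥0 (ℤ.+ 9 / 22)))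
        term : ∀ S → when (small? S) (λ _ → DenseSet.W S (emptyGraph n) * rD S ^ (m₁ ℕ.∸ 0)) ≤ h * y ^ Cut.size S
        term S = when-≤ (small? S) (0≤* 0≤h (0≤^ 0≤y s)) λ (1≤s , _) → begin
          DenseSet.W S (emptyGraph n) * rD S ^ m₁
            ≡⟨ cong₂ _*_ (trans (DenseSet.W-empty S) (sym (^-assocʳ A⁻¹ ℓ s))) (trans (^-assocʳ g s m₁) (trans (cong (g ^_) (ℕ.*-comm s m₁)) (sym (^-assocʳ g m₁ s)))) ⟩
          (A⁻¹ ^ ℓ) ^ s * (g ^ m₁) ^ s
            ≡⟨ ^-distrib-* (A⁻¹ ^ ℓ) (g ^ m₁) s ⟨
          (A⁻¹ ^ ℓ * g ^ m₁) ^ s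
            ≤⟨ ^-monoˡ (0≤* (0≤^ 0≤A⁻¹ ℓ) (0≤^ 0≤1+2i m₁)) (*-monoˡ (A⁻¹ ^ ℓ) (0≤^ 0≤A⁻¹ ℓ) (≤-trans (≤-reflexive (^m₁ g))
                 (^-monoˡ (0≤^ (0≤^ 0≤1+2i k) (a ℕ.+ a)) (^-monoˡ (0≤^ 0≤1+2i k) g^k≤2 (a ℕ.+ a)) ℓ))) s ⟩
          (A⁻¹ ^ ℓ * p ^ ℓ) ^ s
            ≡⟨ cong (_^ s) (trans (sym (^-distrib-* A⁻¹ p ℓ)) (trans (cong (_^ ℓ) (solve 1 (λ x → x := con ½ :* (x :* con (ℕtoℚ 2))) refl (A⁻¹ * p))) (^-distrib-* ½ z ℓ))) ⟩
          (h * y) ^ s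
            ≡⟨ ^-distrib-* h y s ⟩
          h ^ s * y ^ s
            -- Here S must be nonempty: one factor `h` is kept out of h^s.
            ≤⟨ *-monoʳ (y ^ s) (0≤^ 0≤y s) (≤-trans (^-antiʳ 0≤h (^≤1 (≥0 ½) (≤ᵇ⇒≤ {½} {1ℚ} _) ℓ) 1≤s) (≤-reflexive (*-identityʳ h))) ⟩
          h * y ^ s ∎
          where
          s = Cut.size S
        Ny≤½ : ℕtoℚ 2 * (N * y) ≤ 1ℚ
        Ny≤½ = begin
          ℕtoℚ 2 * (N * y)  ≤⟨ *-monoˡ (ℕtoℚ 2) (≥0 (ℕtoℚ 2)) (*-monoʳ y 0≤y N≤b^) ⟩
          ℕtoℚ 2 * (b * b ^ ℓ * y)  ≡⟨ solve 3 (λ b p y → con (ℕtoℚ 2) :* (b :* p :* y) := con (ℕtoℚ 2) :* b :* (p :* y)) refl b (b ^ ℓ) y ⟩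
          ℕtoℚ 2 * b * (b ^ ℓ * y)  ≤⟨ *-monoʳ (b ^ ℓ * y) (0≤* (0≤^ 0≤b ℓ) 0≤y) (≤-trans (cast-≤ (B ∷ B ℕ.^ ℓ ∷ []) (# 2 ⊗ var 0F) (var 1F) 2B≤B^ℓ) (≤-reflexive (ι-^ B ℓ))) ⟩
          b ^ ℓ * (b ^ ℓ * y)  ≡⟨ trans (solve 2 (λ p y → p :* (p :* y) := y :* (p :* p)) refl (b ^ ℓ) y) (cong (y *_) (sym (^-distrib-* b b ℓ))) ⟩
          z ^ ℓ * (b * b) ^ ℓ  ≡⟨ ^-distrib-* z (b * b) ℓ ⟨
          (z * (b * b)) ^ ℓ  ≡⟨ trans (cong (_^ ℓ) zb²≡1) (1^ ℓ) ⟩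
          1ℚ  ∎
        y≤1 : y ≤ 1ℚ
        y≤1 = begin
          y  ≡⟨ *-identityˡ y ⟨
          1ℚ * y  ≤⟨ *-monoʳ y 0≤y (≤-trans (≤ᵇ⇒≤ {1ℚ} {ℕtoℚ 2 * ℕtoℚ 50000} _) (*-monoˡ (ℕtoℚ 2) (≥0 (ℕtoℚ 2)) 50000≤N)) ⟩
          ℕtoℚ 2 * N * y  ≡⟨ *-assoc (ℕtoℚ 2) N y ⟩
          ℕtoℚ 2 * (N * y) ≤⟨ Ny≤½ ⟩
          1ℚ  ∎
        total≤2 : (1ℚ + y) ^ n ≤ ℕtoℚ 2
        total≤2 = begin
          (1ℚ + y) ^ n
            ≡⟨ solve 1 (λ x → x := con (ℕtoℚ 2) :* (x :* con ½)) refl ((1ℚ + y) ^ n) ⟩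
          ℕtoℚ 2 * ((1ℚ + y) ^ n * ½)
            ≤⟨ *-monoˡ (ℕtoℚ 2) (≥0 (ℕtoℚ 2)) (≤-trans (*-monoˡ _ (0≤^ (0≤+ 0≤1 0≤y) n) (≤-trans
                 (≤-by (solve 2 (λ N y → con 1ℚ :+ N :* (:- y) :- con ½ := con ½ :* (con 1ℚ :- con (ℕtoℚ 2) :* (N :* y))) refl N y) (0≤* (≥0 ½) (p≤q⇒0≤q-p Ny≤½)))
                 (bernoulli (- y) (p≤q⇒0≤q-p y≤1) n)))
                 (^-≤1 (0≤+ 0≤1 0≤y) (p≤q⇒0≤q-p y≤1) (≤-trans (≤-reflexive (*-comm (1ℚ + y) _)) ([1-x][1+x]≤1 y)) n)) ⟩
          ℕtoℚ 2 * 1ℚ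
            ≡⟨ *-identityʳ (ℕtoℚ 2) ⟩
          ℕtoℚ 2 ∎

      -- There are 2^n sets, but m₀ ≥ jn with j = 6T², and jκ = 3 makes rE^j at most 1/4. So each
      -- vertex contributes a factor at most 1/2. This needs ℓ ≥ T² and a ≥ 138 = 6·23.
      fE-empty : fE 0 (emptyGraph n) ≤ h
      fE-empty = begin
        fE 0 (emptyGraph n)
          ≤⟨ ∑-mono (subsets n) (λ {S} _ → term S) ⟩
        ∑ (subsets n) (λ S → rE ^ m₀ * 1ℚ ^ Cut.size S)
          ≡⟨ trans (∑-*ˡ (subsets n) (rE ^ m₀) (λ S → 1ℚ ^ Cut.size S)) (cong (rE ^ m₀ *_) (∑-subsets n 1ℚ)) ⟩
        rE ^ m₀ * ℕtoℚ 2 ^ n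
          ≤⟨ *-monoʳ (ℕtoℚ 2 ^ n) (0≤^ (≥0 (ℕtoℚ 2)) n) (≤-trans (^-antiʳ 0≤rE rE≤1 jn≤m₀) (≤-reflexive (sym (^-assocʳ rE j n)))) ⟩
        (rE ^ j) ^ n * ℕtoℚ 2 ^ n
          ≡⟨ ^-distrib-* (rE ^ j) (ℕtoℚ 2) n ⟨
        (rE ^ j * ℕtoℚ 2) ^ n
          ≤⟨ ^-monoˡ (0≤* (0≤^ 0≤rE j) (≥0 (ℕtoℚ 2))) quarter n ⟩
        ½ ^ n
          ≤⟨ ^-antiʳ (≥0 ½) (≤ᵇ⇒≤ {½} {1ℚ} _) ℓ≤n ⟩
        h ∎
        where
        open ≤-Reasoning
        j : ℕ
        j = 6 ℕ.* (T ℕ.* T)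
        κ : ℚ
        κ = (ℤ.+ 1 / 2) * (τ * τ)
        term : ∀ S → when (large? S) (λ _ → Expansion.W S (emptyGraph n) * rE ^ (m₀ ℕ.∸ 0)) ≤ rE ^ m₀ * 1ℚ ^ Cut.size S
        term S = when-≤ (large? S) (0≤* (0≤^ 0≤rE m₀) (0≤^ 0≤1 (Cut.size S))) λ _ → ≤-reflexive
          (trans (cong (_* rE ^ m₀) (trans (Expansion.W-empty S) (sym (1^ (Cut.size S))))) (*-comm (1ℚ ^ Cut.size S) (rE ^ m₀)))
        jn≤m₀ : j ℕ.* n ℕ.≤ m₀
        jn≤m₀ = ι-cancel-≤ (begin
          ι (j ℕ.* n)  ≡⟨ ι-⟦⟧ (# 6 ⊗ (var 0F ⊗ var 0F) ⊗ var 1F) (T ∷ n ∷ []) ⟩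
          ℕtoℚ 6 * (ι T * ι T) * N  ≤⟨ *-monoˡ (ℕtoℚ 6 * (ι T * ι T)) (0≤* (≥0 (ℕtoℚ 6)) (0≤* (0≤ι T) (0≤ι T))) N≤23k ⟩
          ℕtoℚ 6 * (ι T * ι T) * (ℕtoℚ 23 * ι k)  ≡⟨ solve 2 (λ t k → con (ℕtoℚ 6) :* t :* (con (ℕtoℚ 23) :* k) := k :* (con (ℕtoℚ 138) :* t)) refl (ι T * ι T) (ι k) ⟩
          ι k * (ℕtoℚ 138 * (ι T * ι T))  ≤⟨ *-monoˡ (ι k) (0≤ι k) (*-mono (0≤* (0≤ι T) (0≤ι T)) (0≤ι a) (cast-≤ (a ∷ []) (# 138) (var 0F) 138≤a)
                                                       (subst (_≤ L) (ι-* T T) (ι-mono-≤ T²≤ℓ))) ⟩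
          ι k * (ι a * L)  ≡⟨ ι-⟦⟧ (var 0F ⊗ (var 1F ⊗ var 2F)) (k ∷ a ∷ ℓ ∷ []) ⟨
          ι m₀  ∎)
        jκ≡3 : ι j * κ ≡ ℕtoℚ 3
        jκ≡3 = trans (cong (_* κ) (ι-⟦⟧ (# 6 ⊗ (var 0F ⊗ var 0F)) (T ∷ [])))
          (trans (solve 2 (λ t τ → con (ℕtoℚ 6) :* (t :* t) :* (con (ℤ.+ 1 / 2) :* (τ :* τ)) := con (ℕtoℚ 3) :* (t :* τ :* (t :* τ))) refl (ι T) τ)
            (cong (λ x → ℕtoℚ 3 * (x * x)) Tτ≡1))
        quarter : rE ^ j * ℕtoℚ 2 ≤ ½
        quarter = begin
          rE ^ j * ℕtoℚ 2  ≡⟨ solve 1 (λ x → x :* con (ℕtoℚ 2) := x :* con (ℕtoℚ 4) :* con ½) refl (rE ^ j) ⟩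
          rE ^ j * ℕtoℚ 4 * ½  ≤⟨ *-monoʳ ½ (≥0 ½) (decay j 0≤rE 0≤κ ([1-x][1+x]≤1 κ) (≤-reflexive (cong (1ℚ +_) (sym jκ≡3)))) ⟩
          1ℚ * ½  ≡⟨ *-identityˡ ½ ⟩
          ½  ∎

      f-empty : f 0 (emptyGraph n) ≤ (ℕtoℚ 4225 * b + ℕtoℚ 11) * h
      f-empty = ≤-trans (+-mono-≤ (+-mono-≤ (+-mono-≤ (+-mono-≤ fA-empty fB-empty) fC-empty) fD-empty) fE-empty)
        (≤-reflexive (solve 2 (λ b h → con (ℕtoℚ 8) :* h :+ b :* h :+ con (ℕtoℚ 4224) :* (b :* h) :+ con (ℕtoℚ 2) :* h :+ h := (con (ℕtoℚ 4225) :* b :+ con (ℕtoℚ 11)) :* h) refl b h))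

-- Choice of the constants, and the hitting time

module Parameters where

  open import Data.Fin.Base using (fromℕ<)
  open import Data.Fin.Patterns using (0F; 1F; 2F)
  import Data.Fin.Properties as Fin
  open import Data.Integer.Base as ℤ using (1ℤ)
  open import Data.List.Extrema.Nat using (v≤min⁺; min≤xs)
  open import Data.List.Membership.Propositional.Properties using (∈-allFin)
  import Data.List.Relation.Unary.All as All
  import Data.List.Relation.Unary.All.Properties as All
  open import Data.Nat.Combinatorics using (_C_)
  open import Data.Nat.DivMod using (m/n*n≤m; m%n<n; m≡m%n+[m/n]*n)
  open import Data.Product.Base using (Σ-syntax)
  open import Data.Rational.Base
  open import Data.Rational.Properties
  open import Data.Rational.Solver using (module +-*-Solver)
  open import Data.Vec.Base using ([]; _∷_; lookup)
  open import Defs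
  open Rationals
  open Casts
  open EdgeCounts
  open EdgeProcess
  open Growth using (#isolated)
  open Potentials
  open +-*-Solver using (solve; _:=_; _:+_; _:*_; _:-_; :-_; con)

  -- `d` is the denominator minus one, and the numerator is at least 1, so p ≥ 1/(d + 1) > 1/(d +
  -- 2).
  archimedean : ∀ {p} → 0ℚ < p → ∃[ k ] 1ℤ / suc k < p
  archimedean {p@(mkℚ (ℤ.+ suc m) d _)} 0<p = suc d , toℚᵘ-cancel-< (ℚᵘ.<-respˡ-≃ (ℚᵘ.≃-sym (toℚᵘ-fromℚᵘ (ℚᵘ.mkℚᵘ 1ℤ (suc d))))
    (ℚᵘ.*<* (ℤ.+<+ (ℕ.≤-trans (ℕ.≤-reflexive (cong (λ x → suc (suc x)) (ℕ.+-identityʳ d))) (ℕ.m≤m+n (suc (suc d)) _)))))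
  archimedean {mkℚ (ℤ.+ zero) d _}   (*<* (ℤ.+<+ ()))
  archimedean {mkℚ (ℤ.-[1+ m ]) d _} (*<* ())

  least : ∀ {k} {P : Fin k → Set} → (∀ i → Dec (P i)) → ∀ i → P i → ∃[ j ] IsMin P j
  least {suc k} P? i Pi with P? Fin.zero
  ... | yes P0 = Fin.zero , P0 , λ j ()
  least {suc k} P? Fin.zero    P0 | no ¬P0 = contradiction P0 ¬P0
  least {suc k} {P} P? (Fin.suc i) Pi | no ¬P0 with least (P? ∘ Fin.suc) i Pi
  ... | j , Pj , min = Fin.suc j , Pj , before
    where
    before : ∀ l → l Fin.< Fin.suc j → ¬ P l
    before Fin.zero    _           = ¬P0
    before (Fin.suc l) (s≤s l<j) = min l l<j

  1≤δ⇒1≤deg : ∀ {n} (G : Graph n) → 1 ℕ.≤ δ G → ∀ v → 1 ℕ.≤ deg G v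
  1≤δ⇒1≤deg {n} G 1≤δ v = ℕ.≤-trans 1≤δ (All.lookup (All.map⁻ (min≤xs n (map (deg G) (allFin n)))) (∈-allFin v))

  1≤deg⇒1≤δ : ∀ {n} (G : Graph n) → 1 ℕ.≤ n → (∀ v → 1 ℕ.≤ deg G v) → 1 ℕ.≤ δ G
  1≤deg⇒1≤δ {n} G 1≤n 1≤deg = v≤min⁺ {xs = map (deg G) (allFin n)} 1≤n (All.map⁺ (All.universal 1≤deg (allFin n)))

  1≤deg⇒none-isolated : ∀ {n} (G : Graph n) → (∀ v → 1 ℕ.≤ deg G v) → #isolated G ≡ 0
  1≤deg⇒none-isolated {n} G 1≤deg = trans (sum-cong-≗ (λ v → 0^ (deg G v) (1≤deg v))) (sum-zero n)
    where
    0^ : ∀ d → 1 ℕ.≤ d → 0 ℕ.^ d ≡ 0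
    0^ (suc d) _ = refl

  #missing-empty : ∀ n → length (missing (emptyGraph n)) ≡ n C 2
  #missing-empty n = ℕ.*-cancelʳ-≡ _ _ 2 (ℕ.+-cancelʳ-≡ n _ _ (begin
    M ℕ.* 2 ℕ.+ n  ≡⟨ cong (ℕ._+ n) (ℕ.+-identityʳ (M ℕ.* 2)) ⟨
    M ℕ.* 2 ℕ.+ 0 ℕ.+ n  ≡⟨ cong (λ e → M ℕ.* 2 ℕ.+ e ℕ.+ n) (count-empty {n} (λ _ _ → 1)) ⟨
    M ℕ.* 2 ℕ.+ edges (emptyGraph n) ℕ.+ n  ≡⟨ length-missing (emptyGraph n) ⟩
    n ℕ.* n  ≡⟨ nC2 n ⟨
    (n C 2) ℕ.* 2 ℕ.+ n  ∎))
    where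
    open ≡-Reasoning
    M = length (missing (emptyGraph n))

  k<2^k : ∀ k → k ℕ.< 2 ℕ.^ k
  k<2^k zero    = s≤s z≤n
  k<2^k (suc k) = ℕ.≤-trans (s≤s (k<2^k k)) (ℕ.≤-trans (ℕ.+-monoˡ-≤ (2 ℕ.^ k) (ℕ.m^n>0 2 k)) (ℕ.≤-reflexive (cong (2 ℕ.^ k ℕ.+_) (sym (ℕ.+-identityʳ _)))))

  [m*n]^k : ∀ m n k → (m ℕ.* n) ℕ.^ k ≡ m ℕ.^ k ℕ.* n ℕ.^ k
  [m*n]^k m n zero    = refl
  [m*n]^k m n (suc k) = trans (cong (m ℕ.* n ℕ.*_) ([m*n]^k m n k))
    (solve-ℕ 4 (λ m n x y → m :*ℕ n :*ℕ (x :*ℕ y) :=ℕ m :*ℕ x :*ℕ (n :*ℕ y)) refl m n (m ℕ.^ k) (n ℕ.^ k))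

  floor-log : ∀ b n → 2 ℕ.≤ b → ∀ ℓ₀ → b ℕ.^ ℓ₀ ℕ.≤ n → ∃[ ℓ ] ℓ₀ ℕ.≤ ℓ × b ℕ.^ ℓ ℕ.≤ n × n ℕ.< b ℕ.^ suc ℓ
  floor-log b n 2≤b ℓ₀ = search n ℓ₀ (ℕ.≤-trans (k<2^k n) (ℕ.≤-trans (ℕ.^-monoˡ-≤ n 2≤b) (ℕ.^-monoʳ-≤ b {{b≢0}} (ℕ.m≤m+n n ℓ₀))))
    where
    b≢0 : ℕ.NonZero b
    b≢0 = ℕ.>-nonZero (ℕ.≤-trans (s≤s z≤n) 2≤b)
    search : ∀ j ℓ₀ → n ℕ.< b ℕ.^ (j ℕ.+ ℓ₀) → b ℕ.^ ℓ₀ ℕ.≤ n → ∃[ ℓ ] ℓ₀ ℕ.≤ ℓ × b ℕ.^ ℓ ℕ.≤ n × n ℕ.< b ℕ.^ suc ℓ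
    search zero    ℓ₀ n< ≤n = contradiction ≤n (ℕ.<⇒≱ n<)
    search (suc j) ℓ₀ n< ≤n with b ℕ.^ suc ℓ₀ ℕ.≤? n
    ... | no  ≰n = ℓ₀ , ℕ.≤-refl , ≤n , ℕ.≰⇒> ≰n
    ... | yes ≤n′ with search j (suc ℓ₀) (subst (λ e → n ℕ.< b ℕ.^ e) (sym (ℕ.+-suc j ℓ₀)) n<) ≤n′
    ...   | ℓ , ℓ₀<ℓ , rest = ℓ , ℕ.<⇒≤ ℓ₀<ℓ , rest

  -- B and a are chosen so that, over a blocks of n/22 steps, a decay by 9/10 per block is survived by one of
  -- B vertices, while decays by 20/23 and 25/27 per block beat the number of pairs of low degree and of vertices.
  opaque
    a B : ℕ
    a = 210
    B = 2 ℕ.^ 33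

    138≤a : 138 ℕ.≤ a
    138≤a = ℕ.≤ᵇ⇒≤ _ _ _

    a≤220 : a ℕ.≤ 220
    a≤220 = ℕ.≤ᵇ⇒≤ _ _ _

    640≤B : 640 ℕ.≤ B
    640≤B = ℕ.≤ᵇ⇒≤ _ _ _

    B-survive : 2 ℕ.* 10 ℕ.^ a ℕ.≤ B ℕ.* 9 ℕ.^ a
    B-survive = ℕ.≤ᵇ⇒≤ _ _ _

    B-isolated : 2 ℕ.* B ℕ.* 25 ℕ.^ (a ℕ.+ a) ℕ.≤ 1 ℕ.* 27 ℕ.^ (a ℕ.+ a)
    B-isolated = ℕ.≤ᵇ⇒≤ _ _ _

    B-low : 512 ℕ.* B ℕ.* 20 ℕ.^ a ℕ.≤ 1 ℕ.* 23 ℕ.^ a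
    B-low = ℕ.≤ᵇ⇒≤ _ _ _

  2≤B : 2 ℕ.≤ B
  2≤B = ℕ.≤-trans (ℕ.≤ᵇ⇒≤ 2 640 _) 640≤B

  opaque
    -- 2^(2a) outweighs the growth of the weight up to m₁, the factor 2 yields `h`, and B² beats the
    -- n choices of a vertex. Opaque, since the numbers are astronomical.
    A₀ D : ℕ
    A₀ = 2 ℕ.^ (a ℕ.+ a) ℕ.* (2 ℕ.* (B ℕ.* B))
    D  = A₀ ℕ.^ 8

    A₀≡ : A₀ ≡ 2 ℕ.^ (a ℕ.+ a) ℕ.* (2 ℕ.* (B ℕ.* B))
    A₀≡ = refl

    D≡A₀⁸ : D ≡ A₀ ℕ.^ 8
    D≡A₀⁸ = refl

  2≤A₀ : 2 ℕ.≤ A₀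
  2≤A₀ = ℕ.≤-trans (ℕ.*-mono-≤ (ℕ.m^n>0 2 (a ℕ.+ a)) (ℕ.*-monoʳ-≤ 2 (ℕ.*-mono-≤ 1≤B 1≤B))) (ℕ.≤-reflexive (sym A₀≡))
    where
    1≤B : 1 ℕ.≤ B
    1≤B = ℕ.≤-trans (s≤s z≤n) 2≤B

  256≤D : 256 ℕ.≤ D
  256≤D = ℕ.≤-trans (ℕ.^-monoˡ-≤ 8 2≤A₀) (ℕ.≤-reflexive (sym D≡A₀⁸))

  opaque
    T : ℕ → ℕ
    T K = 3 ℕ.* K ℕ.* D

    T≡3KD : ∀ K → T K ≡ 3 ℕ.* K ℕ.* D
    T≡3KD K = refl

  768≤T : ∀ K → 1 ℕ.≤ K → 768 ℕ.≤ T K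
  768≤T K 1≤K = ℕ.≤-trans (ℕ.*-mono-≤ {3} (ℕ.*-monoʳ-≤ 3 1≤K) 256≤D) (ℕ.≤-reflexive (sym (T≡3KD K)))

  opaque
    -- The first summand serves the union bound over large sets, the second makes the initial
    -- potential at most 1/(j + 1).
    ℓ₀ : ℕ → ℕ → ℕ
    ℓ₀ K j = T K ℕ.* T K ℕ.+ (4225 ℕ.* B ℕ.+ 11) ℕ.* suc j

    T²≤ℓ₀ : ∀ K j → T K ℕ.* T K ℕ.≤ ℓ₀ K j
    T²≤ℓ₀ K j = ℕ.m≤m+n _ _

    error≤ℓ₀ : ∀ K j → (4225 ℕ.* B ℕ.+ 11) ℕ.* suc j ℕ.≤ ℓ₀ K j
    error≤ℓ₀ K j = ℕ.m≤n+m _ _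

  -- Once the quotient is at least 22, one more copy of it absorbs the remainder; a smaller quotient
  -- would force n < 22² = 484.
  n/22-lower : ∀ n → 640 ℕ.≤ n → n ℕ.≤ 23 ℕ.* (n ℕ./ 22)
  n/22-lower n 640≤n = bound (n ℕ./ 22) (ℕ.≤-trans (s≤s (ℕ.≤-reflexive (m≡m%n+[m/n]*n n 22)))
    (ℕ.≤-trans (ℕ.+-monoˡ-≤ (n ℕ./ 22 ℕ.* 22) (m%n<n n 22)) (ℕ.≤-reflexive (ℕ.*-comm (suc (n ℕ./ 22)) 22))))
    where
    bound : ∀ k → n ℕ.< 22 ℕ.* suc k → n ℕ.≤ 23 ℕ.* k
    bound k n< = ℕ.≤-trans (ℕ.<⇒≤ n<) (ℕ.≤-trans (ℕ.≤-reflexive (solve-ℕ 1 (λ k → conℕ 22 :*ℕ (conℕ 1 :+ℕ k) :=ℕ conℕ 22 :+ℕ conℕ 22 :*ℕ k) refl k))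
      (ℕ.≤-trans (ℕ.+-monoˡ-≤ (22 ℕ.* k) 22≤k) (ℕ.≤-reflexive (solve-ℕ 1 (λ k → k :+ℕ conℕ 22 :*ℕ k :=ℕ conℕ 23 :*ℕ k) refl k))))
      where
      22≤k : 22 ℕ.≤ k
      22≤k = ℕ.≮⇒≥ λ k<22 → ℕ.<⇒≱ {n} {22 ℕ.* suc k} n< (ℕ.≤-trans {22 ℕ.* suc k} {640} (ℕ.≤-trans {22 ℕ.* suc k} {22 ℕ.* 22} (ℕ.*-monoʳ-≤ 22 k<22) (ℕ.≤ᵇ⇒≤ 484 640 _)) 640≤n)

  positive-reciprocal : ∀ m → 1 ℕ.≤ m → ∃[ y ] 0ℚ ≤ y × ι m * y ≡ 1ℚ
  positive-reciprocal m 1≤m = reciprocal (<-≤-trans (positive⁻¹ 1ℚ) (subst (_≤ ι m) ι1 (ι-mono-≤ 1≤m)))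

  -- The real bound is tested at the single rational ½ - 1/K, which exceeds ½ - ε because 1/K < ε.
  few-removed : ∀ (ε : ℝ) K {y} → ι K * y ≡ 1ℚ → ℝ.L ε y → ∀ d e → d ≤ ½ ⊖ ε · e → 2 ℕ.* K ℕ.* d ℕ.+ 2 ℕ.* e ℕ.≤ K ℕ.* e
  few-removed ε K {y} Ky≡1 Ly d e d≤ = uncast-≤ (K ∷ d ∷ e ∷ []) (# 2 ⊗ var 0F ⊗ var 1F ⊕ # 2 ⊗ var 2F) (var 0F ⊗ var 2F)
    (≤-modulo (ℕtoℚ 2 * ι e) Ky≡1
      (solve 4 (λ K y d e → K :* e :- (con (ℕtoℚ 2) :* K :* d :+ con (ℕtoℚ 2) :* e) :=
        con (ℕtoℚ 2) :* K :* ((con ½ :- y) :* e :- d) :+ con (ℕtoℚ 2) :* e :* (K :* y :- con 1ℚ)) refl (ι K) y (ι d) (ι e))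
      (0≤* (0≤* (≥0 (ℕtoℚ 2)) (0≤ι K)) (p≤q⇒0≤q-p (subst₂ (λ x z → x ≤ (½ - y) * z) (sym (ι≡ℕtoℚ d)) (sym (ι≡ℕtoℚ e))
        (d≤ (½ - y) (subst (ℝ.L ε) (solve 1 (λ y → y := con ½ :- (con ½ :- y)) refl y) Ly))))))

  module Scale (K j n : ℕ) (1≤K : 1 ℕ.≤ K) (n≥ : B ℕ.^ ℓ₀ K j ℕ.≤ n) where

    private
      scale = floor-log B n 2≤B (ℓ₀ K j) n≥

    ℓ k : ℕ
    ℓ = proj₁ scale
    k = n ℕ./ 22

    ℓ₀≤ℓ : ℓ₀ K j ℕ.≤ ℓ
    ℓ₀≤ℓ = proj₁ (proj₂ scale)

    B^ℓ≤n : B ℕ.^ ℓ ℕ.≤ n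
    B^ℓ≤n = proj₁ (proj₂ (proj₂ scale))

    n≤B^ℓ⁺¹ : n ℕ.≤ B ℕ.* B ℕ.^ ℓ
    n≤B^ℓ⁺¹ = ℕ.<⇒≤ (proj₂ (proj₂ (proj₂ scale)))

    T²≤ℓ : T K ℕ.* T K ℕ.≤ ℓ
    T²≤ℓ = ℕ.≤-trans (T²≤ℓ₀ K j) ℓ₀≤ℓ

    2≤ℓ : 2 ℕ.≤ ℓ
    2≤ℓ = ℕ.≤-trans (ℕ.≤-trans (ℕ.≤ᵇ⇒≤ 2 768 _) (ℕ.≤-trans (768≤T K 1≤K)
      (ℕ.m≤m*n (T K) (T K) {{ℕ.>-nonZero (ℕ.≤-trans (s≤s z≤n) (768≤T K 1≤K))}}))) T²≤ℓ

    1≤B : 1 ℕ.≤ B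
    1≤B = ℕ.≤-trans (s≤s z≤n) 2≤B

    2B≤B^ℓ : 2 ℕ.* B ℕ.≤ B ℕ.^ ℓ
    2B≤B^ℓ = ℕ.≤-trans (ℕ.*-monoˡ-≤ B 2≤B) (ℕ.≤-trans (ℕ.≤-reflexive (cong (B ℕ.*_) (sym (ℕ.*-identityʳ B))))
      (ℕ.^-monoʳ-≤ B {{ℕ.>-nonZero 1≤B}} 2≤ℓ))

    ℓ≤n : ℓ ℕ.≤ n
    ℓ≤n = ℕ.≤-trans (ℕ.<⇒≤ (k<2^k ℓ)) (ℕ.≤-trans (ℕ.^-monoˡ-≤ ℓ 2≤B) B^ℓ≤n)

    B≤n : B ℕ.≤ n
    B≤n = ℕ.≤-trans (ℕ.≤-trans (ℕ.m≤n*m B 2) 2B≤B^ℓ) B^ℓ≤n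

    1≤n : 1 ℕ.≤ n
    1≤n = ℕ.≤-trans 1≤B B≤n

    22k≤n : 22 ℕ.* k ℕ.≤ n
    22k≤n = ℕ.≤-trans (ℕ.≤-reflexive (ℕ.*-comm 22 k)) (m/n*n≤m n 22)

    n≤23k : n ℕ.≤ 23 ℕ.* k
    n≤23k = n/22-lower n (ℕ.≤-trans 640≤B B≤n)

    -- Each of the three factors is below a power with exponent ℓ: 160^ℓ, 2^ℓ and 2^ℓ. Their product
    -- 640^ℓ explains `640≤B`.
    large : 160 ℕ.* (T K ℕ.* T K) ℕ.* (ℓ ℕ.+ 1) ℕ.≤ n
    large = begin
      160 ℕ.* (T K ℕ.* T K) ℕ.* (ℓ ℕ.+ 1)
        ≤⟨ ℕ.*-mono-≤ (ℕ.*-mono-≤ 160≤160^ℓ (ℕ.≤-trans T²≤ℓ (ℕ.<⇒≤ (k<2^k ℓ)))) (ℕ.≤-trans (ℕ.≤-reflexive (ℕ.+-comm ℓ 1)) (k<2^k ℓ)) ⟩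
      160 ℕ.^ ℓ ℕ.* 2 ℕ.^ ℓ ℕ.* 2 ℕ.^ ℓ
        ≡⟨ trans (cong (ℕ._* 2 ℕ.^ ℓ) (sym ([m*n]^k 160 2 ℓ))) (sym ([m*n]^k 320 2 ℓ)) ⟩
      640 ℕ.^ ℓ
        ≤⟨ ℕ.^-monoˡ-≤ ℓ 640≤B ⟩
      B ℕ.^ ℓ
        ≤⟨ B^ℓ≤n ⟩
      n ∎
      where
      open ℕ.≤-Reasoning
      160≤160^ℓ : 160 ℕ.≤ 160 ℕ.^ ℓ
      160≤160^ℓ = ℕ.^-monoʳ-≤ 160 {1} {ℓ} (ℕ.≤-trans (s≤s z≤n) 2≤ℓ)

    private
      inv-n = positive-reciprocal n 1≤n
      inv-T = positive-reciprocal (T K) (ℕ.≤-trans (s≤s z≤n) (768≤T K 1≤K))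
      inv-A = positive-reciprocal A₀ (ℕ.≤-trans (s≤s z≤n) 2≤A₀)

    open Potentials.Family n ℓ k a A₀ D (T K) K (proj₁ inv-n) (proj₁ inv-T) (proj₁ inv-A)
      1≤K (ℕ.≤-trans (s≤s z≤n) 2≤A₀) a≤220 22k≤n D≡A₀⁸ (T≡3KD K) (768≤T K 1≤K) large
      (proj₁ (proj₂ inv-n)) (proj₂ (proj₂ inv-n)) (proj₁ (proj₂ inv-T)) (proj₂ (proj₂ inv-T))
      (proj₁ (proj₂ inv-A)) (proj₂ (proj₂ inv-A))

    open Initial B B^ℓ≤n n≤B^ℓ⁺¹ n≤23k 2B≤B^ℓ ℓ≤n T²≤ℓ 138≤a A₀≡ B-survive B-isolated B-low using (f-empty)

    potential : ℕ → Graph n → ℚ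
    potential = cutoff m₁ f

    good : Trajectory n → Bool
    good = below1 potential 0

    initial-error : potential 0 (emptyGraph n) ≤ 1ℤ / suc j
    initial-error = begin
      potential 0 (emptyGraph n)
        ≡⟨ cutoff-≤ {m = m₁} {f = f} {0} {emptyGraph n} z≤n ⟩
      f 0 (emptyGraph n)
        ≤⟨ f-empty ⟩
      c * ½ ^ ℓ
        ≡⟨ solve 2 (λ c h → c :* h := c :* con 1ℚ :* h) refl c (½ ^ ℓ) ⟩
      c * 1ℚ * ½ ^ ℓ
        ≡⟨ cong (λ x → c * x * ½ ^ ℓ) (1/suc j) ⟨
      c * (ι (suc j) * y) * ½ ^ ℓ
        ≡⟨ solve 4 (λ c s y h → c :* (s :* y) :* h := c :* s :* (y :* h)) refl c (ι (suc j)) y (½ ^ ℓ) ⟩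
      c * ι (suc j) * (y * ½ ^ ℓ)
        ≤⟨ *-monoʳ (y * ½ ^ ℓ) (0≤* (0≤1/suc j) (0≤^ (≥0 ½) ℓ)) c[j+1]≤2^ℓ ⟩
      ℕtoℚ 2 ^ ℓ * (y * ½ ^ ℓ)
        ≡⟨ trans (solve 3 (λ t y h → t :* (y :* h) := t :* h :* y) refl (ℕtoℚ 2 ^ ℓ) y (½ ^ ℓ))
             (cong (_* y) (trans (sym (^-distrib-* (ℕtoℚ 2) ½ ℓ)) (1^ ℓ))) ⟩
      1ℚ * y
        ≡⟨ *-identityˡ y ⟩
      y ∎
      where
      open ≤-Reasoning
      c y : ℚ
      c = ℕtoℚ 4225 * ι B + ℕtoℚ 11
      y = 1ℤ / suc j
      c[j+1]≤2^ℓ : c * ι (suc j) ≤ ℕtoℚ 2 ^ ℓ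
      c[j+1]≤2^ℓ = begin
        c * ι (suc j)  ≡⟨ ι-⟦⟧ ((# 4225 ⊗ var 0F ⊕ # 11) ⊗ var 1F) (B ∷ suc j ∷ []) ⟨
        ι ((4225 ℕ.* B ℕ.+ 11) ℕ.* suc j)  ≤⟨ ι-mono-≤ (ℕ.≤-trans (ℕ.≤-trans (error≤ℓ₀ K j) ℓ₀≤ℓ) (ℕ.<⇒≤ (k<2^k ℓ))) ⟩
        ι (2 ℕ.^ ℓ)  ≡⟨ trans (ι-^ 2 ℓ) (cong (_^ ℓ) (ι≡ℕtoℚ 2)) ⟩
        ℕtoℚ 2 ^ ℓ  ∎

    good-likely : 1ℚ - 1ℤ / suc j ≤ Pr (process n) good
    good-likely = ≤-trans (+-monoʳ-≤ 1ℚ (neg-antimono-≤ initial-error))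
      (ville {f = potential} (0≤cutoff {m = m₁} (f-potential .nonneg)) (cutoff-supermartingale f-potential) (n C 2) 0 (emptyGraph n)
        (#missing-empty n) (count-empty {n} (λ _ _ → 1)))

    -- Ensures that m₁ is an index of the trajectory, so that a time without isolated vertices
    -- exists and the search for the least one succeeds.
    m₁≤nC2 : m₁ ℕ.≤ n C 2
    m₁≤nC2 = ℕ.*-cancelʳ-≤ m₁ (n C 2) 2 (ℕ.+-cancelʳ-≤ n _ _ (ℕ.≤-trans
      (uncast-≤ (m₁ ∷ n ∷ []) (var 0F ⊗ # 2 ⊕ var 1F) (var 1F ⊗ var 1F) (≤-by
        (solve 3 (λ N L m → N :* N :- (m :* con (ℕtoℚ 2) :+ N) :=
          con (ℕtoℚ 2) :* (con (ℕtoℚ 20) :* (N :* L) :- m) :+ N :* (N :- con (ℕtoℚ 50000) :* (L :+ con 1ℚ))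
          :+ con (ℕtoℚ 49960) :* (N :* L) :+ con (ℕtoℚ 49999) :* N) refl N L (ι m₁))
        (0≤+ (0≤+ (0≤+ (0≤* (≥0 (ℕtoℚ 2)) (p≤q⇒0≤q-p (t≤20NL m₁ ℕ.≤-refl))) (0≤* 0≤N (p≤q⇒0≤q-p 50000[L+1]≤N)))
          (0≤* (≥0 (ℕtoℚ 49960)) (0≤* 0≤N (0≤ι ℓ)))) (0≤* (≥0 (ℕtoℚ 49999)) 0≤N))))
      (ℕ.≤-reflexive (sym (nC2 n)))))

    module Outcome (ω : Trajectory n) (ω-good : Bool.T (good ω)) where

      P : Fin (suc (n C 2)) → Set
      P m = 1 ℕ.≤ δ (lookup ω m)

      f<1 : ∀ m → toℕ m ℕ.≤ m₁ → f (toℕ m) (lookup ω m) < 1ℚ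
      f<1 m m≤m₁ = subst (_< 1ℚ) (cutoff-≤ {m = m₁} {f = f} {toℕ m} {lookup ω m} m≤m₁) (below1-lookup potential 0 ω ω-good m)

      last : Fin (suc (n C 2))
      last = fromℕ< (s≤s m₁≤nC2)

      last≡m₁ : toℕ last ≡ m₁
      last≡m₁ = Fin.toℕ-fromℕ< (s≤s m₁≤nC2)

      P-last : P last
      P-last = 1≤deg⇒1≤δ (lookup ω last) 1≤n
        (Consequences.none-isolated (toℕ last) (lookup ω last) (f<1 last (ℕ.≤-reflexive last≡m₁)) (ℕ.≤-reflexive (sym last≡m₁)))

      hitting : ∃[ τ₁ ] IsMin P τ₁
      hitting = least (λ m → 1 ℕ.≤? δ (lookup ω m)) last P-last

      τ₁ : Fin (suc (n C 2))
      τ₁ = proj₁ hitting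

      G : Graph n
      G = lookup ω τ₁

      1≤deg : ∀ v → 1 ℕ.≤ deg G v
      1≤deg = 1≤δ⇒1≤deg G (proj₁ (proj₂ hitting))

      τ₁≤m₁ : toℕ τ₁ ℕ.≤ m₁
      τ₁≤m₁ = subst (toℕ τ₁ ℕ.≤_) last≡m₁ (ℕ.≮⇒≥ λ last<τ₁ → proj₂ (proj₂ hitting) last last<τ₁ P-last)

      open Consequences (toℕ τ₁) G (f<1 τ₁ τ₁≤m₁)

      m₀≤τ₁ : m₀ ℕ.≤ toℕ τ₁
      m₀≤τ₁ = ℕ.<⇒≤ (ℕ.≰⇒> λ τ₁≤m₀ → contradiction (subst (1 ℕ.≤_) (1≤deg⇒none-isolated G 1≤deg) (some-isolated τ₁≤m₀)) λ ())

      resilient : ∀ (ε : ℝ) {y} → ι K * y ≡ 1ℚ → ℝ.L ε y → Resilient connectivity (½ ⊖ ε) G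
      resilient ε Ky≡1 Ly H H⊆G deg-H≤ = Connectivity.Robust.connected G ℓ K D 1≤K 1≤deg
        (low-degrees-apart m₀≤τ₁) small-sparse (large-expand m₀≤τ₁) H
        (λ v → few-removed ε K Ky≡1 Ly (deg H v) (deg G v) (deg-H≤ v))

-- The theorem: K from ε, and the threshold for n from η

open import Defs
open import Data.Nat.Base using (_≤_)
open import Data.Product.Base using (∃-syntax; _×_)
open import Data.Rational.Base using (½)
open import Data.Vec.Base using (lookup)

open import Data.Integer.Base using (1ℤ)
open import Data.Nat.Base using (_^_)
open import Data.Rational.Base using (0ℚ; 1ℚ; _/_)
import Data.Rational.Properties as ℚ
open EdgeProcess using (1/suc)
open Parameters

theorem1p3 : (ε : ℝ) → Positive ε →
    WithHighProbability process (λ n G →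
    ∃[ τ₁ ] IsMin (λ m → 1 ≤ δ (lookup G m)) τ₁
    × Resilient connectivity (½ ⊖ ε) (lookup G τ₁))
theorem1p3 ε 0<ε η 0<η = B ^ ℓ₀ K j , λ n n≥ → let open Scale K j n (s≤s z≤n) n≥ in
  good ,
  (λ ω ω-good → let open Outcome ω ω-good in τ₁ , proj₂ hitting , resilient ε (1/suc (proj₁ small-ε)) 1/K<ε) ,
  ℚ.≤-trans (ℚ.+-monoʳ-≤ 1ℚ (ℚ.neg-antimono-≤ (ℚ.<⇒≤ (proj₂ small-η)))) good-likely
  where
  small-η = archimedean 0<η
  j = proj₁ small-η
  -- Roundedness gives a positive rational below ε; by the Archimedean property 1/K is smaller
  -- still, hence in the lower cut of ε.
  below-ε = Equivalence.to (ℝ.L-rounded ε 0ℚ) 0<ε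
  small-ε = archimedean (proj₁ (proj₂ below-ε))
  K = suc (proj₁ small-ε)
  1/K<ε : ℝ.L ε (1ℤ / K)
  1/K<ε = Equivalence.from (ℝ.L-rounded ε (1ℤ / K)) (proj₁ below-ε , proj₂ small-ε , proj₂ (proj₂ below-ε))
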